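{- Let $q$ be a prime power, $k\ge 1$, and let $\mathfrak m,\mathfrak n$ be $k$-tuples of nonnegative integers. Then $$P_k(\mathfrak m;\mathfrak n)=\sum_{\substack{\mathfrak d\ge\mathfrak 0\\ \mathfrak d\le\mathfrak m,\ \mathfrak d\le\mathfrak n}}N_k(\mathfrak m-\mathfrak d)N_k(\mathfrak n-\mathfrak d)A_k(\mathfrak d),$$ where $$A_k(\mathfrak d)=\sum_{h\in\mathcal N_k(\mathfrak d)}\mu(h)=\sum_{(a_{\mathfrak i})}(-1)^{\sum_{\mathfrak i}a_{\mathfrak i}}\prod_{\mathfrak 0<\mathfrak i\le\mathfrak d}\binom{I_k(\mathfrak i)}{a_{\mathfrak i}},$$ the last sum being over all families $(a_{\mathfrak i})_{\mathfrak 0<\mathfrak i\le\mathfrak d}$ of nonnegative integers with $\sum_{\mathfrak 0<\mathfrak i\le\mathfrak d}a_{\mathfrak i}\mathfrak i=\mathfrak d$.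
   Context: $\mathbb F_q$ is the finite field with $q$ elements. Two polynomials in $\mathbb F_q[x_1,\dots,x_k]$ are identified if they differ by a factor in $\mathbb F_q^\times$; the classes are called normalized polynomials. The vector degree of a nonzero $f$ is $\operatorname{Deg} f=(\deg_{x_1}f,\dots,\deg_{x_k}f)$. $k$-tuples of nonnegative integers are ordered componentwise, $\mathfrak 0$ is the zero tuple, and $\mathfrak a<\mathfrak b$ means $\mathfrak a\le\mathfrak b$ and $\mathfrak a\ne\mathfrak b$. $\mathcal N_k(\mathfrak m)$ is the set of normalized polynomials $f\in\mathbb F_q[x_1,\dots,x_k]$ with $\operatorname{Deg} f=\mathfrak m$, $N_k(\mathfrak m)=|\mathcal N_k(\mathfrak m)|$, and $I_k(\mathfrak m)$ is the number of irreducible elements of $\mathcal N_k(\mathfrak m)$. $P_k(\mathfrak m;\mathfrak n)=|\{(f,g)\in\mathcal N_k(\mathfrak m)\times\mathcal N_k(\mathfrak n):\gcd(f,g)=1\}|$. The Möbius function $\mu$ on nonzero normalized polynomials is $\mu(h)=(-1)^s$ if $h$ is a product of $s$ distinct irreducibles, and $\mu(h)=0$ if $h$ is divisible by the square of an irreducible. -}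

module Defs where

open import Algebra.Bundles using (RawSemiring)
open import Algebra.Structures using (IsCommutativeRing)
import Algebra.Definitions.RawSemiring as RawSemiringDefinitions
open import Data.Fin.Base using (Fin)
open import Data.Integer.Base as ℤ using (ℤ; 0ℤ; -1ℤ)
open import Data.List.Base as List using (List; []; _∷_; upTo)
open import Data.List.Relation.Unary.All using (All)
open import Data.List.Relation.Unary.AllPairs using (AllPairs)
open import Data.Nat.Base as ℕ using (ℕ; suc)
open import Data.Nat.Combinatorics using (_C_)
open import Data.Nat.Primality using (Prime)
import Data.Nat.Properties as ℕₚ
open import Data.Product.Base using (∃-syntax; _×_; _,_; proj₁)
open import Data.Product.Relation.Binary.Pointwise.NonDependent using (_×ₛ_)
open import Data.Vec.Base as Vec using (Vec; []; _∷_; lookup; zipWith; replicate; fromList)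
import Data.Vec.Properties as Vecₚ
open import Data.Vec.Relation.Binary.Pointwise.Inductive as Pointwise using (Pointwise; []; _∷_)
open import Function.Base using (_∘_)
open import Function.Bundles using (Inverse; _↔_)
open import Level using (0ℓ)
open import Relation.Binary.Bundles using (Setoid)
import Relation.Binary.Construct.On as On
open import Relation.Binary.Definitions using (Decidable)
open import Relation.Binary.PropositionalEquality
open import Relation.Nullary using (¬_; Dec; yes; no; contradiction)
open import Relation.Nullary.Decidable using (¬?)

infix 10 big-sum

big-sum : {X : Set} → List X → (X → ℤ) → ℤ
big-sum xs f = List.foldr (λ x s → f x ℤ.+ s) 0ℤ xs

syntax big-sum xs (λ x → t) = ∑[ x ∈ xs ] t

------------------------------------------------------------------------
-- Tuples of natural numbers

infix  4 _≤ᵗ_ _≤ᵗ?_ _≟ᵗ_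
infixl 6 _+ᵗ_ _∸ᵗ_
infixl 7 _·ᵗ_

Tuple : ℕ → Set
Tuple k = Vec ℕ k

𝟘 : ∀ {k} → Tuple k
𝟘 = replicate _ 0

_≤ᵗ_ : ∀ {k} → Tuple k → Tuple k → Set
_≤ᵗ_ = Pointwise ℕ._≤_

_≤ᵗ?_ : ∀ {k} → Decidable (_≤ᵗ_ {k})
_≤ᵗ?_ = Pointwise.decidable ℕₚ._≤?_

_≟ᵗ_ : ∀ {k} (a b : Tuple k) → Dec (a ≡ b)
_≟ᵗ_ = Vecₚ.≡-dec ℕₚ._≟_

_+ᵗ_ _∸ᵗ_ : ∀ {k} → Tuple k → Tuple k → Tuple k
_+ᵗ_ = zipWith ℕ._+_
_∸ᵗ_ = zipWith ℕ._∸_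

_·ᵗ_ : ∀ {k} → ℕ → Tuple k → Tuple k
a ·ᵗ i = Vec.map (a ℕ.*_) i

-- The tuples a with 𝟘 ≤ a ≤ m, each listed exactly once.
box : ∀ {k} → Tuple k → List (Tuple k)
box []       = [] ∷ []
box (m ∷ ms) = List.cartesianProductWith _∷_ (upTo (suc m)) (box ms)

-- The tuples i with 𝟘 < i ≤ d.
positive : ∀ {k} → Tuple k → List (Tuple k)
positive d = List.filter (λ i → ¬? (i ≟ᵗ 𝟘)) (box d)

-- A family (aᵢ) of natural numbers indexed by 𝟘 < i ≤ d; its entries are
-- in the order of the list  positive d.
Family : ∀ {k} → Tuple k → Set
Family d = Vec ℕ (List.length (positive d))

-- ∑ᵢ aᵢ i
weight : ∀ {k} (d : Tuple k) → Family d → Tuple k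
weight d a = Vec.foldr _ _+ᵗ_ 𝟘 (zipWith _·ᵗ_ a (fromList (positive d)))

-- All families a with  weight d a ≡ d.  Restricting the entries to be at
-- most  Vec.sum d  loses nothing: each index i has a coordinate iⱼ ≥ 1, so
-- aᵢ ≤ aᵢ iⱼ ≤ dⱼ.
families : ∀ {k} (d : Tuple k) → List (Family d)
families d = List.filter (λ a → weight d a ≟ᵗ d) (box (replicate _ (Vec.sum d)))

------------------------------------------------------------------------
-- Finite sets, presented as setoids

Subset : (S : Setoid 0ℓ 0ℓ) → (Setoid.Carrier S → Set) → Setoid 0ℓ 0ℓ
Subset S Q = On.setoid S (proj₁ {B = Q})

record Finite (S : Setoid 0ℓ 0ℓ) : Set where
  field
    size        : ℕ
    enumeration : Inverse (setoid (Fin size)) S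

  elements : List (Setoid.Carrier S)
  elements = List.tabulate (Inverse.to enumeration)

open Finite using (size; elements)

------------------------------------------------------------------------
-- Finite fields

IsPrimePower : ℕ → Set
IsPrimePower q = ∃[ p ] ∃[ r ] Prime p × 1 ℕ.≤ r × q ≡ p ℕ.^ r

record FiniteField (q : ℕ) : Set₁ where
  infixl 6 _+_
  infixl 7 _*_
  field
    Carrier           : Set
    _+_ _*_           : Carrier → Carrier → Carrier
    -_                : Carrier → Carrier
    0# 1#             : Carrier
    isCommutativeRing : IsCommutativeRing _≡_ _+_ _*_ -_ 0# 1#
    1≢0               : 1# ≢ 0#
    inverse           : ∀ x → x ≢ 0# → ∃[ y ] x * y ≡ 1#
    enumeration       : Fin q ↔ Carrier

  open IsCommutativeRing isCommutativeRing public
    hiding (refl; sym; trans; reflexive)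

  x*y≡1⇒y≢0 : ∀ {x y} → x * y ≡ 1# → y ≢ 0#
  x*y≡1⇒y≢0 {x} eq refl = 1≢0 (trans (sym eq) (zeroʳ x))

  *-cancel-inverse : ∀ {x y} → x * y ≡ 1# → ∀ z → y * (x * z) ≡ z
  *-cancel-inverse {x} {y} eq z = begin
    y * (x * z)  ≡⟨ sym (*-assoc y x z) ⟩
    y * x * z    ≡⟨ cong (_* z) (trans (*-comm y x) eq) ⟩
    1# * z       ≡⟨ *-identityˡ z ⟩
    z            ∎
    where open ≡-Reasoning

  x*y≢0 : ∀ {x y} → x ≢ 0# → y ≢ 0# → x * y ≢ 0#
  x*y≢0 {x} {y} x≢0 y≢0 xy≡0 with x⁻¹ , eq ← inverse x x≢0 =
    y≢0 (trans (sym (*-cancel-inverse eq y)) (trans (cong (x⁻¹ *_) xy≡0) (zeroʳ x⁻¹)))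

------------------------------------------------------------------------
-- The polynomial ring F[x₁,…,xₖ]

module Polynomials {q : ℕ} (F : FiniteField q) (k : ℕ) where

  private
    module F = FiniteField F

  -- coeff e  is the coefficient of x₁^e₁ ⋯ xₖ^eₖ.  The bound only witnesses
  -- that the support is finite; equality of polynomials ignores it.
  record Poly : Set where
    field
      coeff  : Tuple k → F.Carrier
      bound  : Tuple k
      vanish : ∀ e → ¬ e ≤ᵗ bound → coeff e ≡ F.0#

  open Poly public

  infix  4 _≈_ _~_
  infixl 6 _+_
  infixl 7 _*_

  _≈_ : Poly → Poly → Set
  f ≈ g = ∀ e → coeff f e ≡ coeff g e

  const : F.Carrier → Poly
  const c = record { coeff = c-at-𝟘 ; bound = 𝟘 ; vanish = vanish′ }
    where
    c-at-𝟘 : Tuple k → F.Carrier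
    c-at-𝟘 e with e ≟ᵗ 𝟘
    ... | yes _ = c
    ... | no  _ = F.0#

    vanish′ : ∀ e → ¬ e ≤ᵗ 𝟘 → c-at-𝟘 e ≡ F.0#
    vanish′ e e≰𝟘 with e ≟ᵗ 𝟘
    ... | yes refl = contradiction (Pointwise.refl ℕₚ.≤-refl) e≰𝟘
    ... | no  _    = refl

  0ₚ 1ₚ : Poly
  0ₚ = const F.0#
  1ₚ = const F.1#

  _+_ : Poly → Poly → Poly
  f + g = record
    { coeff  = λ e → coeff f e F.+ coeff g e
    ; bound  = bound f +ᵗ bound g
    ; vanish = λ e e≰ → trans
        (cong₂ F._+_ (vanish f e (e≰ ∘ weakenˡ)) (vanish g e (e≰ ∘ weakenʳ)))
        (F.+-identityˡ F.0#)
    }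
    where
    weakenˡ : ∀ {n} {e a b : Tuple n} → e ≤ᵗ a → e ≤ᵗ a +ᵗ b
    weakenˡ {b = []}    []       = []
    weakenˡ {b = b ∷ _} (p ∷ ps) = ℕₚ.m≤n⇒m≤n+o b p ∷ weakenˡ ps

    weakenʳ : ∀ {n} {e a b : Tuple n} → e ≤ᵗ b → e ≤ᵗ a +ᵗ b
    weakenʳ {a = []}    []       = []
    weakenʳ {a = a ∷ _} (p ∷ ps) = ℕₚ.m≤n⇒m≤o+n a p ∷ weakenʳ ps

  _*_ : Poly → Poly → Poly
  f * g = record
    { coeff  = λ e → List.foldr (λ a s → term e a F.+ s) F.0# (box e)
    ; bound  = bound f +ᵗ bound g
    ; vanish = λ e e≰ → sum-vanish e e≰ (box e)
    }
    where
    term : Tuple k → Tuple k → F.Carrier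
    term e a = coeff f a F.* coeff g (e ∸ᵗ a)

    add-bounds : ∀ {n} (e a b c : Tuple n) → a ≤ᵗ b → e ∸ᵗ a ≤ᵗ c → e ≤ᵗ b +ᵗ c
    add-bounds []      []      []      []      []       []       = []
    add-bounds (e ∷ es) (a ∷ as) (b ∷ bs) (c ∷ cs) (p ∷ ps) (r ∷ rs) =
      ℕₚ.≤-trans (ℕₚ.m≤n+m∸n e a) (ℕₚ.+-mono-≤ p r) ∷ add-bounds es as bs cs ps rs

    term-vanish : ∀ e a → ¬ e ≤ᵗ bound f +ᵗ bound g → term e a ≡ F.0#
    term-vanish e a e≰ with a ≤ᵗ? bound f
    ... | no  a≰ = trans (cong (F._* _) (vanish f a a≰)) (F.zeroˡ _)
    ... | yes a≤ = trans
      (cong (_ F.*_) (vanish g (e ∸ᵗ a) (e≰ ∘ add-bounds e a _ _ a≤)))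
      (F.zeroʳ _)

    sum-vanish : ∀ e → ¬ e ≤ᵗ bound f +ᵗ bound g → ∀ as →
                 List.foldr (λ a s → term e a F.+ s) F.0# as ≡ F.0#
    sum-vanish e e≰ []       = refl
    sum-vanish e e≰ (a ∷ as) = trans
      (cong₂ F._+_ (term-vanish e a e≰) (sum-vanish e e≰ as))
      (F.+-identityˡ F.0#)

  polyRawSemiring : RawSemiring 0ℓ 0ℓ
  polyRawSemiring = record
    { Carrier = Poly ; _≈_ = _≈_ ; _+_ = _+_ ; _*_ = _*_ ; 0# = 0ₚ ; 1# = 1ₚ }

  open RawSemiringDefinitions polyRawSemiring public
    using (_∣_; Irreducible; Coprime)

  product : List Poly → Poly
  product = List.foldr _*_ 1ₚ

  ----------------------------------------------------------------------
  -- Normalized polynomials and vector degree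

  _~_ : Poly → Poly → Set
  f ~ g = ∃[ c ] c ≢ F.0# × (∀ e → coeff f e ≡ c F.* coeff g e)

  Normalized : Setoid 0ℓ 0ℓ
  Normalized = record
    { Carrier       = Poly
    ; _≈_           = _~_
    ; isEquivalence = record
      { refl  = λ {f} → F.1# , F.1≢0 , λ e → sym (F.*-identityˡ (coeff f e))
      ; sym   = λ {f} {g} → ~-sym {f} {g}
      ; trans = λ { (c , c≢0 , f≡cg) (d , d≢0 , g≡dh) →
                    c F.* d , F.x*y≢0 c≢0 d≢0 , λ e →
                    trans (f≡cg e) (trans (cong (c F.*_) (g≡dh e))
                                          (sym (F.*-assoc c d _))) }
      }
    }
    where
    ~-sym : ∀ {f g} → f ~ g → g ~ f
    ~-sym (c , c≢0 , f≡cg) with c⁻¹ , eq ← F.inverse c c≢0 =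
      c⁻¹ , F.x*y≡1⇒y≢0 eq , λ e →
      sym (trans (cong (c⁻¹ F.*_) (f≡cg e)) (F.*-cancel-inverse eq _))

  -- deg_{xᵢ} f = n
  HasDegreeIn : Fin k → Poly → ℕ → Set
  HasDegreeIn i f n =
    (∀ e → coeff f e ≢ F.0# → lookup e i ℕ.≤ n) ×
    (∃[ e ] coeff f e ≢ F.0# × lookup e i ≡ n)

  -- Deg f = m
  HasDegree : Tuple k → Poly → Set
  HasDegree m f = ¬ f ≈ 0ₚ × (∀ i → HasDegreeIn i f (lookup m i))

  𝒩 : Tuple k → Setoid 0ℓ 0ℓ
  𝒩 m = Subset Normalized (HasDegree m)

  IrreducibleIn𝒩 : Tuple k → Setoid 0ℓ 0ℓ
  IrreducibleIn𝒩 m = Subset (𝒩 m) (λ (f , _) → Irreducible f)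

  CoprimePairs : Tuple k → Tuple k → Setoid 0ℓ 0ℓ
  CoprimePairs m n = Subset (𝒩 m ×ₛ 𝒩 n) (λ ((f , _) , (g , _)) → Coprime f g)

  ----------------------------------------------------------------------
  -- The Möbius function

  -- Its value at 0 is left unspecified.
  record IsMöbius (μ : Poly → ℤ) : Set where
    field
      distinct : ∀ h (ps : List Poly) →
                 All Irreducible ps → AllPairs (λ p r → ¬ p ~ r) ps →
                 h ~ product ps →
                 μ h ≡ -1ℤ ℤ.^ List.length ps
      square   : ∀ h p → ¬ h ≈ 0ₚ → Irreducible p → p * p ∣ h → μ h ≡ 0ℤ

  ----------------------------------------------------------------------
  -- The counting functions

  -- Everything whose existence is implicit in the notation N, I, P, μ:
  -- finiteness of the sets being counted and well-definedness of μ.  The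
  -- cardinalities and the values of μ at nonzero polynomials do not depend
  -- on the choice of an element of this record.
  record CountingData : Set where
    field
      𝒩-finite              : ∀ m → Finite (𝒩 m)
      IrreducibleIn𝒩-finite : ∀ m → Finite (IrreducibleIn𝒩 m)
      CoprimePairs-finite   : ∀ m n → Finite (CoprimePairs m n)
      μ                     : Poly → ℤ
      isMöbius              : IsMöbius μ

    N I : Tuple k → ℕ
    N m = size (𝒩-finite m)
    I m = size (IrreducibleIn𝒩-finite m)

    P : Tuple k → Tuple k → ℕ
    P m n = size (CoprimePairs-finite m n)

    A : Tuple k → ℤ
    A d = ∑[ h ∈ elements (𝒩-finite d) ] μ (proj₁ h)

    -- ∏ᵢ (I(i) choose aᵢ)
    binomialProduct : (d : Tuple k) → Family d → ℕ
    binomialProduct d a =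
      Vec.foldr _ ℕ._*_ 1 (zipWith (λ aᵢ i → I i C aᵢ) a (fromList (positive d)))

{-# OPTIONS --safe #-}

-- Unique factorization in F[x₁,…,xₖ] is obtained by induction on k: Gauss's lemma, together
-- with a Euclidean algorithm that allows multiplication by nonzero elements of the smaller ring,
-- shows that irreducible elements are prime.
--
-- The first formula follows from ∑_{h ∣ f, h ∣ g} μ(h) = [gcd(f,g) = 1] by summing over f and g,
-- since a polynomial h of vector degree d has N(m − d) multiples of vector degree m.
-- For the second, μ(h) is the sum of (−1)^|s| over the sets s of irreducibles with product h;
-- the sets s are grouped by the numbers aᵢ of their elements of vector degree i.

module Submission where

open import Defs
open import Algebra.Bundles using (CommutativeRing; Semiring)
open import Algebra.Definitions.RawMagma using (_,_)
import Algebra.Definitions.RawSemiring as RawSemiringDefinitions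
import Algebra.Properties.CommutativeSemigroup as CommutativeSemigroupProperties
import Algebra.Properties.Ring as RingProperties
import Algebra.Properties.Semiring.Divisibility as SemiringDivisibility
import Algebra.Properties.Semiring.Primality as SemiringPrimality
open import Algebra.Structures using (IsCommutativeRing)
open import Data.Fin.Base using (Fin; zero; suc)
import Data.Fin.Properties as Finₚ
open import Data.Integer.Base as ℤ using (ℤ; 0ℤ; 1ℤ; -1ℤ)
import Data.Integer.Properties as ℤₚ
open import Data.List.Base as List using (List; []; _∷_; _++_; length; concatMap; upTo; cartesianProductWith)
open import Data.List.Membership.Propositional using (_∈_; lose; find)
import Data.List.Membership.Propositional.Properties as ∈ₚ
import Data.List.Properties as Listₚ
open import Data.List.Relation.Unary.All as All using (All; []; _∷_; all?)
import Data.List.Relation.Unary.All.Properties as Allₚ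
open import Data.List.Relation.Unary.AllPairs as AllPairs using (AllPairs; []; _∷_)
import Data.List.Relation.Unary.AllPairs.Properties as AllPairsₚ
open import Data.List.Relation.Unary.Any as Any using (Any; here; there; any?)
import Data.List.Relation.Unary.Any.Properties as Anyₚ
import Data.List.Relation.Unary.Unique.DecSetoid.Properties as UniqueDecSetoidₚ
open import Data.List.Relation.Unary.Unique.Propositional using (Unique)
import Data.List.Relation.Unary.Unique.Propositional.Properties as Uniqueₚ
open import Data.Maybe.Base using (nothing)
open import Data.Nat.Base as ℕ using (ℕ; zero; suc; z≤n; s≤s)
open import Data.Nat.Combinatorics using (_C_; nCk+nC[k+1]≡[n+1]C[k+1])
import Data.Nat.Properties as ℕₚ
open import Data.Product.Base using (∃-syntax; Σ; _×_; _,_; proj₁; proj₂)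
open import Data.Product.Relation.Binary.Pointwise.NonDependent using (_×ₛ_; ×-decidable)
open import Data.Sum.Base as Sum using (_⊎_; inj₁; inj₂)
open import Data.Vec.Base as Vec using (Vec; []; _∷_; lookup; fromList; zipWith; replicate)
import Data.Vec.Properties as Vecₚ
open import Data.Vec.Relation.Binary.Pointwise.Inductive as Pointwise using ([]; _∷_)
open import Function.Base using (_∘_)
open import Function.Bundles using (Inverse)
open import Function.Properties.Inverse using (↔⇒↣; ↔-sym)
open import Level using (0ℓ)
open import Relation.Binary.Bundles using (Setoid; DecSetoid)
open import Relation.Binary.Definitions using (Decidable; tri<; tri≈; tri>)
open import Relation.Binary.PropositionalEquality as ≡ using (_≡_; _≢_; module ≡-Reasoning)
import Relation.Binary.Reasoning.Setoid as SetoidReasoning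
open import Relation.Binary.Structures using (IsEquivalence)
open import Relation.Nullary using (¬_; Dec; yes; no; contradiction)
open import Relation.Nullary.Decidable as Dec using (¬?; _×-dec_; via-injection; decidable-stable)
open import Tactic.RingSolver using (solve-∀)
open import Tactic.RingSolver.Core.AlmostCommutativeRing using (AlmostCommutativeRing; fromCommutativeRing)

-- The ring of coefficients, polynomials in one variable fewer, is not a field, and no field of
-- fractions is formed. A constant that enters through division is removed afterwards, one
-- irreducible factor at a time: such a factor is prime in the larger ring by Gauss's lemma.
-- Euclid's algorithm is applied directly to a divisibility `p ∣ a * b`, so that no Bézout
-- coefficients occur.
--
-- Degrees add and the field is finite, so the divisors of a nonzero polynomial lie in an explicit
-- finite list. Divisibility, irreducibility and the existence of factorizations all rest on
-- searches through such lists.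
--
-- Classes of normalized polynomials are never formed as a quotient. A count runs over a list of
-- pairwise nonassociated representatives, and two such lists are compared by summing the indicator
-- of `~` over both and exchanging the sums. Coprimality is decided by looking for a common
-- irreducible factor; no greatest common divisor is constructed.

module RingIdentities (R : CommutativeRing 0ℓ 0ℓ) where

  private
    ring : AlmostCommutativeRing 0ℓ 0ℓ
    ring = fromCommutativeRing R (λ _ → nothing)

  open AlmostCommutativeRing ring

  +-medial : ∀ a b c d → (a + b) + (c + d) ≈ (a + c) + (b + d)
  +-medial = solve-∀ ring

  *-medial : ∀ a b c d → (a * b) * (c * d) ≈ (a * c) * (b * d)
  *-medial = solve-∀ ring

  *-left-comm : ∀ a b c → a * (b * c) ≈ b * (a * c)
  *-left-comm = solve-∀ ring

  regroup : ∀ q a r s f x → (q * a + r) + s * (f * (x * a)) ≈ (q + s * (f * x)) * a + r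
  regroup = solve-∀ ring

  regroup′ : ∀ u d a b → u * (d * a * b) ≈ (u * a) * (d * b)
  regroup′ u d a b = trans (*-congˡ (trans (*-congʳ (*-comm d a)) (*-assoc a d b))) (sym (*-assoc u a (d * b)))

-- Finite sums over lists

module Sums (R : CommutativeRing 0ℓ 0ℓ) where
  open CommutativeRing R
  open RingIdentities R using (+-medial)

  sum : {X : Set} → List X → (X → Carrier) → Carrier
  sum xs f = List.foldr (λ x s → f x + s) 0# xs

  private variable
    X Y Z : Set

  sum-cong-∈ : ∀ (xs : List X) {f g : X → Carrier} → (∀ {x} → x ∈ xs → f x ≈ g x) → sum xs f ≈ sum xs g
  sum-cong-∈ []       f≈g = refl
  sum-cong-∈ (x ∷ xs) f≈g = +-cong (f≈g (here ≡.refl)) (sum-cong-∈ xs (f≈g ∘ there))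

  sum-cong : ∀ (xs : List X) {f g : X → Carrier} → (∀ x → f x ≈ g x) → sum xs f ≈ sum xs g
  sum-cong xs f≈g = sum-cong-∈ xs (λ {x} _ → f≈g x)

  sum-0 : ∀ (xs : List X) → sum xs (λ _ → 0#) ≈ 0#
  sum-0 []       = refl
  sum-0 (x ∷ xs) = trans (+-identityˡ _) (sum-0 xs)

  sum-zero-∈ : ∀ (xs : List X) {f : X → Carrier} → (∀ {x} → x ∈ xs → f x ≈ 0#) → sum xs f ≈ 0#
  sum-zero-∈ xs f≈0 = trans (sum-cong-∈ xs f≈0) (sum-0 xs)

  sum-+ : ∀ (xs : List X) (f g : X → Carrier) → sum xs (λ x → f x + g x) ≈ sum xs f + sum xs g
  sum-+ []       f g = sym (+-identityˡ 0#)
  sum-+ (x ∷ xs) f g = trans (+-congˡ (sum-+ xs f g)) (+-medial (f x) (g x) (sum xs f) (sum xs g))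

  sum-*ˡ : ∀ (xs : List X) c (f : X → Carrier) → sum xs (λ x → c * f x) ≈ c * sum xs f
  sum-*ˡ []       c f = sym (zeroʳ c)
  sum-*ˡ (x ∷ xs) c f = trans (+-congˡ (sum-*ˡ xs c f)) (sym (distribˡ c (f x) (sum xs f)))

  sum-*ʳ : ∀ (xs : List X) c (f : X → Carrier) → sum xs (λ x → f x * c) ≈ sum xs f * c
  sum-*ʳ xs c f = trans (sum-cong xs (λ x → *-comm (f x) c)) (trans (sum-*ˡ xs c f) (*-comm c (sum xs f)))

  sum-++ : ∀ (xs ys : List X) (f : X → Carrier) → sum (xs ++ ys) f ≈ sum xs f + sum ys f
  sum-++ []       ys f = sym (+-identityˡ _)
  sum-++ (x ∷ xs) ys f = trans (+-congˡ (sum-++ xs ys f)) (sym (+-assoc _ _ _))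

  sum-map : ∀ (g : X → Y) (xs : List X) (f : Y → Carrier) → sum (List.map g xs) f ≡ sum xs (f ∘ g)
  sum-map g []       f = ≡.refl
  sum-map g (x ∷ xs) f = ≡.cong (f (g x) +_) (sum-map g xs f)

  sum-swap : ∀ (xs : List X) (ys : List Y) (f : X → Y → Carrier) →
             sum xs (λ x → sum ys (f x)) ≈ sum ys (λ y → sum xs (λ x → f x y))
  sum-swap []       ys f = sym (sum-0 ys)
  sum-swap (x ∷ xs) ys f =
    trans (+-congˡ (sum-swap xs ys f)) (sym (sum-+ ys (f x) (λ y → sum xs (λ x → f x y))))

  sum-cartesianProductWith : ∀ (c : X → Y → Z) xs ys (f : Z → Carrier) →
    sum (cartesianProductWith c xs ys) f ≈ sum xs (λ x → sum ys (λ y → f (c x y)))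
  sum-cartesianProductWith c []       ys f = refl
  sum-cartesianProductWith c (x ∷ xs) ys f =
    trans (sum-++ (List.map (c x) ys) _ f)
          (+-cong (reflexive (sum-map (c x) ys f)) (sum-cartesianProductWith c xs ys f))

-- Power series in several variables

module PowerSeries (R : CommutativeRing 0ℓ 0ℓ) where
  open CommutativeRing R
  open RingIdentities R
  open Sums R

  Series : ℕ → Set
  Series k = Tuple k → Carrier

  private variable
    k : ℕ

  infix  4 _≋_
  infixl 6 _⊕_
  infixl 7 _⊗_

  _≋_ : Series k → Series k → Set
  f ≋ g = ∀ e → f e ≈ g e

  _⊕_ : Series k → Series k → Series k
  (f ⊕ g) e = f e + g e

  zeroˢ : Series k
  zeroˢ _ = 0#

  slice : Series (suc k) → ℕ → Series k
  slice f n e = f (n ∷ e)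

  tail : Series (suc k) → Series (suc k)
  tail f e = f (suc (Vec.head e) ∷ Vec.tail e)

  -- The Cauchy product, computed from `f = f₀ + x · tail f` in the first variable. In this
  -- recursive form the ring laws follow by induction on the exponent, without reindexing of sums.
  _⊗_ : Series k → Series k → Series k
  _⊗_             f g []          = f [] * g []
  _⊗_ {k = suc _} f g (zero  ∷ e) = (slice f 0 ⊗ slice g 0) e
  _⊗_ {k = suc _} f g (suc n ∷ e) = (slice f 0 ⊗ slice g (suc n)) e + (tail f ⊗ g) (n ∷ e)

  oneˢ : Series k
  oneˢ []          = 1#
  oneˢ (zero  ∷ e) = oneˢ e
  oneˢ (suc _ ∷ e) = 0#

  ⊗-cong : ∀ {f f′ g g′ : Series k} → f ≋ f′ → g ≋ g′ → f ⊗ g ≋ f′ ⊗ g′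
  ⊗-cong p q []          = *-cong (p []) (q [])
  ⊗-cong p q (zero  ∷ e) = ⊗-cong (p ∘ (0 ∷_)) (q ∘ (0 ∷_)) e
  ⊗-cong p q (suc n ∷ e) = +-cong
    (⊗-cong (p ∘ (0 ∷_)) (q ∘ (suc n ∷_)) e)
    (⊗-cong (λ e → p (suc (Vec.head e) ∷ Vec.tail e)) q (n ∷ e))

  ⊗-distribˡ : ∀ (f g h : Series k) → f ⊗ (g ⊕ h) ≋ f ⊗ g ⊕ f ⊗ h
  ⊗-distribˡ f g h []          = distribˡ _ _ _
  ⊗-distribˡ f g h (zero  ∷ e) = ⊗-distribˡ (slice f 0) (slice g 0) (slice h 0) e
  ⊗-distribˡ f g h (suc n ∷ e) = trans
    (+-cong (⊗-distribˡ (slice f 0) (slice g (suc n)) (slice h (suc n)) e)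
            (⊗-distribˡ (tail f) g h (n ∷ e)))
    (+-medial _ _ _ _)

  ⊗-distribʳ : ∀ (f g h : Series k) → (g ⊕ h) ⊗ f ≋ g ⊗ f ⊕ h ⊗ f
  ⊗-distribʳ f g h []          = distribʳ _ _ _
  ⊗-distribʳ f g h (zero  ∷ e) = ⊗-distribʳ (slice f 0) (slice g 0) (slice h 0) e
  ⊗-distribʳ f g h (suc n ∷ e) = trans
    (+-cong (⊗-distribʳ (slice f (suc n)) (slice g 0) (slice h 0) e)
            (⊗-distribʳ f (tail g) (tail h) (n ∷ e)))
    (+-medial _ _ _ _)

  ⊗-zeroˡ : ∀ (f : Series k) → zeroˢ ⊗ f ≋ zeroˢ
  ⊗-zeroˡ f []          = zeroˡ _
  ⊗-zeroˡ f (zero  ∷ e) = ⊗-zeroˡ (slice f 0) e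
  ⊗-zeroˡ f (suc n ∷ e) = trans
    (+-cong (⊗-zeroˡ (slice f (suc n)) e) (⊗-zeroˡ f (n ∷ e))) (+-identityˡ 0#)

  ⊗-identityˡ : ∀ (f : Series k) → oneˢ ⊗ f ≋ f
  ⊗-identityˡ f []          = *-identityˡ _
  ⊗-identityˡ f (zero  ∷ e) = ⊗-identityˡ (slice f 0) e
  ⊗-identityˡ f (suc n ∷ e) = trans
    (+-cong (⊗-identityˡ (slice f (suc n)) e) (⊗-zeroˡ f (n ∷ e))) (+-identityʳ _)

  ·-⊗ : ∀ c (f g : Series k) → (λ e → c * f e) ⊗ g ≋ (λ e → c * (f ⊗ g) e)
  ·-⊗ c f g []          = *-assoc _ _ _
  ·-⊗ c f g (zero  ∷ e) = ·-⊗ c (slice f 0) (slice g 0) e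
  ·-⊗ c f g (suc n ∷ e) = trans
    (+-cong (·-⊗ c (slice f 0) (slice g (suc n)) e) (·-⊗ c (tail f) g (n ∷ e)))
    (sym (distribˡ c _ _))

  -- The mirror image of the defining recursion, with `g` decomposed in place of `f`; commutativity
  -- depends on having both.
  ⊗-suc : ∀ (f g : Series (suc k)) n e →
          (f ⊗ g) (suc n ∷ e) ≈ (f ⊗ tail g) (n ∷ e) + (slice f (suc n) ⊗ slice g 0) e
  ⊗-suc f g zero    e = refl
  ⊗-suc f g (suc n) e = trans (+-congˡ (⊗-suc (tail f) g n e)) (sym (+-assoc _ _ _))

  ⊗-comm : ∀ (f g : Series k) → f ⊗ g ≋ g ⊗ f
  ⊗-comm f g []          = *-comm _ _
  ⊗-comm f g (zero  ∷ e) = ⊗-comm (slice f 0) (slice g 0) e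
  ⊗-comm f g (suc n ∷ e) = trans
    (+-cong (⊗-comm (slice f 0) (slice g (suc n)) e) (⊗-comm (tail f) g (n ∷ e)))
    (trans (+-comm _ _) (sym (⊗-suc g f n e)))

  -- The product of `g` with `a`, where `a` is regarded as a series constant in the first variable.
  scale : Series k → Series (suc k) → Series (suc k)
  scale a g e = (a ⊗ slice g (Vec.head e)) (Vec.tail e)

  mutual
    -- By the recursion, `tail (f ⊗ g)` is `scale (slice f 0) (tail g) ⊕ tail f ⊗ g`. After
    -- multiplication by `h`, the first summand is handled by `scale-⊗` and the second by the
    -- induction hypothesis.
    ⊗-assoc : ∀ (f g h : Series k) → (f ⊗ g) ⊗ h ≋ f ⊗ (g ⊗ h)
    ⊗-assoc f g h []          = *-assoc _ _ _
    ⊗-assoc f g h (zero  ∷ e) = ⊗-assoc (slice f 0) (slice g 0) (slice h 0) e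
    ⊗-assoc f g h (suc n ∷ e) = begin
      ((slice f 0 ⊗ slice g 0) ⊗ slice h (suc n)) e + (tail (f ⊗ g) ⊗ h) (n ∷ e)
        ≈⟨ +-cong (⊗-assoc (slice f 0) (slice g 0) (slice h (suc n)) e)
                  (trans tailProduct
                         (+-cong (scale-⊗ (slice f 0) (tail g) h n e) (⊗-assoc (tail f) g h (n ∷ e)))) ⟩
      (slice f 0 ⊗ (slice g 0 ⊗ slice h (suc n))) e +
      ((slice f 0 ⊗ slice (tail g ⊗ h) n) e + (tail f ⊗ (g ⊗ h)) (n ∷ e))
        ≈⟨ sym (+-assoc _ _ _) ⟩
      (slice f 0 ⊗ (slice g 0 ⊗ slice h (suc n))) e + (slice f 0 ⊗ slice (tail g ⊗ h) n) e
        + (tail f ⊗ (g ⊗ h)) (n ∷ e)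
        ≈⟨ +-congʳ (sym (⊗-distribˡ (slice f 0) (slice g 0 ⊗ slice h (suc n)) (slice (tail g ⊗ h) n) e)) ⟩
      (f ⊗ (g ⊗ h)) (suc n ∷ e) ∎
      where
      open SetoidReasoning setoid
      tailProduct : (tail (f ⊗ g) ⊗ h) (n ∷ e) ≈
                    (scale (slice f 0) (tail g) ⊗ h) (n ∷ e) + ((tail f ⊗ g) ⊗ h) (n ∷ e)
      tailProduct = trans
        (⊗-cong {f = tail (f ⊗ g)} {scale (slice f 0) (tail g) ⊕ tail f ⊗ g} {h} {h}
                (λ { (_ ∷ _) → refl }) (λ _ → refl) (n ∷ e))
        (⊗-distribʳ h (scale (slice f 0) (tail g)) (tail f ⊗ g) (n ∷ e))

    scale-⊗ : ∀ (a : Series k) (g h : Series (suc k)) n e →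
              (scale a g ⊗ h) (n ∷ e) ≈ (a ⊗ slice (g ⊗ h) n) e
    scale-⊗ a g h zero    e = ⊗-assoc a (slice g 0) (slice h 0) e
    scale-⊗ a g h (suc n) e = trans
      (+-cong (⊗-assoc a (slice g 0) (slice h (suc n)) e) (scale-⊗ a (tail g) h n e))
      (sym (⊗-distribˡ a (slice g 0 ⊗ slice h (suc n)) (slice (tail g ⊗ h) n) e))

  -- The right side is the convolution by which polynomials are multiplied, so the laws of `⊗` carry
  -- over to polynomials.
  ⊗-box : ∀ (f g : Series k) e → (f ⊗ g) e ≈ sum (box e) (λ a → f a * g (e ∸ᵗ a))
  ⊗-box f g []      = sym (+-identityʳ _)
  ⊗-box f g (n ∷ e) = trans (outer f n) (sym (sum-cartesianProductWith _∷_ (upTo (suc n)) (box e) _))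
    where
    term : Series _ → ℕ → ℕ → Carrier
    term f n i = sum (box e) (λ a → f (i ∷ a) * g ((n ℕ.∸ i) ∷ (e ∸ᵗ a)))
    outer : ∀ f n → (f ⊗ g) (n ∷ e) ≈ sum (upTo (suc n)) (term f n)
    outer f zero    = trans (⊗-box (slice f 0) (slice g 0) e) (sym (+-identityʳ _))
    outer f (suc n) = +-cong (⊗-box (slice f 0) (slice g (suc n)) e) (begin
      (tail f ⊗ g) (n ∷ e)                                  ≈⟨ outer (tail f) n ⟩
      sum (upTo (suc n)) (λ i → term f (suc n) (suc i))     ≡⟨ sum-map suc (upTo (suc n)) (term f (suc n)) ⟨
      sum (List.map suc (upTo (suc n))) (term f (suc n))    ≡⟨ ≡.cong (λ is → sum is (term f (suc n))) (Listₚ.map-upTo suc (suc n)) ⟩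
      sum (List.applyUpTo suc (suc n)) (term f (suc n))     ∎)
      where open SetoidReasoning setoid

-- Polynomials over a finite field form a commutative ring

≤ᵗ-refl : ∀ {k} {a : Tuple k} → a ≤ᵗ a
≤ᵗ-refl = Pointwise.refl ℕₚ.≤-refl

fieldRing : ∀ {q} → FiniteField q → CommutativeRing 0ℓ 0ℓ
fieldRing F = record { isCommutativeRing = FiniteField.isCommutativeRing F }

module PolynomialRing {q : ℕ} (F : FiniteField q) where
  open CommutativeRing (fieldRing F) using (ring)
    renaming (_+_ to _+ᶜ_; -_ to -ᶜ_; 0# to 0ᶜ; 1# to 1ᶜ)
  private
    module C = CommutativeRing (fieldRing F)
  open PowerSeries (fieldRing F)

  oneˢ-𝟘 : ∀ {n} → oneˢ (𝟘 {n}) ≡ 1ᶜ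
  oneˢ-𝟘 {zero}  = ≡.refl
  oneˢ-𝟘 {suc n} = oneˢ-𝟘 {n}

  oneˢ-≢ : ∀ {n} (e : Tuple n) → e ≢ 𝟘 → oneˢ e ≡ 0ᶜ
  oneˢ-≢ []          e≢𝟘 = contradiction ≡.refl e≢𝟘
  oneˢ-≢ (zero  ∷ e) e≢𝟘 = oneˢ-≢ e (e≢𝟘 ∘ ≡.cong (0 ∷_))
  oneˢ-≢ (suc _ ∷ e) e≢𝟘 = ≡.refl

  module _ (k : ℕ) where
    open Polynomials F k

    coeff-const-𝟘 : ∀ c → coeff (const c) 𝟘 ≡ c
    coeff-const-𝟘 c with 𝟘 {k} ≟ᵗ 𝟘
    ... | yes _   = ≡.refl
    ... | no  𝟘≢𝟘 = contradiction ≡.refl 𝟘≢𝟘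

    coeff-const-≢ : ∀ c {e} → e ≢ 𝟘 → coeff (const c) e ≡ 0ᶜ
    coeff-const-≢ c {e} e≢𝟘 with e ≟ᵗ 𝟘
    ... | yes e≡𝟘 = contradiction e≡𝟘 e≢𝟘
    ... | no  _   = ≡.refl

    opaque
      coeff-0 : ∀ e → coeff 0ₚ e ≡ 0ᶜ
      coeff-0 e with e ≟ᵗ 𝟘
      ... | yes _ = ≡.refl
      ... | no  _ = ≡.refl

    opaque
      coeff-1 : coeff 1ₚ ≋ oneˢ
      coeff-1 e with e ≟ᵗ 𝟘
      ... | yes ≡.refl = ≡.sym (oneˢ-𝟘 {k})
      ... | no  e≢𝟘    = ≡.sym (oneˢ-≢ e e≢𝟘)

    opaque
      coeff-* : ∀ f g → coeff (f * g) ≋ coeff f ⊗ coeff g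
      coeff-* f g e = ≡.sym (⊗-box (coeff f) (coeff g) e)

    neg : Poly → Poly
    neg f = record
      { coeff  = λ e → -ᶜ coeff f e
      ; bound  = bound f
      ; vanish = λ e e≰ → ≡.trans (≡.cong -ᶜ_ (vanish f e e≰)) (RingProperties.-0#≈0# ring)
      }

    private
      *-cong : ∀ {f f′ g g′} → f ≈ f′ → g ≈ g′ → f * g ≈ f′ * g′
      *-cong {f} {f′} {g} {g′} p q e = ≡.trans (coeff-* f g e)
        (≡.trans (⊗-cong p q e) (≡.sym (coeff-* f′ g′ e)))

      *-assoc : ∀ f g h → (f * g) * h ≈ f * (g * h)
      *-assoc f g h e = begin
        coeff ((f * g) * h) e                  ≡⟨ coeff-* (f * g) h e ⟩
        (coeff (f * g) ⊗ coeff h) e            ≡⟨ ⊗-cong {g = coeff h} (coeff-* f g) (λ _ → ≡.refl) e ⟩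
        ((coeff f ⊗ coeff g) ⊗ coeff h) e      ≡⟨ ⊗-assoc (coeff f) (coeff g) (coeff h) e ⟩
        (coeff f ⊗ (coeff g ⊗ coeff h)) e      ≡⟨ ⊗-cong {f = coeff f} (λ _ → ≡.refl) (coeff-* g h) e ⟨
        (coeff f ⊗ coeff (g * h)) e            ≡⟨ coeff-* f (g * h) e ⟨
        coeff (f * (g * h)) e                  ∎
        where open ≡.≡-Reasoning

      *-comm : ∀ f g → f * g ≈ g * f
      *-comm f g e = ≡.trans (coeff-* f g e)
        (≡.trans (⊗-comm (coeff f) (coeff g) e) (≡.sym (coeff-* g f e)))

      *-identityˡ : ∀ f → 1ₚ * f ≈ f
      *-identityˡ f e = ≡.trans (coeff-* 1ₚ f e)
        (≡.trans (⊗-cong {g = coeff f} coeff-1 (λ _ → ≡.refl) e) (⊗-identityˡ (coeff f) e))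

      distribˡ : ∀ f g h → f * (g + h) ≈ f * g + f * h
      distribˡ f g h e = ≡.trans (coeff-* f (g + h) e)
        (≡.trans (⊗-distribˡ (coeff f) (coeff g) (coeff h) e)
                 (≡.sym (≡.cong₂ _+ᶜ_ (coeff-* f g e) (coeff-* f h e))))

    opaque
      poly-isCommutativeRing : IsCommutativeRing _≈_ _+_ _*_ neg 0ₚ 1ₚ
      poly-isCommutativeRing = record
        { isRing = record
          { +-isAbelianGroup = record
            { isGroup = record
              { isMonoid = record
                { isSemigroup = record
                  { isMagma = record
                    { isEquivalence = record
                      { refl = λ _ → ≡.refl ; sym = λ p e → ≡.sym (p e) ; trans = λ p q e → ≡.trans (p e) (q e) }
                    ; ∙-cong = λ p q e → ≡.cong₂ _+ᶜ_ (p e) (q e)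
                    }
                  ; assoc = λ f g h e → C.+-assoc _ _ _
                  }
                ; identity = (λ f e → ≡.trans (≡.cong (_+ᶜ _) (coeff-0 e)) (C.+-identityˡ _))
                           , (λ f e → ≡.trans (≡.cong (_ +ᶜ_) (coeff-0 e)) (C.+-identityʳ _))
                }
              ; inverse = (λ f e → ≡.trans (C.-‿inverseˡ _) (≡.sym (coeff-0 e)))
                        , (λ f e → ≡.trans (C.-‿inverseʳ _) (≡.sym (coeff-0 e)))
              ; ⁻¹-cong = λ p e → ≡.cong -ᶜ_ (p e)
              }
            ; comm = λ f g e → C.+-comm _ _
            }
          ; *-cong = λ {f} {f′} {g} {g′} → *-cong {f} {f′} {g} {g′}
          ; *-assoc = *-assoc
          ; *-identity = *-identityˡ , (λ f e → ≡.trans (*-comm f 1ₚ e) (*-identityˡ f e))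
          ; distrib = distribˡ , (λ f g h e → ≡.trans (*-comm (g + h) f e)
              (≡.trans (distribˡ f g h e) (≡.cong₂ _+ᶜ_ (*-comm f g e) (*-comm f h e))))
          }
        ; *-comm = *-comm
        }

    polyRing : CommutativeRing 0ℓ 0ℓ
    polyRing = record { isCommutativeRing = poly-isCommutativeRing }

-- Adjoining one variable

-- L = K[X]; slice f n is the coefficient of Xⁿ.
record PolynomialExtension (K L : CommutativeRing 0ℓ 0ℓ) : Set where
  private
    module K = CommutativeRing K
    module L = CommutativeRing L
  field
    slice       : L.Carrier → ℕ → K.Carrier
    ι           : K.Carrier → L.Carrier
    X           : L.Carrier
    tail        : L.Carrier → L.Carrier
    slice-cong  : ∀ {f g} → f L.≈ g → ∀ n → slice f n K.≈ slice g n
    slice-ext   : ∀ {f g} → (∀ n → slice f n K.≈ slice g n) → f L.≈ g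
    slice-+     : ∀ f g n → slice (f L.+ g) n K.≈ slice f n K.+ slice g n
    slice-ι-0   : ∀ a → slice (ι a) 0 K.≈ a
    slice-ι-suc : ∀ a n → slice (ι a) (suc n) K.≈ K.0#
    slice-ι*    : ∀ a f n → slice (ι a L.* f) n K.≈ a K.* slice f n
    slice-X*-0  : ∀ f → slice (X L.* f) 0 K.≈ K.0#
    slice-X*    : ∀ f n → slice (X L.* f) (suc n) K.≈ slice f n
    slice-0-*   : ∀ f g → slice (f L.* g) 0 K.≈ slice f 0 K.* slice g 0
    slice-tail  : ∀ f n → slice (tail f) n K.≈ slice f (suc n)
    degreeBound : L.Carrier → ℕ
    slice-big   : ∀ f n → degreeBound f ℕ.≤ n → slice f n K.≈ K.0#

module _ {q : ℕ} (F : FiniteField q) (k : ℕ) where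
  open PolynomialRing F
  open PowerSeries (fieldRing F) using (_⊗_; _≋_; oneˢ; ⊗-cong; ⊗-zeroˡ; ⊗-identityˡ)
  private
    module F = FiniteField F
    module K = Polynomials F k
    module L = Polynomials F (suc k)
    module PS = PowerSeries (fieldRing F)

    slice : L.Poly → ℕ → K.Poly
    slice f n = record
      { coeff  = λ e → L.coeff f (n ∷ e)
      ; bound  = Vec.tail (L.bound f)
      ; vanish = λ e e≰ → L.vanish f (n ∷ e) (e≰ ∘ lemma (L.bound f))
      }
      where
      lemma : ∀ {e} (b : Tuple (suc k)) → n ∷ e ≤ᵗ b → e ≤ᵗ Vec.tail b
      lemma (_ ∷ _) (_ ∷ e≤) = e≤

    tail : L.Poly → L.Poly
    tail f = record
      { coeff  = PS.tail (L.coeff f)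
      ; bound  = L.bound f
      ; vanish = λ { (n ∷ e) e≰ → L.vanish f (suc n ∷ e) (e≰ ∘ lemma) }
      }
      where
      lemma : ∀ {n e} {b : Tuple (suc k)} → suc n ∷ e ≤ᵗ b → n ∷ e ≤ᵗ b
      lemma (n≤ ∷ e≤) = ℕₚ.<⇒≤ n≤ ∷ e≤

    ι : K.Poly → L.Poly
    ι a = record
      { coeff  = λ { (zero ∷ e) → K.coeff a e ; (suc _ ∷ _) → F.0# }
      ; bound  = 0 ∷ K.bound a
      ; vanish = λ { (zero ∷ e) e≰ → K.vanish a e (e≰ ∘ (z≤n ∷_)) ; (suc _ ∷ _) _ → ≡.refl }
      }

    X : L.Poly
    X = record
      { coeff  = λ { (1 ∷ e) → oneˢ e ; _ → F.0# }
      ; bound  = 1 ∷ 𝟘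
      ; vanish = λ { (0 ∷ e) _ → ≡.refl
                   ; (1 ∷ e) e≰ → oneˢ-≢ e (λ { ≡.refl → e≰ ≤ᵗ-refl })
                   ; (suc (suc _) ∷ _) _ → ≡.refl }
      }

    opaque
      slice-ι* : ∀ a f n → slice (ι a L.* f) n K.≈ a K.* slice f n
      slice-ι* a f n e = ≡.trans (coeff-* (suc k) (ι a) f (n ∷ e)) (≡.trans (go n) (≡.sym (coeff-* k a (slice f n) e)))
        where
        go : ∀ n → (L.coeff (ι a) ⊗ L.coeff f) (n ∷ e) ≡ (K.coeff a ⊗ K.coeff (slice f n)) e
        go zero    = ≡.refl
        go (suc n) = ≡.trans
          (≡.cong ((K.coeff a ⊗ K.coeff (slice f (suc n))) e F.+_) (⊗-zeroˡ (L.coeff f) (n ∷ e)))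
          (F.+-identityʳ _)

    opaque
      slice-X*-0 : ∀ f → slice (X L.* f) 0 K.≈ K.0ₚ
      slice-X*-0 f e = ≡.trans (coeff-* (suc k) X f (0 ∷ e))
        (≡.trans (⊗-zeroˡ _ e) (≡.sym (coeff-0 k e)))

    opaque
      slice-X* : ∀ f n → slice (X L.* f) (suc n) K.≈ slice f n
      slice-X* f n e = ≡.trans (coeff-* (suc k) X f (suc n ∷ e)) (≡.trans
        (≡.cong₂ F._+_
          (⊗-zeroˡ (L.coeff f ∘ (suc n ∷_)) e)
          (≡.trans (⊗-cong {f = PS.tail (L.coeff X)} {oneˢ} {L.coeff f} tail-X (λ _ → ≡.refl) (n ∷ e))
                   (⊗-identityˡ (L.coeff f) (n ∷ e))))
        (F.+-identityˡ _))
        where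
        tail-X : PS.tail (L.coeff X) ≋ oneˢ
        tail-X (zero  ∷ _) = ≡.refl
        tail-X (suc _ ∷ _) = ≡.refl

    opaque
      slice-0-* : ∀ f g → slice (f L.* g) 0 K.≈ slice f 0 K.* slice g 0
      slice-0-* f g e = ≡.trans (coeff-* (suc k) f g (0 ∷ e)) (≡.sym (coeff-* k (slice f 0) (slice g 0) e))

  polynomialExtension : PolynomialExtension (polyRing k) (polyRing (suc k))
  polynomialExtension = record
    { slice       = slice
    ; ι           = ι
    ; X           = X
    ; tail        = tail
    ; slice-cong  = λ f≈g n e → f≈g (n ∷ e)
    ; slice-ext   = λ { eq (n ∷ e) → eq n e }
    ; slice-+     = λ _ _ _ _ → ≡.refl
    ; slice-ι-0   = λ _ _ → ≡.refl
    ; slice-ι-suc = λ _ _ e → ≡.sym (coeff-0 k e)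
    ; slice-ι*    = slice-ι*
    ; slice-X*-0  = slice-X*-0
    ; slice-X*    = slice-X*
    ; slice-0-*   = slice-0-*
    ; slice-tail  = λ _ _ _ → ≡.refl
    -- `bound` is inclusive whereas `degreeBound` is exclusive, hence the successor.
    ; degreeBound = λ f → suc (Vec.head (L.bound f))
    ; slice-big   = λ f n n> e → ≡.trans (L.vanish f (n ∷ e) (big (L.bound f) n>)) (≡.sym (coeff-0 k e))
    }
    where
    big : ∀ {n e} (b : Tuple (suc k)) → Vec.head b ℕ.< n → ¬ n ∷ e ≤ᵗ b
    big (_ ∷ _) n> (n≤ ∷ _) = ℕₚ.<⇒≱ n> n≤

-- Divisibility, factorizations and zero divisors

module Divisibility (R : CommutativeRing 0ℓ 0ℓ) where
  open CommutativeRing R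
  open RawSemiringDefinitions (Semiring.rawSemiring semiring) public using (_∣_; _∤_; Coprime; Irreducible; mkIrred)
  open SemiringDivisibility semiring public
    using (∣-trans; ∣-respˡ; ∣-respʳ; _∣0; x∣ʳyx; x∣ʳy⇒x∣ʳzy; 0∣x⇒x≈0)
  open SemiringPrimality semiring public using (Irreducible⇒≉0)
  open RingProperties ring

  x∣xy : ∀ x y → x ∣ x * y
  x∣xy x y = y , *-comm y x

  x∣y⇒x∣yz : ∀ {x y} z → x ∣ y → x ∣ y * z
  x∣y⇒x∣yz {x} {y} z x∣y = ∣-respʳ (*-comm z y) (x∣ʳy⇒x∣ʳzy z x∣y)

  *-mono-∣ : ∀ {x y} z → x ∣ y → z * x ∣ z * y
  *-mono-∣ {x} {y} z (q , qx≈y) =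
    q , trans (RingIdentities.*-left-comm R q z x) (*-congˡ qx≈y)

  ∣-+ : ∀ {x y z} → x ∣ y → x ∣ z → x ∣ y + z
  ∣-+ {x} (q , qx≈y) (r , rx≈z) = q + r , trans (distribʳ x q r) (+-cong qx≈y rx≈z)

  ∣-+-cancel : ∀ {x} y z → x ∣ y → x ∣ y + z → x ∣ z
  ∣-+-cancel {x} y z (q , qx≈y) x∣y+z = ∣-respʳ (begin
    - y + (y + z)  ≈⟨ +-assoc (- y) y z ⟨
    (- y + y) + z  ≈⟨ +-congʳ (-‿inverseˡ y) ⟩
    0# + z         ≈⟨ +-identityˡ z ⟩
    z              ∎) (∣-+ (- q , trans (sym (-‿distribˡ-* q x)) (-‿cong qx≈y)) x∣y+z)
    where open SetoidReasoning setoid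

  -- The main clause of primality, without excluding zero and units: that `0#` splits means that
  -- there are no zero divisors.
  Splits : Carrier → Set
  Splits p = ∀ {x y} → p ∣ x * y → p ∣ x ⊎ p ∣ y

  -- The recursion ends in an arbitrary unit instead of `1#`, so that units met on the way need not
  -- be absorbed into a factor.
  data Factorization (P : Carrier → Set) (c : Carrier) : Set where
    unit : c ∣ 1# → Factorization P c
    cons : ∀ {p d} → P p → c ≈ p * d → Factorization P d → Factorization P c

  *-∣1 : ∀ {x y} → x ∣ 1# → y ∣ 1# → x * y ∣ 1#
  *-∣1 {x} {y} (u , ux≈1) (v , vy≈1) =
    u * v , trans (RingIdentities.*-medial R u v x y) (trans (*-cong ux≈1 vy≈1) (*-identityˡ 1#))

  factorization-unit* : ∀ {P u x y} → u ∣ 1# → y ≈ u * x → Factorization P x → Factorization P y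
  factorization-unit* u∣1 y≈ux (unit x∣1) = unit (∣-respˡ (sym y≈ux) (*-∣1 u∣1 x∣1))
  factorization-unit* {u = u} u∣1 y≈ux (cons {p} {d} Pp x≈pd fact) = cons Pp
    (trans y≈ux (trans (*-congˡ x≈pd) (RingIdentities.*-left-comm R u p d)))
    (factorization-unit* u∣1 refl fact)

  factorization-* : ∀ {P x y z} → z ≈ x * y → Factorization P x → Factorization P y → Factorization P z
  factorization-* z≈xy (unit x∣1) fact = factorization-unit* x∣1 z≈xy fact
  factorization-* {y = y} z≈xy (cons Pp x≈pd fact) fact′ =
    cons Pp (trans z≈xy (trans (*-congʳ x≈pd) (*-assoc _ _ y))) (factorization-* refl fact fact′)

module IntegralDomain (R : CommutativeRing 0ℓ 0ℓ) where
  open CommutativeRing R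
  open RingProperties ring

  NoZeroDivisors : Set
  NoZeroDivisors = ∀ x y → x * y ≈ 0# → x ≈ 0# ⊎ y ≈ 0#

  *-cancelˡ : NoZeroDivisors → ∀ {x y z} → ¬ x ≈ 0# → x * y ≈ x * z → y ≈ z
  *-cancelˡ noZeroDivisors {x} {y} {z} x≉0 xy≈xz
    with noZeroDivisors x (y - z) (trans (x[y-z]≈xy-xz x y z) (x≈y⇒x∙y⁻¹≈ε xy≈xz))
  ... | inj₁ x≈0   = contradiction x≈0 x≉0
  ... | inj₂ y-z≈0 = x∙y⁻¹≈ε⇒x≈y y z y-z≈0

-- Gauss's lemma and irreducible elements of K[X]

module Extension {K L : CommutativeRing 0ℓ 0ℓ} (E : PolynomialExtension K L) where
  open PolynomialExtension E
  private
    module K where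
      open CommutativeRing K public
      open RingProperties ring public
      open Divisibility K public
    module L where
      open CommutativeRing L public
      open RingProperties ring public
      open Divisibility L public
      open RingIdentities L public

  -- deg f < n
  Below : L.Carrier → ℕ → Set
  Below f n = ∀ i → n ℕ.≤ i → slice f i K.≈ K.0#

  slice-0# : ∀ n → slice L.0# n K.≈ K.0#
  slice-0# n = K.x+x≈x⇒x≈0 _ (K.trans (K.sym (slice-+ L.0# L.0# n)) (slice-cong (L.+-identityˡ L.0#) n))

  slice-neg : ∀ f n → slice (L.- f) n K.≈ K.- slice f n
  slice-neg f n = K.+-inverseˡ-unique _ _
    (K.trans (K.sym (slice-+ (L.- f) f n)) (K.trans (slice-cong (L.-‿inverseˡ f) n) (slice-0# n)))

  Below-0⇒≈0 : ∀ {f} → Below f 0 → f L.≈ L.0#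
  Below-0⇒≈0 f<0 = slice-ext (λ n → K.trans (f<0 n z≤n) (K.sym (slice-0# n)))

  Below-ι : ∀ a → Below (ι a) 1
  Below-ι a (suc n) _ = slice-ι-suc a n

  ι-cong : ∀ {a b} → a K.≈ b → ι a L.≈ ι b
  ι-cong {a} {b} a≈b = slice-ext λ
    { zero    → K.trans (slice-ι-0 a) (K.trans a≈b (K.sym (slice-ι-0 b)))
    ; (suc n) → K.trans (slice-ι-suc a n) (K.sym (slice-ι-suc b n)) }

  ι-* : ∀ a b → ι (a K.* b) L.≈ ι a L.* ι b
  ι-* a b = slice-ext λ
    { zero    → K.trans (slice-ι-0 _) (K.sym (K.trans (slice-ι* a (ι b) 0) (K.*-congˡ (slice-ι-0 b))))
    ; (suc n) → K.trans (slice-ι-suc _ n) (K.sym (K.trans (slice-ι* a (ι b) (suc n))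
                  (K.trans (K.*-congˡ (slice-ι-suc b n)) (K.zeroʳ a)))) }

  ι-1*f : ∀ f → ι K.1# L.* f L.≈ f
  ι-1*f f = slice-ext λ n → K.trans (slice-ι* K.1# f n) (K.*-identityˡ _)

  ι-1 : ι K.1# L.≈ L.1#
  ι-1 = L.trans (L.sym (L.*-identityʳ _)) (ι-1*f L.1#)

  ι-0 : ι K.0# L.≈ L.0#
  ι-0 = slice-ext λ
    { zero    → K.trans (slice-ι-0 _) (K.sym (slice-0# 0))
    ; (suc n) → K.trans (slice-ι-suc _ n) (K.sym (slice-0# (suc n))) }

  ι-injective-0 : ∀ {a} → ι a L.≈ L.0# → a K.≈ K.0#
  ι-injective-0 {a} ιa≈0 = K.trans (K.sym (slice-ι-0 a)) (K.trans (slice-cong ιa≈0 0) (slice-0# 0))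

  head+tail : ∀ f → f L.≈ ι (slice f 0) L.+ X L.* tail f
  head+tail f = slice-ext λ
    { zero    → K.sym (K.trans (slice-+ _ _ 0)
                  (K.trans (K.+-cong (slice-ι-0 _) (slice-X*-0 _)) (K.+-identityʳ _)))
    ; (suc n) → K.sym (K.trans (slice-+ _ _ (suc n))
                  (K.trans (K.+-cong (slice-ι-suc _ n) (K.trans (slice-X* _ n) (slice-tail f n)))
                           (K.+-identityˡ _))) }

  ι-mono-∣ : ∀ {a b} → a K.∣ b → ι a L.∣ ι b
  ι-mono-∣ {a} (q , qa≈b) = ι q , L.trans (L.sym (ι-* q a)) (ι-cong qa≈b)

  ι∣⇒∣slice : ∀ {a f} → ι a L.∣ f → ∀ n → a K.∣ slice f n
  ι∣⇒∣slice {a} {f} (q , qa≈f) n = K.∣-respʳ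
    (K.trans (K.sym (slice-ι* a q n)) (slice-cong (L.trans (L.*-comm (ι a) q) qa≈f) n))
    (K.x∣xy a (slice q n))

  ι∣1⇒∣1 : ∀ {a} → ι a L.∣ L.1# → a K.∣ K.1#
  ι∣1⇒∣1 ιa∣1 = K.∣-respʳ (K.trans (slice-cong (L.sym ι-1) 0) (slice-ι-0 K.1#)) (ι∣⇒∣slice ιa∣1 0)

  -- Comparison of coefficients shows that `tail q` is the quotient. No cancellation is involved, so
  -- that zero is covered as a divisor, as the case `p = 0` of Gauss's lemma demands.
  ι∣X*⇒ι∣ : ∀ {a f} → ι a L.∣ X L.* f → ι a L.∣ f
  ι∣X*⇒ι∣ {a} {f} (q , qa≈Xf) = tail q , L.trans (L.*-comm (tail q) (ι a)) (slice-ext λ n → begin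
    slice (ι a L.* tail q) n        ≈⟨ slice-ι* a (tail q) n ⟩
    a K.* slice (tail q) n          ≈⟨ K.*-congˡ (slice-tail q n) ⟩
    a K.* slice q (suc n)           ≈⟨ slice-ι* a q (suc n) ⟨
    slice (ι a L.* q) (suc n)       ≈⟨ slice-cong (L.trans (L.*-comm (ι a) q) qa≈Xf) (suc n) ⟩
    slice (X L.* f) (suc n)         ≈⟨ slice-X* f n ⟩
    slice f n                       ∎)
    where open SetoidReasoning K.setoid

  Below-tail : ∀ {f n} → Below f (suc n) → Below (tail f) n
  Below-tail {f} f<n i n≤i = K.trans (slice-tail f i) (f<n (suc i) (s≤s n≤i))

  -- Gauss's lemma.  The case p = 0 says that L has no zero divisors.
  ι-splits : ∀ {p} → (∀ a → Dec (p K.∣ a)) → K.Splits p → L.Splits (ι p)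
  ι-splits {p} p∣? splits {f} {g} =
    go (degreeBound f) (degreeBound g) f g (slice-big f) (slice-big g)
    where
    ι∣head⇒ : ∀ {f} → p K.∣ slice f 0 → ι p L.∣ tail f → ι p L.∣ f
    ι∣head⇒ {f} p∣h p∣t = L.∣-respʳ (L.sym (head+tail f)) (L.∣-+ (ι-mono-∣ p∣h) (L.x∣ʳy⇒x∣ʳzy X p∣t))

    ι∣tail : ∀ {f g} → p K.∣ slice f 0 → ι p L.∣ f L.* g → ι p L.∣ tail f L.* g
    ι∣tail {f} {g} p∣h p∣fg = ι∣X*⇒ι∣ (L.∣-respʳ (L.*-assoc X (tail f) g)
      (L.∣-+-cancel (ι (slice f 0) L.* g) (X L.* tail f L.* g)
        (L.x∣y⇒x∣yz g (ι-mono-∣ p∣h))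
        (L.∣-respʳ (L.trans (L.*-congʳ (head+tail f)) (L.distribʳ g _ _)) p∣fg)))

    -- Constant coefficients divisible by `p` are stripped off one at a time, which lowers `n` or
    -- `m`. Once neither constant coefficient is divisible by `p`, their product is not divisible
    -- either, although it is the constant coefficient of `f * g`.
    go : ∀ n m f g → Below f n → Below g m → ι p L.∣ f L.* g → ι p L.∣ f ⊎ ι p L.∣ g
    go zero    m       f g f<n g<m p∣fg = inj₁ (L.∣-respʳ (L.sym (Below-0⇒≈0 f<n)) (ι p L.∣0))
    go (suc n) zero    f g f<n g<m p∣fg = inj₂ (L.∣-respʳ (L.sym (Below-0⇒≈0 g<m)) (ι p L.∣0))
    go (suc n) (suc m) f g f<n g<m p∣fg with p∣? (slice f 0) | p∣? (slice g 0)
    ... | yes p∣f₀ | _ =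
      Sum.map₁ (ι∣head⇒ p∣f₀) (go n (suc m) (tail f) g (Below-tail f<n) g<m (ι∣tail p∣f₀ p∣fg))
    ... | no _     | yes p∣g₀ =
      Sum.map₂ (ι∣head⇒ p∣g₀) (go (suc n) m f (tail g) f<n (Below-tail g<m)
        (L.∣-respʳ (L.*-comm (tail g) f) (ι∣tail p∣g₀ (L.∣-respʳ (L.*-comm f g) p∣fg))))
    ... | no p∤f₀  | no p∤g₀ =
      contradiction (splits (K.∣-respʳ (slice-0-* f g) (ι∣⇒∣slice p∣fg 0)))
                    Sum.[ p∤f₀ , p∤g₀ ]

  noZeroDivisors : (∀ a → Dec (a K.≈ K.0#)) → IntegralDomain.NoZeroDivisors K → IntegralDomain.NoZeroDivisors L
  noZeroDivisors _≟0 noZeroDivisorsᴷ f g fg≈0 = Sum.map ι0∣⇒≈0 ι0∣⇒≈0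
    (ι-splits 0∣? (Sum.map ≈0⇒0∣ ≈0⇒0∣ ∘ noZeroDivisorsᴷ _ _ ∘ K.0∣x⇒x≈0) (L.∣-respʳ (L.sym fg≈0) (ι K.0# L.∣0)))
    where
    ≈0⇒0∣ : ∀ {a} → a K.≈ K.0# → K.0# K.∣ a
    ≈0⇒0∣ a≈0 = K.∣-respʳ (K.sym a≈0) (K.0# K.∣0)
    0∣? : ∀ a → Dec (K.0# K.∣ a)
    0∣? a with a ≟0
    ... | yes a≈0 = yes (≈0⇒0∣ a≈0)
    ... | no  a≉0 = no (a≉0 ∘ K.0∣x⇒x≈0)
    ι0∣⇒≈0 : ∀ {f} → ι K.0# L.∣ f → f L.≈ L.0#
    ι0∣⇒≈0 = L.0∣x⇒x≈0 ∘ L.∣-respˡ ι-0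

  X^_ : ℕ → L.Carrier
  X^ zero  = L.1#
  X^ suc j = X L.* X^ j

  slice-X^* : ∀ j f n → slice (X^ j L.* f) (j ℕ.+ n) K.≈ slice f n
  slice-X^* zero    f n = slice-cong (L.*-identityˡ f) n
  slice-X^* (suc j) f n = K.trans (slice-cong (L.*-assoc X (X^ j) f) (suc (j ℕ.+ n)))
    (K.trans (slice-X* (X^ j L.* f) (j ℕ.+ n)) (slice-X^* j f n))

  -- The induction step of unique factorization. The hypothesis `below-∣` expresses that a nonzero
  -- multiple of `p` has at least the degree of `p`; for polynomials it is derived from the
  -- additivity of the vector degree.
  module Step
    (_≟0 : ∀ a → Dec (a K.≈ K.0#))
    (_∣?_ : ∀ p a → Dec (p K.∣ a))
    (1≉0 : ¬ K.1# K.≈ K.0#)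
    (noZeroDivisorsᴷ : IntegralDomain.NoZeroDivisors K)
    (factor : ∀ {c} → ¬ c K.≈ K.0# → K.Factorization K.Irreducible c)
    (splitsᴷ : ∀ {p} → K.Irreducible p → K.Splits p)
    (below-∣ : ∀ {p r n} → ¬ slice p n K.≈ K.0# → Below r n → p L.∣ r → r L.≈ L.0#)
    where

    private
      L-noZeroDivisors : IntegralDomain.NoZeroDivisors L
      L-noZeroDivisors = noZeroDivisors _≟0 noZeroDivisorsᴷ

      L-cancel : ∀ {x y z} → ¬ x L.≈ L.0# → x L.* y L.≈ x L.* z → y L.≈ z
      L-cancel = IntegralDomain.*-cancelˡ L L-noZeroDivisors

      ι-irreducible-splits : ∀ {p} → K.Irreducible p → L.Splits (ι p)
      ι-irreducible-splits {p} irr = ι-splits (p ∣?_) (splitsᴷ irr)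

      ι-irreducible-≉0 : ∀ {p} → K.Irreducible p → ¬ ι p L.≈ L.0#
      ι-irreducible-≉0 irr ιp≈0 = K.Irreducible⇒≉0 (1≉0 ∘ K.sym) irr (ι-injective-0 ιp≈0)

    leadingTerm : ∀ f → f L.≈ L.0# ⊎ ∃[ m ] ¬ slice f m K.≈ K.0# × Below f (suc m)
    leadingTerm f = go (degreeBound f) (slice-big f)
      where
      lower : ∀ {n} → Below f (suc n) → slice f n K.≈ K.0# → Below f n
      lower f<n+1 f≈0 i n≤i with ℕₚ.m≤n⇒m<n∨m≡n n≤i
      ... | inj₁ n<i    = f<n+1 i n<i
      ... | inj₂ ≡.refl = f≈0
      go : ∀ n → Below f n → f L.≈ L.0# ⊎ ∃[ m ] ¬ slice f m K.≈ K.0# × Below f (suc m)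
      go zero    f<0 = inj₁ (Below-0⇒≈0 f<0)
      go (suc n) f<n with slice f n ≟0
      ... | yes fₙ≈0 = go n (lower f<n fₙ≈0)
      ... | no  fₙ≉0 = inj₂ (n , fₙ≉0 , f<n)

    -- Leading coefficients cannot be inverted, so `f` is multiplied by that of `a` before each
    -- subtraction. The multiplier `s` is a power of this coefficient and is nonzero because `K` has
    -- no zero divisors.
    pseudoDivision : ∀ a m → ¬ slice a m K.≈ K.0# → Below a (suc m) → ∀ f →
      ∃[ s ] ∃[ q ] ∃[ r ] ¬ s K.≈ K.0# × ι s L.* f L.≈ q L.* a L.+ r × Below r m
    pseudoDivision a m aₘ≉0 a<m+1 f = go (degreeBound f) f (slice-big f)
      where
      small : ∀ n → n ℕ.≤ m → ∀ f → Below f n →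
        ∃[ s ] ∃[ q ] ∃[ r ] ¬ s K.≈ K.0# × ι s L.* f L.≈ q L.* a L.+ r × Below r m
      small n n≤m f f<n = K.1# , L.0# , f , 1≉0
        , L.trans (ι-1*f f) (L.sym (L.trans (L.+-congʳ (L.zeroˡ a)) (L.+-identityˡ f)))
        , λ i m≤i → f<n i (ℕₚ.≤-trans n≤m m≤i)
      go : ∀ n f → Below f n →
        ∃[ s ] ∃[ q ] ∃[ r ] ¬ s K.≈ K.0# × ι s L.* f L.≈ q L.* a L.+ r × Below r m
      go zero    f f<n = small 0 z≤n f f<n
      go (suc n) f f<n with ℕₚ.≤-<-connex (suc n) m
      ... | inj₁ n<m = small (suc n) n<m f f<n
      ... | inj₂ (s≤s m≤n) with go n f₁ f₁<n
        where
        c = slice a m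
        j = n ℕ.∸ m
        t = ι (slice f n) L.* (X^ j L.* a)
        -- Cross-multiplication by the two leading coefficients cancels the coefficient of index
        -- `n`. Only indices `j + i` with `m ≤ i` need to be inspected, and these are exactly the
        -- indices from `n` on.
        f₁ = ι c L.* f L.+ L.- t
        slice-t : ∀ i → m ℕ.≤ i → slice t (j ℕ.+ i) K.≈ slice f n K.* slice a i
        slice-t i _ = K.trans (slice-ι* (slice f n) (X^ j L.* a) (j ℕ.+ i)) (K.*-congˡ (slice-X^* j a i))
        cancels : ∀ i → m ℕ.≤ i → c K.* slice f (j ℕ.+ i) K.≈ slice f n K.* slice a i
        cancels i m≤i with ℕₚ.m≤n⇒m<n∨m≡n m≤i
        ... | inj₂ ≡.refl = K.trans (K.*-comm c _) (K.*-congʳ (K.reflexive (≡.cong (slice f) (ℕₚ.m∸n+n≡m m≤n))))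
        ... | inj₁ m<i    = K.trans
          (K.trans (K.*-congˡ (f<n (j ℕ.+ i)
             (≡.subst (ℕ._≤ j ℕ.+ i) (≡.trans (ℕₚ.+-suc j m) (≡.cong suc (ℕₚ.m∸n+n≡m m≤n)))
                      (ℕₚ.+-monoʳ-≤ j m<i)))) (K.zeroʳ c))
          (K.sym (K.trans (K.*-congˡ (a<m+1 i m<i)) (K.zeroʳ _)))
        shifted : ∀ i → m ℕ.≤ i → slice f₁ (j ℕ.+ i) K.≈ K.0#
        shifted i m≤i = K.trans (slice-+ _ _ _) (K.trans
          (K.+-cong (K.trans (slice-ι* c f _) (K.trans (cancels i m≤i) (K.sym (slice-t i m≤i)))) (slice-neg t _))
          (K.-‿inverseʳ _))
        f₁<n : Below f₁ n
        f₁<n i n≤i = ≡.subst (λ l → slice f₁ l K.≈ K.0#) (ℕₚ.m+[n∸m]≡n {j} {i} (ℕₚ.≤-trans (ℕₚ.m∸n≤m n m) n≤i))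
          (shifted (i ℕ.∸ j) (≡.subst (ℕ._≤ i ℕ.∸ j) (ℕₚ.m∸[m∸n]≡n m≤n) (ℕₚ.∸-monoˡ-≤ j n≤i)))
      ... | s , q , r , s≉0 , eq , r<m =
        s K.* c , q L.+ ι s L.* (ι (slice f n) L.* X^ j) , r
        , (λ sc≈0 → Sum.[ s≉0 , aₘ≉0 ] (noZeroDivisorsᴷ s (slice a m) sc≈0))
        , (begin
          ι (s K.* c) L.* f
            ≈⟨ L.trans (L.*-congʳ (ι-* s c)) (L.*-assoc _ _ _) ⟩
          ι s L.* (ι c L.* f)
            ≈⟨ L.*-congˡ (L.trans (L.sym (L.+-identityʳ _)) (L.+-congˡ (L.sym (L.-‿inverseˡ t)))) ⟩
          ι s L.* (ι c L.* f L.+ (L.- t L.+ t))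
            ≈⟨ L.trans (L.*-congˡ (L.sym (L.+-assoc _ _ _))) (L.distribˡ _ _ _) ⟩
          ι s L.* (ι c L.* f L.+ L.- t) L.+ ι s L.* t
            ≈⟨ L.+-congʳ eq ⟩
          (q L.* a L.+ r) L.+ ι s L.* t
            ≈⟨ L.regroup q a r (ι s) (ι (slice f n)) (X^ j) ⟩
          (q L.+ ι s L.* (ι (slice f n) L.* X^ j)) L.* a L.+ r ∎)
        , r<m
        where
        open SetoidReasoning L.setoid
        c = slice a m
        j = n ℕ.∸ m
        t = ι (slice f n) L.* (X^ j L.* a)

    module _ {p : L.Carrier} (irr : L.Irreducible p) where
      open L.Irreducible irr

      module PositiveDegree {m : ℕ} (pₘ≉0 : ¬ slice p (suc m) K.≈ K.0#) where
        open SetoidReasoning L.setoid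

        p∤ι : ∀ {π} → ¬ π K.≈ K.0# → p L.∤ ι π
        p∤ι {π} π≉0 p∣ιπ = π≉0 (ι-injective-0 (below-∣ pₘ≉0 (λ i i> → Below-ι π i (ℕₚ.≤-trans (s≤s z≤n) i>)) p∣ιπ))

        -- An irreducible factor `π` of `c` is prime in `L`, so from `g * p` being a multiple of
        -- `ι π` it follows that `ι π` divides `g` or `p`. In the first case it cancels. The second
        -- is impossible: `p` would be associated to a constant, or `π` would be a unit.
        cancel-ι : ∀ {c} → K.Factorization K.Irreducible c → ∀ {a} → p L.∣ ι c L.* a → p L.∣ a
        cancel-ι {c} (K.unit (d , dc≈1)) {a} p∣ca = L.∣-respʳ (begin
          ι d L.* (ι c L.* a)  ≈⟨ L.*-assoc _ _ _ ⟨
          ι d L.* ι c L.* a    ≈⟨ L.*-congʳ (L.trans (L.sym (ι-* d c)) (ι-cong dc≈1)) ⟩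
          ι K.1# L.* a         ≈⟨ ι-1*f a ⟩
          a                    ∎) (L.x∣ʳy⇒x∣ʳzy (ι d) p∣ca)
        cancel-ι {c} (K.cons {π} {d} π-irr c≈πd fact) {a} (g , gp≈ca)
          with ι-irreducible-splits π-irr (ι d L.* a , L.trans (L.*-comm _ _) (L.sym gp≈π[da]))
          where
          gp≈π[da] : g L.* p L.≈ ι π L.* (ι d L.* a)
          gp≈π[da] = L.trans gp≈ca (L.trans (L.*-congʳ (L.trans (ι-cong c≈πd) (ι-* π d))) (L.*-assoc _ _ _))
        ... | inj₁ (g′ , g′π≈g) = cancel-ι fact (g′ , L-cancel (ι-irreducible-≉0 π-irr) (begin
          ι π L.* (g′ L.* p)   ≈⟨ L.*-assoc _ _ _ ⟨
          ι π L.* g′ L.* p     ≈⟨ L.*-congʳ (L.trans (L.*-comm _ _) g′π≈g) ⟩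
          g L.* p              ≈⟨ gp≈ca ⟩
          ι c L.* a            ≈⟨ L.*-congʳ (L.trans (ι-cong c≈πd) (ι-* π d)) ⟩
          ι π L.* ι d L.* a    ≈⟨ L.*-assoc _ _ _ ⟩
          ι π L.* (ι d L.* a)  ∎))
        ... | inj₂ (h , hπ≈p) with split-∣1 (L.sym hπ≈p)
        ...   | inj₁ (u , uh≈1) = contradiction
          (u , L.trans (L.*-congˡ (L.sym hπ≈p)) (L.trans (L.sym (L.*-assoc _ _ _)) (L.trans (L.*-congʳ uh≈1) (L.*-identityˡ _))))
          (p∤ι (K.Irreducible⇒≉0 (1≉0 ∘ K.sym) π-irr))
        ...   | inj₂ ιπ∣1 = contradiction (ι∣1⇒∣1 ιπ∣1) (K.Irreducible.p∤1 π-irr)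

        -- Turns divisibility of `p` by `a` up to a constant into an honest factorization of `p`, to
        -- which irreducibility applies. Each irreducible factor of `c` divides `q` or `a` and is
        -- cancelled there; `d` collects what is taken out of `a`, up to a unit.
        clearContent : ∀ {c} → K.Factorization K.Irreducible c → ∀ q a → ι c L.* p L.≈ q L.* a →
          ∃[ d ] ∃[ q′ ] ∃[ a′ ] a L.≈ ι d L.* a′ × p L.≈ q′ L.* a′
        clearContent {c} (K.unit (d , dc≈1)) q a cp≈qa = K.1# , ι d L.* q , a , L.sym (ι-1*f a) , (begin
          p                    ≈⟨ ι-1*f p ⟨
          ι K.1# L.* p         ≈⟨ L.*-congʳ (L.trans (ι-cong (K.sym dc≈1)) (ι-* d c)) ⟩
          ι d L.* ι c L.* p    ≈⟨ L.*-assoc _ _ _ ⟩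
          ι d L.* (ι c L.* p)  ≈⟨ L.*-congˡ cp≈qa ⟩
          ι d L.* (q L.* a)    ≈⟨ L.*-assoc _ _ _ ⟨
          ι d L.* q L.* a      ∎)
        clearContent {c} (K.cons {π} {d} π-irr c≈πd fact) q a cp≈qa
          with ι-irreducible-splits π-irr (ι d L.* p , L.trans (L.*-comm _ _) π[dp]≈qa)
          where
          π[dp]≈qa : ι π L.* (ι d L.* p) L.≈ q L.* a
          π[dp]≈qa = L.trans (L.sym (L.*-assoc _ _ _))
            (L.trans (L.*-congʳ (L.sym (L.trans (ι-cong c≈πd) (ι-* π d)))) cp≈qa)
        ... | inj₁ (q′ , q′π≈q) = clearContent fact q′ a (L-cancel (ι-irreducible-≉0 π-irr) (begin
          ι π L.* (ι d L.* p)  ≈⟨ L.*-assoc _ _ _ ⟨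
          ι π L.* ι d L.* p    ≈⟨ L.*-congʳ (L.trans (ι-cong c≈πd) (ι-* π d)) ⟨
          ι c L.* p            ≈⟨ cp≈qa ⟩
          q L.* a              ≈⟨ L.*-congʳ (L.trans (L.*-comm _ _) q′π≈q) ⟨
          ι π L.* q′ L.* a     ≈⟨ L.*-assoc _ _ _ ⟩
          ι π L.* (q′ L.* a)   ∎))
        ... | inj₂ (a₁ , a₁π≈a)
          with d′ , q′ , a′ , a₁≈d′a′ , p≈q′a′ ← clearContent fact q a₁ (L-cancel (ι-irreducible-≉0 π-irr) (begin
            ι π L.* (ι d L.* p)  ≈⟨ L.*-assoc _ _ _ ⟨
            ι π L.* ι d L.* p    ≈⟨ L.*-congʳ (L.trans (ι-cong c≈πd) (ι-* π d)) ⟨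
            ι c L.* p            ≈⟨ cp≈qa ⟩
            q L.* a              ≈⟨ L.*-congˡ (L.trans (L.*-comm _ _) a₁π≈a) ⟨
            q L.* (ι π L.* a₁)   ≈⟨ L.*-left-comm _ _ _ ⟩
            ι π L.* (q L.* a₁)   ∎))
          = π K.* d′ , q′ , a′ , (begin
            a                          ≈⟨ a₁π≈a ⟨
            a₁ L.* ι π                 ≈⟨ L.*-comm _ _ ⟩
            ι π L.* a₁                 ≈⟨ L.*-congˡ a₁≈d′a′ ⟩
            ι π L.* (ι d′ L.* a′)      ≈⟨ L.*-assoc _ _ _ ⟨
            ι π L.* ι d′ L.* a′        ≈⟨ L.*-congʳ (ι-* π d′) ⟨
            ι (π K.* d′) L.* a′        ∎) , p≈q′a′

        remainder-∣ : ∀ {w x r b} → w L.≈ x L.+ r → p L.∣ w L.* b → p L.∣ x L.* b → p L.∣ r L.* b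
        remainder-∣ {w} {x} {r} {b} w≈x+r p∣wb p∣xb = L.∣-+-cancel (x L.* b) (r L.* b) p∣xb
          (L.∣-respʳ (L.trans (L.*-congʳ w≈x+r) (L.distribʳ b x r)) p∣wb)

        -- Euclid's algorithm on (p , a), with b carried along: a remainder r of p modulo a
        -- still satisfies p ∣ r b.
        splits-lowDegree : ∀ n → n ℕ.≤ suc m → ∀ {a b} → Below a n → p L.∣ a L.* b → p L.∣ a ⊎ p L.∣ b
        splits-lowDegree zero    _   {a} a<n p∣ab = inj₁ (L.∣-respʳ (L.sym (Below-0⇒≈0 a<n)) (p L.∣0))
        splits-lowDegree (suc n) n<m {a} {b} a<n p∣ab with leadingTerm a
        ... | inj₁ a≈0 = inj₁ (L.∣-respʳ (L.sym a≈0) (p L.∣0))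
        ... | inj₂ (l , aₗ≉0 , a<l+1) with pseudoDivision a l aₗ≉0 a<l+1 p
        ...   | s , q , r , s≉0 , eq , r<l
          with splits-lowDegree n (ℕₚ.<⇒≤ n<m) {r} {b}
                 (λ i n≤i → r<l i (ℕₚ.≤-trans l≤n n≤i))
                 (remainder-∣ eq (L.x∣y⇒x∣yz b (L.x∣ʳyx p (ι s)))
                   (L.∣-respʳ (L.sym (L.*-assoc q a b)) (L.x∣ʳy⇒x∣ʳzy q p∣ab)))
          where
          l≤n : l ℕ.≤ n
          l≤n = ℕₚ.≮⇒≥ λ n<l → aₗ≉0 (a<n l n<l)
        ...     | inj₂ p∣b = inj₂ p∣b
        -- Here `r` has smaller degree than `p` and so vanishes, which leaves `ι s * p ≈ q * a`.
        -- Once the constant is cleared, irreducibility of `p ≈ q′ * a′` leaves two cases: if `q′`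
        -- is a unit, then `p` divides `a`; if `a′` is a unit, then `a` is essentially the constant
        -- `d`, which can be cancelled from `p ∣ a * b`.
        ...     | inj₁ p∣r
          with d , q′ , a′ , a≈da′ , p≈q′a′ ← clearContent (factor s≉0) q a
                 (L.trans eq (L.trans (L.+-congˡ (below-∣ pₘ≉0
                   (λ i m≤i → r<l i (ℕₚ.≤-trans (ℕₚ.≤-trans (ℕₚ.≮⇒≥ λ n<l → aₗ≉0 (a<n l n<l)) (ℕₚ.<⇒≤ n<m)) m≤i))
                   p∣r)) (L.+-identityʳ _)))
          with split-∣1 p≈q′a′
        ...       | inj₁ (u , uq′≈1) = inj₁ (L.∣-respʳ (L.sym a≈da′) (L.x∣ʳy⇒x∣ʳzy (ι d) (u , (begin
          u L.* p              ≈⟨ L.*-congˡ p≈q′a′ ⟩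
          u L.* (q′ L.* a′)    ≈⟨ L.*-assoc _ _ _ ⟨
          u L.* q′ L.* a′      ≈⟨ L.*-congʳ uq′≈1 ⟩
          L.1# L.* a′          ≈⟨ L.*-identityˡ a′ ⟩
          a′                   ∎))))
        ...       | inj₂ (u , ua′≈1) = inj₂ (cancel-ι (factor d≉0) (L.∣-respʳ (begin
          u L.* (a L.* b)                ≈⟨ L.*-congˡ (L.*-congʳ a≈da′) ⟩
          u L.* (ι d L.* a′ L.* b)       ≈⟨ L.regroup′ u (ι d) a′ b ⟩
          (u L.* a′) L.* (ι d L.* b)     ≈⟨ L.*-congʳ ua′≈1 ⟩
          L.1# L.* (ι d L.* b)           ≈⟨ L.*-identityˡ _ ⟩
          ι d L.* b                      ∎) (L.x∣ʳy⇒x∣ʳzy u p∣ab)))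
          where
          d≉0 : ¬ d K.≈ K.0#
          d≉0 d≈0 = aₗ≉0 (K.trans (slice-cong a≈da′ l) (K.trans (slice-ι* d a′ l)
            (K.trans (K.*-congʳ d≈0) (K.zeroˡ _))))

        -- Reduction of `a` modulo `p` brings the degree below that of `p`; the multiplier `s`
        -- disappears by `cancel-ι`.
        splits : Below p (suc (suc m)) → L.Splits p
        splits p<m+2 {a} {b} p∣ab with pseudoDivision p (suc m) pₘ≉0 p<m+2 a
        ... | s , q , r , s≉0 , eq , r<m+1
          with splits-lowDegree (suc m) ℕₚ.≤-refl {r} {b} r<m+1
                 (remainder-∣ eq (L.∣-respʳ (L.sym (L.*-assoc _ _ _)) (L.x∣ʳy⇒x∣ʳzy (ι s) p∣ab))
                              (L.x∣y⇒x∣yz b (L.x∣ʳyx p q)))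
        ...   | inj₂ p∣b = inj₂ p∣b
        ...   | inj₁ p∣r = inj₁ (cancel-ι (factor s≉0) (L.∣-respʳ (L.sym eq) (L.∣-+ (L.x∣ʳyx p q) p∣r)))

      -- Such a `p` is a constant and irreducible in `K` as well, since a factorization in `K` is
      -- also one in `L`. Gauss's lemma then applies.
      splits-degree-0 : Below p 1 → L.Splits p
      splits-degree-0 p<1 p∣ab = Sum.map (L.∣-respˡ (L.sym p≈ιp₀)) (L.∣-respˡ (L.sym p≈ιp₀))
        (ι-irreducible-splits p₀-irr (L.∣-respˡ p≈ιp₀ p∣ab))
        where
        p≈ιp₀ : p L.≈ ι (slice p 0)
        p≈ιp₀ = slice-ext λ
          { zero    → K.sym (slice-ι-0 _)
          ; (suc n) → K.trans (p<1 (suc n) (s≤s z≤n)) (K.sym (slice-ι-suc _ n)) }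
        p₀-irr : K.Irreducible (slice p 0)
        p₀-irr = K.mkIrred
          (λ p₀∣1 → p∤1 (L.∣-respʳ ι-1 (L.∣-respˡ (L.sym p≈ιp₀) (ι-mono-∣ p₀∣1))))
          (λ {x} {y} p₀≈xy → Sum.map ι∣1⇒∣1 ι∣1⇒∣1
            (split-∣1 (L.trans p≈ιp₀ (L.trans (ι-cong p₀≈xy) (ι-* x y)))))

    irreducible-splits : ∀ {p} → L.Irreducible p → L.Splits p
    irreducible-splits {p} irr p∣ab with leadingTerm p
    ... | inj₁ p≈0                 = contradiction p≈0 (L.Irreducible⇒≉0 0≉1 irr)
      where
      0≉1 : ¬ L.0# L.≈ L.1#
      0≉1 0≈1 = 1≉0 (ι-injective-0 (L.trans ι-1 (L.sym 0≈1)))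
    ... | inj₂ (zero  , _   , p<1) = splits-degree-0 irr p<1 p∣ab
    ... | inj₂ (suc m , pₘ≉0 , p<) = PositiveDegree.splits irr pₘ≉0 p< p∣ab

-- Tuples of exponents

∈-box⁺ : ∀ {k} {a m : Tuple k} → a ≤ᵗ m → a ∈ box m
∈-box⁺ []         = here ≡.refl
∈-box⁺ (a≤ ∷ as≤) = ∈ₚ.∈-cartesianProductWith⁺ _∷_ (∈ₚ.∈-upTo⁺ (s≤s a≤)) (∈-box⁺ as≤)

∈-box⁻ : ∀ {k} {a : Tuple k} m → a ∈ box m → a ≤ᵗ m
∈-box⁻ []       (here ≡.refl) = []
∈-box⁻ (m ∷ ms) a∈ with ∈ₚ.∈-cartesianProductWith⁻ _∷_ (upTo (suc m)) (box ms) a∈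
... | _ , _ , x∈ , y∈ , ≡.refl = ℕₚ.≤-pred (∈ₚ.∈-upTo⁻ x∈) ∷ ∈-box⁻ ms y∈

lookup-ext : ∀ {k} {a b : Tuple k} → (∀ i → lookup a i ≡ lookup b i) → a ≡ b
lookup-ext {a = a} {b} eq = ≡.trans (≡.sym (Vecₚ.tabulate∘lookup a))
  (≡.trans (Vecₚ.tabulate-cong eq) (Vecₚ.tabulate∘lookup b))

≤ᵗ-lookup⁺ : ∀ {k} {a b : Tuple k} → (∀ i → lookup a i ℕ.≤ lookup b i) → a ≤ᵗ b
≤ᵗ-lookup⁺ {a = []}    {[]}    _  = []
≤ᵗ-lookup⁺ {a = _ ∷ _} {_ ∷ _} a≤ = a≤ zero ∷ ≤ᵗ-lookup⁺ (a≤ ∘ suc)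

≤ᵗ-trans : ∀ {k} {a b c : Tuple k} → a ≤ᵗ b → b ≤ᵗ c → a ≤ᵗ c
≤ᵗ-trans = Pointwise.trans ℕₚ.≤-trans

≤ᵗ-antisym : ∀ {k} {a b : Tuple k} → a ≤ᵗ b → b ≤ᵗ a → a ≡ b
≤ᵗ-antisym []       []       = ≡.refl
≤ᵗ-antisym (p ∷ ps) (q ∷ qs) = ≡.cong₂ _∷_ (ℕₚ.≤-antisym p q) (≤ᵗ-antisym ps qs)

𝟘≤ᵗ : ∀ {k} (a : Tuple k) → 𝟘 ≤ᵗ a
𝟘≤ᵗ []      = []
𝟘≤ᵗ (_ ∷ a) = z≤n ∷ 𝟘≤ᵗ a

≤ᵗ-+ˡ : ∀ {k} (a b : Tuple k) → a ≤ᵗ a +ᵗ b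
≤ᵗ-+ˡ []      []      = []
≤ᵗ-+ˡ (a ∷ as) (b ∷ bs) = ℕₚ.m≤m+n a b ∷ ≤ᵗ-+ˡ as bs

+ᵗ-comm : ∀ {k} (a b : Tuple k) → a +ᵗ b ≡ b +ᵗ a
+ᵗ-comm = Vecₚ.zipWith-comm ℕₚ.+-comm

+ᵗ-identityʳ : ∀ {k} (a : Tuple k) → a +ᵗ 𝟘 ≡ a
+ᵗ-identityʳ = Vecₚ.zipWith-identityʳ ℕₚ.+-identityʳ

+ᵗ-cancelˡ : ∀ {k} (a : Tuple k) {b c} → a +ᵗ b ≡ a +ᵗ c → b ≡ c
+ᵗ-cancelˡ []      {[]}    {[]}    _  = ≡.refl
+ᵗ-cancelˡ (a ∷ as) {b ∷ bs} {c ∷ cs} eq with Vecₚ.∷-injective eq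
... | p , q = ≡.cong₂ _∷_ (ℕₚ.+-cancelˡ-≡ a b c p) (+ᵗ-cancelˡ as q)

a+b≡𝟘⇒b≡𝟘 : ∀ {k} (a : Tuple k) {b} → a +ᵗ b ≡ 𝟘 → b ≡ 𝟘
a+b≡𝟘⇒b≡𝟘 []       {[]}     _  = ≡.refl
a+b≡𝟘⇒b≡𝟘 (a ∷ as) {b ∷ bs} eq with Vecₚ.∷-injective eq
... | p , q = ≡.cong₂ _∷_ (ℕₚ.m+n≡0⇒n≡0 a p) (a+b≡𝟘⇒b≡𝟘 as q)

maximum : ∀ {X : Set} {P : X → Set} (P? : ∀ x → Dec (P x)) (w : X → ℕ) (xs : List X) →
          Any P xs → ∃[ x ] P x × (∀ {y} → y ∈ xs → P y → w y ℕ.≤ w x)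
maximum {P = P} P? w (x ∷ xs) any with any? P? xs
... | no none = x , Px , λ { (here ≡.refl) _ → ℕₚ.≤-refl ; (there y∈) Py → contradiction (lose y∈ Py) none }
  where
  Px : P x
  Px = Any.head none any
... | yes some with maximum P? w xs some | P? x
...   | z , Pz , z-max | no ¬Px = z , Pz , λ { (here ≡.refl) Py → contradiction Py ¬Px ; (there y∈) → z-max y∈ }
...   | z , Pz , z-max | yes Px with ℕₚ.≤-total (w x) (w z)
...     | inj₁ x≤z = z , Pz , λ { (here ≡.refl) _ → x≤z ; (there y∈) → z-max y∈ }
...     | inj₂ z≤x = x , Px , λ { (here ≡.refl) _ → ℕₚ.≤-refl ; (there y∈) Py → ℕₚ.≤-trans (z-max y∈ Py) z≤x }

-- Finite search among polynomials and the vector degree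

module FieldElements {q : ℕ} (F : FiniteField q) where
  open FiniteField F

  _≟ᶜ_ : (x y : Carrier) → Dec (x ≡ y)
  _≟ᶜ_ = via-injection (↔⇒↣ (↔-sym enumeration)) Finₚ._≟_

  fieldElements : List Carrier
  fieldElements = List.tabulate (Inverse.to enumeration)

  ∈-fieldElements : ∀ c → c ∈ fieldElements
  ∈-fieldElements c = ≡.subst (_∈ fieldElements) (Inverse.strictlyInverseˡ enumeration c)
    (∈ₚ.∈-tabulate⁺ (Inverse.from enumeration c))

module PolynomialFacts {q : ℕ} (F : FiniteField q) (k : ℕ) where
  open Polynomials F k
  open PolynomialRing F
  open FieldElements F
  private
    module F = FiniteField F
    module PS = PowerSeries (fieldRing F)
    module S = Sums (fieldRing F)
    module R = CommutativeRing (polyRing k)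
  open Divisibility (polyRing k) using (∣-respˡ; _∤_; mkIrred; Factorization; unit; cons; factorization-*)

  ≢0-stable : ∀ {x} → ¬ x ≢ F.0# → x ≡ F.0#
  ≢0-stable {x} = decidable-stable (x ≟ᶜ F.0#)

  Support : Poly → Tuple k → Set
  Support f m = ∀ e → coeff f e ≢ F.0# → e ≤ᵗ m

  support-bound : ∀ f → Support f (bound f)
  support-bound f e fe≢0 = decidable-stable (e ≤ᵗ? bound f) (λ e≰ → fe≢0 (vanish f e e≰))

  opaque
    _≈?_ : ∀ f g → Dec (f ≈ g)
    f ≈? g = Dec.map′ to (λ f≈g → All.tabulate (λ {e} _ → f≈g e)) (all? (λ e → coeff f e ≟ᶜ coeff g e) es)
      where
      es : List (Tuple k)
      es = box (bound f) ++ box (bound g)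
      to : All (λ e → coeff f e ≡ coeff g e) es → f ≈ g
      to eqs e with e ≤ᵗ? bound f | e ≤ᵗ? bound g
      ... | yes e≤ | _      = All.lookup eqs (∈ₚ.∈-++⁺ˡ (∈-box⁺ e≤))
      ... | no _   | yes e≤ = All.lookup eqs (∈ₚ.∈-++⁺ʳ (box (bound f)) (∈-box⁺ e≤))
      ... | no e≰  | no e≰′ = ≡.trans (vanish f e e≰) (≡.sym (vanish g e e≰′))

  opaque
    nonzeroCoeff : ∀ f → ¬ f ≈ 0ₚ → ∃[ e ] coeff f e ≢ F.0#
    nonzeroCoeff f f≉0 with any? (λ e → ¬? (coeff f e ≟ᶜ F.0#)) (box (bound f))
    ... | yes some = Any.satisfied some
    ... | no  none = contradiction
      (λ e → ≡.trans (≢0-stable (λ fe≢0 → none (lose (∈-box⁺ (support-bound f e fe≢0)) fe≢0))) (≡.sym (coeff-0 k e))) f≉0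

  coeff≢0⇒≉0 : ∀ {f} e → coeff f e ≢ F.0# → ¬ f ≈ 0ₚ
  coeff≢0⇒≉0 e fe≢0 f≈0 = fe≢0 (≡.trans (f≈0 e) (coeff-0 k e))

  -- Polynomials with bounded support

  put : Tuple k → F.Carrier → Poly → Poly
  put a c f = record
    { coeff  = λ e → at e (e ≟ᵗ a)
    ; bound  = a +ᵗ bound f
    ; vanish = λ e e≰ → at-vanish e e≰ (e ≟ᵗ a)
    }
    where
    at : ∀ e → Dec (e ≡ a) → F.Carrier
    at e (yes _) = c
    at e (no  _) = coeff f e
    at-vanish : ∀ e → ¬ e ≤ᵗ a +ᵗ bound f → ∀ d → at e d ≡ F.0#
    at-vanish e e≰ (yes ≡.refl) = contradiction (≤ᵗ-+ˡ a (bound f)) e≰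
    at-vanish e e≰ (no  _)      = vanish f e
      (λ e≤ → e≰ (≤ᵗ-trans e≤ (≡.subst (bound f ≤ᵗ_) (+ᵗ-comm (bound f) a) (≤ᵗ-+ˡ (bound f) a))))

  polysOn : List (Tuple k) → List Poly
  polysOn []       = 0ₚ ∷ []
  polysOn (a ∷ as) = cartesianProductWith (put a) fieldElements (polysOn as)

  -- An arbitrary coefficient function `c` lets the induction drop an exponent from the list without
  -- truncating a polynomial.
  polysOn-complete : ∀ as (c : Tuple k → F.Carrier) → ∃[ g ] g ∈ polysOn as ×
    (∀ {e} → e ∈ as → coeff g e ≡ c e) × (∀ e → ¬ e ∈ as → coeff g e ≡ F.0#)
  polysOn-complete []       c = 0ₚ , here ≡.refl , (λ ()) , (λ e _ → coeff-0 k e)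
  polysOn-complete (a ∷ as) c with polysOn-complete as c
  ... | g , g∈ , agree , zero-outside =
    put a (c a) g , ∈ₚ.∈-cartesianProductWith⁺ (put a) (∈-fieldElements (c a)) g∈ , agree′ , zero-outside′
    where
    agree′ : ∀ {e} → e ∈ a ∷ as → coeff (put a (c a) g) e ≡ c e
    agree′ {e} e∈ with e ≟ᵗ a | e∈
    ... | yes ≡.refl | _        = ≡.refl
    ... | no  e≢a    | here e≡a = contradiction e≡a e≢a
    ... | no  _      | there e∈as = agree e∈as
    zero-outside′ : ∀ e → ¬ e ∈ a ∷ as → coeff (put a (c a) g) e ≡ F.0#
    zero-outside′ e e∉ with e ≟ᵗ a
    ... | yes e≡a = contradiction (here e≡a) e∉
    ... | no  _   = zero-outside e (e∉ ∘ there)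

  polysIn : Tuple k → List Poly
  polysIn m = polysOn (box m)

  opaque
    -- This makes an existential statement about polynomials of bounded support decidable.
    polysIn-complete : ∀ f m → Support f m → Any (f ≈_) (polysIn m)
    polysIn-complete f m supp with polysOn-complete (box m) (coeff f)
    ... | g , g∈ , agree , zero-outside = lose g∈ f≈g
      where
      f≈g : f ≈ g
      f≈g e with e ≤ᵗ? m
      ... | yes e≤m = ≡.sym (agree (∈-box⁺ e≤m))
      ... | no  e≰m = ≡.trans (≢0-stable (e≰m ∘ supp e)) (≡.sym (zero-outside e (e≰m ∘ ∈-box⁻ m)))

  -- Constants and the relation ~

  coeff-const* : ∀ c f e → coeff (const c * f) e ≡ c F.* coeff f e
  coeff-const* c f e = ≡.trans (coeff-* k (const c) f e) (≡.trans
    (PS.⊗-cong {f = coeff (const c)} {λ e → c F.* PS.oneˢ e} {coeff f} const≋ (λ _ → ≡.refl) e)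
    (≡.trans (PS.·-⊗ c PS.oneˢ (coeff f) e) (≡.cong (c F.*_) (PS.⊗-identityˡ (coeff f) e))))
    where
    const≋ : ∀ e → coeff (const c) e ≡ c F.* PS.oneˢ e
    const≋ e with e ≟ᵗ 𝟘
    ... | yes ≡.refl = ≡.sym (≡.trans (≡.cong (c F.*_) (oneˢ-𝟘 {k})) (F.*-identityʳ c))
    ... | no  e≢𝟘    = ≡.sym (≡.trans (≡.cong (c F.*_) (oneˢ-≢ e e≢𝟘)) (F.zeroʳ c))

  ~⇒≈const* : ∀ {f g} ((c , _) : f ~ g) → f ≈ const c * g
  ~⇒≈const* {f} {g} (c , _ , f≡cg) e = ≡.trans (f≡cg e) (≡.sym (coeff-const* c g e))

  ≈const*⇒~ : ∀ {f g} c → c ≢ F.0# → f ≈ const c * g → f ~ g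
  ≈const*⇒~ {f} {g} c c≢0 f≈cg = c , c≢0 , λ e → ≡.trans (f≈cg e) (coeff-const* c g e)

  ~⇒∣ : ∀ {f g} → f ~ g → g ∣ f
  ~⇒∣ {f} {g} f~g = const (proj₁ f~g) , R.sym {f} {const (proj₁ f~g) * g} (~⇒≈const* {f} {g} f~g)

  _~?_ : ∀ f g → Dec (f ~ g)
  f ~? g = Dec.map′ to
    (λ f~g → lose (∈-fieldElements (proj₁ f~g)) (proj₁ (proj₂ f~g) , ~⇒≈const* {f} {g} f~g))
    (any? (λ c → ¬? (c ≟ᶜ F.0#) ×-dec (f ≈? (const c * g))) fieldElements)
    where
    to : Any (λ c → c ≢ F.0# × f ≈ const c * g) fieldElements → f ~ g
    to some with c , c≢0 , f≈cg ← Any.satisfied some = ≈const*⇒~ {f} {g} c c≢0 f≈cg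

  ≈⇒~ : ∀ {f g} → f ≈ g → f ~ g
  ≈⇒~ f≈g = F.1# , F.1≢0 , λ e → ≡.trans (f≈g e) (≡.sym (F.*-identityˡ _))

  ~-coeff≢0 : ∀ {f g} → f ~ g → ∀ e → coeff g e ≢ F.0# → coeff f e ≢ F.0#
  ~-coeff≢0 (c , c≢0 , f≡cg) e ge≢0 fe≡0 = F.x*y≢0 c≢0 ge≢0 (≡.trans (≡.sym (f≡cg e)) fe≡0)

  -- The vector degree

  HasDegreeIn-unique : ∀ {f i n n′} → HasDegreeIn i f n → HasDegreeIn i f n′ → n ≡ n′
  HasDegreeIn-unique (n-ub , e , fe≢0 , ≡.refl) (n′-ub , e′ , fe′≢0 , ≡.refl) =
    ℕₚ.≤-antisym (n′-ub e fe≢0) (n-ub e′ fe′≢0)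

  opaque
    HasDegree-unique : ∀ {f m m′} → HasDegree m f → HasDegree m′ f → m ≡ m′
    HasDegree-unique {f} (_ , d) (_ , d′) = lookup-ext (λ i → HasDegreeIn-unique {f} {i} (d i) (d′ i))

  opaque
    HasDegree-exists : ∀ {f} → ¬ f ≈ 0ₚ → ∃[ m ] HasDegree m f
    HasDegree-exists {f} f≉0 = Vec.tabulate deg , f≉0 , λ i →
      ≡.subst (HasDegreeIn i f) (≡.sym (Vecₚ.lookup∘tabulate deg i)) (proj₂ (degreeIn i))
      where
      degreeIn : ∀ i → ∃[ n ] HasDegreeIn i f n
      degreeIn i with nonzeroCoeff f f≉0
      ... | e₀ , fe₀≢0 with maximum (λ e → ¬? (coeff f e ≟ᶜ F.0#)) (λ e → lookup e i) (box (bound f))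
                              (lose (∈-box⁺ (support-bound f e₀ fe₀≢0)) fe₀≢0)
      ...   | e , fe≢0 , e-max =
        lookup e i , (λ e′ fe′≢0 → e-max (∈-box⁺ (support-bound f e′ fe′≢0)) fe′≢0) , e , fe≢0 , ≡.refl
      deg : Fin k → ℕ
      deg i = proj₁ (degreeIn i)

  HasDegree⇒Support : ∀ {m f} → HasDegree m f → Support f m
  HasDegree⇒Support (_ , d) e fe≢0 = ≤ᵗ-lookup⁺ (λ i → proj₁ (d i) e fe≢0)

  HasDegree⇒≤ : ∀ {m n f} → HasDegree m f → Support f n → m ≤ᵗ n
  HasDegree⇒≤ {m} {n} {f} (_ , d) supp = ≤ᵗ-lookup⁺ below
    where
    below : ∀ i → lookup m i ℕ.≤ lookup n i
    below i with d i
    ... | _ , e , fe≢0 , eq = ≡.subst (ℕ._≤ lookup n i) eq (Pointwise.lookup (supp e fe≢0) i)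

  opaque
    HasDegree-~ : ∀ {m f g} → f ~ g → HasDegree m g → HasDegree m f
    HasDegree-~ {m} {f} {g} f~g@(c , _ , f≡cg) (g≉0 , d) = f≉0 , λ i → upper i , attained i
      where
      ge≢0 : ∀ e → coeff f e ≢ F.0# → coeff g e ≢ F.0#
      ge≢0 e fe≢0 ge≡0 = fe≢0 (≡.trans (f≡cg e) (≡.trans (≡.cong (c F.*_) ge≡0) (F.zeroʳ c)))
      f≉0 : ¬ f ≈ 0ₚ
      f≉0 with nonzeroCoeff g g≉0
      ... | e , ge≢0 = coeff≢0⇒≉0 {f} e (~-coeff≢0 {f} {g} f~g e ge≢0)
      upper : ∀ i e → coeff f e ≢ F.0# → lookup e i ℕ.≤ lookup m i
      upper i e fe≢0 = proj₁ (d i) e (ge≢0 e fe≢0)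
      attained : ∀ i → ∃[ e ] coeff f e ≢ F.0# × lookup e i ≡ lookup m i
      attained i with d i
      ... | _ , e , ge≢0 , eq = e , ~-coeff≢0 {f} {g} f~g e ge≢0 , eq

  hasDegree? : ∀ m f → Dec (HasDegree m f)
  hasDegree? m f with f ≈? 0ₚ
  ... | yes f≈0 = no (λ d → proj₁ d f≈0)
  ... | no  f≉0 with HasDegree-exists {f} f≉0
  ...   | n , d with m ≟ᵗ n
  ...     | yes ≡.refl = yes d
  ...     | no  m≢n    = no (λ d′ → m≢n (HasDegree-unique {f} d′ d))

  const-HasDegree : ∀ {c} → c ≢ F.0# → HasDegree 𝟘 (const c)
  const-HasDegree {c} c≢0 = coeff≢0⇒≉0 {const c} 𝟘 at𝟘≢0 , λ i →
    (λ e ce≢0 → ℕₚ.≤-reflexive (≡.cong (λ e → lookup e i) (e≡𝟘 e ce≢0))) , 𝟘 , at𝟘≢0 , ≡.refl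
    where
    at𝟘≢0 : coeff (const c) 𝟘 ≢ F.0#
    at𝟘≢0 eq = c≢0 (≡.trans (≡.sym (coeff-const-𝟘 k c)) eq)
    e≡𝟘 : ∀ e → coeff (const c) e ≢ F.0# → e ≡ 𝟘
    e≡𝟘 e ce≢0 = decidable-stable (e ≟ᵗ 𝟘) (λ e≢𝟘 → ce≢0 (coeff-const-≢ k c e≢𝟘))

  HasDegree-𝟘⇒~1 : ∀ {f} → HasDegree 𝟘 f → f ~ 1ₚ
  HasDegree-𝟘⇒~1 {f} d@(f≉0 , _) = coeff f 𝟘 , f𝟘≢0 , f≡
    where
    e≡𝟘 : ∀ e → coeff f e ≢ F.0# → e ≡ 𝟘
    e≡𝟘 e fe≢0 = ≤ᵗ-antisym (HasDegree⇒Support {f = f} d e fe≢0) (𝟘≤ᵗ e)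
    f𝟘≢0 : coeff f 𝟘 ≢ F.0#
    f𝟘≢0 with nonzeroCoeff f f≉0
    ... | e , fe≢0 = ≡.subst (λ e → coeff f e ≢ F.0#) (e≡𝟘 e fe≢0) fe≢0
    f≡ : ∀ e → coeff f e ≡ coeff f 𝟘 F.* coeff 1ₚ e
    f≡ e with e ≟ᵗ 𝟘
    ... | yes ≡.refl = ≡.sym (F.*-identityʳ _)
    ... | no  e≢𝟘    = ≡.trans (≢0-stable (e≢𝟘 ∘ e≡𝟘 e)) (≡.sym (F.zeroʳ _))

  opaque
    coeff-*-≢0 : ∀ f g e → coeff (f * g) e ≢ F.0# →
      ∃[ a ] a ≤ᵗ e × coeff f a ≢ F.0# × coeff g (e ∸ᵗ a) ≢ F.0#
    coeff-*-≢0 f g e fg≢0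
      with any? (λ a → ¬? (coeff f a ≟ᶜ F.0#) ×-dec ¬? (coeff g (e ∸ᵗ a) ≟ᶜ F.0#)) (box e)
    ... | yes some = let a , a∈ , nz = find some in a , ∈-box⁻ e a∈ , nz
    ... | no  none = contradiction (S.sum-zero-∈ (box e) vanishes) fg≢0
      where
      vanishes : ∀ {a} → a ∈ box e → coeff f a F.* coeff g (e ∸ᵗ a) ≡ F.0#
      vanishes {a} a∈ with coeff f a ≟ᶜ F.0# | coeff g (e ∸ᵗ a) ≟ᶜ F.0#
      ... | yes fa≡0 | _        = ≡.trans (≡.cong (F._* _) fa≡0) (F.zeroˡ _)
      ... | no _     | yes ge≡0 = ≡.trans (≡.cong (_ F.*_) ge≡0) (F.zeroʳ _)
      ... | no fa≢0  | no ge≢0  = contradiction (lose a∈ (fa≢0 , ge≢0)) none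

  -- Plays the role of the leading term in the `i`-th variable, but stays in the same ring, so that
  -- the absence of zero divisors applies to it directly.
  part : Fin k → ℕ → Poly → Poly
  part i n f = record
    { coeff  = λ e → at e (lookup e i ℕₚ.≟ n)
    ; bound  = bound f
    ; vanish = λ e e≰ → at-vanish e e≰ (lookup e i ℕₚ.≟ n)
    }
    where
    at : ∀ e {P : Set} → Dec P → F.Carrier
    at e (yes _) = coeff f e
    at e (no  _) = F.0#
    at-vanish : ∀ e → ¬ e ≤ᵗ bound f → {P : Set} (d : Dec P) → at e d ≡ F.0#
    at-vanish e e≰ (yes _) = vanish f e e≰
    at-vanish e e≰ (no  _) = ≡.refl

  coeff-part-≡ : ∀ i f e → coeff (part i (lookup e i) f) e ≡ coeff f e
  coeff-part-≡ i f e with lookup e i ℕₚ.≟ lookup e i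
  ... | yes _  = ≡.refl
  ... | no  ≢  = contradiction ≡.refl ≢

  coeff-part-≢0 : ∀ i n f e → coeff (part i n f) e ≢ F.0# → lookup e i ≡ n
  coeff-part-≢0 i n f e pe≢0 with lookup e i ℕₚ.≟ n
  ... | yes eq = eq
  ... | no  _  = contradiction ≡.refl pe≢0

  lookup-∸ᵗ : ∀ i (e a : Tuple k) → lookup (e ∸ᵗ a) i ≡ lookup e i ℕ.∸ lookup a i
  lookup-∸ᵗ i = Vecₚ.lookup-zipWith ℕ._∸_ i

  module _ (noZeroDivisors : IntegralDomain.NoZeroDivisors (polyRing k)) where

    *-≉0 : ∀ {f g} → ¬ f ≈ 0ₚ → ¬ g ≈ 0ₚ → ¬ f * g ≈ 0ₚ
    *-≉0 {f} {g} f≉0 g≉0 fg≈0 = Sum.[ f≉0 , g≉0 ] (noZeroDivisors f g fg≈0)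

    opaque
      -- The product of the two leading parts is nonzero, so it has a nonzero coefficient at some
      -- `e`, whose `i`-th entry must be `n + m`. At such an `e` the product `f * g` has the same
      -- coefficient: if `a` has `i`-th entry other than `n`, then either `a` exceeds the degree of
      -- `f` or `e ∸ᵗ a` exceeds that of `g`.
      HasDegreeIn-* : ∀ {f g i n m} → HasDegreeIn i f n → HasDegreeIn i g m → HasDegreeIn i (f * g) (n ℕ.+ m)
      HasDegreeIn-* {f} {g} {i} {n} {m} (f≤n , a₀ , fa₀≢0 , ≡.refl) (g≤m , b₀ , gb₀≢0 , ≡.refl) = upper , attained
        where
        upper : ∀ e → coeff (f * g) e ≢ F.0# → lookup e i ℕ.≤ n ℕ.+ m
        upper e fg≢0 with coeff-*-≢0 f g e fg≢0
        ... | a , _ , fa≢0 , ge≢0 = ℕₚ.≤-trans (ℕₚ.m≤n+m∸n (lookup e i) (lookup a i))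
          (ℕₚ.+-mono-≤ (f≤n a fa≢0) (≡.subst (ℕ._≤ m) (lookup-∸ᵗ i e a) (g≤m _ ge≢0)))
        f′ g′ : Poly
        f′ = part i n f
        g′ = part i m g
        agree : ∀ e → lookup e i ≡ n ℕ.+ m → ∀ {a} → a ∈ box e →
                coeff f′ a F.* coeff g′ (e ∸ᵗ a) ≡ coeff f a F.* coeff g (e ∸ᵗ a)
        agree e e≡ {a} a∈ with lookup a i ℕₚ.≟ n | lookup (e ∸ᵗ a) i ℕₚ.≟ m
        ... | yes _ | yes _ = ≡.refl
        ... | yes a≡n | no e-a≢m = contradiction
          (≡.trans (lookup-∸ᵗ i e a) (≡.trans (≡.cong₂ ℕ._∸_ e≡ a≡n) (ℕₚ.m+n∸m≡n n m))) e-a≢m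
        ... | no a≢n | _ = ≡.trans (F.zeroˡ _) (≡.sym fg≡0)
          where
          fg≡0 : coeff f a F.* coeff g (e ∸ᵗ a) ≡ F.0#
          fg≡0 with ℕₚ.<-cmp (lookup a i) n
          ... | tri≈ _ a≡n _ = contradiction a≡n a≢n
          ... | tri> _ _ n<a = ≡.trans (≡.cong (F._* _) (≢0-stable (λ fa≢0 → ℕₚ.<⇒≱ n<a (f≤n a fa≢0)))) (F.zeroˡ _)
          ... | tri< a<n _ _ = ≡.trans (≡.cong (_ F.*_) (≢0-stable (λ ge≢0 → ℕₚ.<⇒≱
            (≡.subst (m ℕ.<_) (≡.sym (≡.trans (lookup-∸ᵗ i e a) (≡.cong (ℕ._∸ lookup a i) e≡)))
              (ℕₚ.m+n≤o⇒m≤o∸n (suc m) (≡.subst (ℕ._≤ n ℕ.+ m) (≡.cong suc (ℕₚ.+-comm (lookup a i) m)) (ℕₚ.+-monoˡ-≤ m a<n)))) (g≤m _ ge≢0)))) (F.zeroʳ _)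
        attained : ∃[ e ] coeff (f * g) e ≢ F.0# × lookup e i ≡ n ℕ.+ m
        attained with nonzeroCoeff (f′ * g′) (*-≉0 {f′} {g′} (coeff≢0⇒≉0 {f′} a₀ (fa₀≢0 ∘ ≡.trans (≡.sym (coeff-part-≡ i f a₀))))
                                               (coeff≢0⇒≉0 {g′} b₀ (gb₀≢0 ∘ ≡.trans (≡.sym (coeff-part-≡ i g b₀)))))
        ... | e , fg′≢0 with coeff-*-≢0 f′ g′ e fg′≢0
        ...   | a , a≤e , f′a≢0 , g′e≢0 = e , (λ fg≡0 → fg′≢0 (≡.trans (S.sum-cong-∈ (box e) (agree e e≡)) fg≡0)) , e≡
          where
          e≡ : lookup e i ≡ n ℕ.+ m
          e≡ = ≡.trans (≡.sym (ℕₚ.m+[n∸m]≡n (Pointwise.lookup a≤e i)))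
            (≡.cong₂ ℕ._+_ (coeff-part-≢0 i n f a f′a≢0)
                           (≡.trans (≡.sym (lookup-∸ᵗ i e a)) (coeff-part-≢0 i m g (e ∸ᵗ a) g′e≢0)))

    HasDegree-* : ∀ {m n f g} → HasDegree m f → HasDegree n g → HasDegree (m +ᵗ n) (f * g)
    HasDegree-* {m} {n} {f} {g} (f≉0 , df) (g≉0 , dg) = *-≉0 {f} {g} f≉0 g≉0 , λ i →
      ≡.subst (HasDegreeIn i (f * g)) (≡.sym (Vecₚ.lookup-zipWith ℕ._+_ i m n)) (HasDegreeIn-* {f} {g} {i} (df i) (dg i))

    opaque
      factorDegrees : ∀ {m f g h} → HasDegree m h → f * g ≈ h →
        ∃[ a ] ∃[ b ] HasDegree a f × HasDegree b g × a +ᵗ b ≡ m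
      factorDegrees {m} {f} {g} {h} d@(h≉0 , _) fg≈h
        with HasDegree-exists {f} (λ f≈0 → h≉0 (R.trans {h} {0ₚ * g} {0ₚ} (R.trans {h} {f * g} {0ₚ * g} (R.sym {f * g} {h} fg≈h)
                                    (R.*-congʳ {g} {f} {0ₚ} f≈0)) (R.zeroˡ g)))
           | HasDegree-exists {g} (λ g≈0 → h≉0 (R.trans {h} {f * 0ₚ} {0ₚ} (R.trans {h} {f * g} {f * 0ₚ} (R.sym {f * g} {h} fg≈h)
                                    (R.*-congˡ {f} {g} {0ₚ} g≈0)) (R.zeroʳ f)))
      ... | a , df | b , dg = a , b , df , dg , HasDegree-unique {f * g} (HasDegree-* {a} {b} {f} {g} df dg) (HasDegree-~ {m} {f * g} {h} (≈⇒~ {f * g} {h} fg≈h) d)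

    HasDegree-𝟘⇒∣1 : ∀ {f} → HasDegree 𝟘 f → f ∣ 1ₚ
    HasDegree-𝟘⇒∣1 {f} d = ~⇒∣ {1ₚ} {f} (Setoid.sym Normalized {f} {1ₚ} (HasDegree-𝟘⇒~1 {f} d))

    -- Degrees add, so the cofactor has degree `𝟘` and is a nonzero constant.
    ∣∧HasDegree⇒~ : ∀ {m f g} → HasDegree m f → HasDegree m g → f ∣ g → g ~ f
    ∣∧HasDegree⇒~ {m} {f} {g} df dg (u , uf≈g) with factorDegrees {m} {u} {f} {g} dg uf≈g
    ... | a , b , du , df′ , a+b≡m = Setoid.trans Normalized {g} {u * f} {f}
      (≈⇒~ {g} {u * f} (R.sym {u * f} {g} uf≈g))
      (≈const*⇒~ {u * f} {f} c c≢0 (R.*-congʳ {f} {u} {const c} u≈c))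
      where
      a≡𝟘 : a ≡ 𝟘
      a≡𝟘 = +ᵗ-cancelˡ m (≡.trans (+ᵗ-comm m a)
        (≡.trans (≡.trans (≡.cong (a +ᵗ_) (HasDegree-unique {f} df df′)) a+b≡m) (≡.sym (+ᵗ-identityʳ m))))
      u~1 : u ~ 1ₚ
      u~1 = HasDegree-𝟘⇒~1 {u} (≡.subst (λ a → HasDegree a u) a≡𝟘 du)
      c = proj₁ u~1
      c≢0 = proj₁ (proj₂ u~1)
      u≈c : u ≈ const c
      u≈c = R.trans {u} {const c * 1ₚ} {const c} (~⇒≈const* {u} {1ₚ} u~1) (R.*-identityʳ (const c))

    opaque
      -- By additivity a factor of `h` has at most the degree of `h`. This confines the search for
      -- divisors and factorizations to `polysIn (bound h)`.
      factorSupports : ∀ {f g h} → ¬ h ≈ 0ₚ → f * g ≈ h → Support f (bound h) × Support g (bound h)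
      factorSupports {f} {g} {h} h≉0 fg≈h with HasDegree-exists {h} h≉0
      ... | m , d with factorDegrees {m} {f} {g} {h} d fg≈h
      ...   | a , b , df , dg , ≡.refl = supp {f = f} df (≤ᵗ-+ˡ a b) , supp {f = g} dg (≡.subst (b ≤ᵗ_) (+ᵗ-comm b a) (≤ᵗ-+ˡ b a))
        where
        supp : ∀ {a} {f} → HasDegree a f → a ≤ᵗ m → Support f (bound h)
        supp {f = f} df a≤m e fe≢0 = ≤ᵗ-trans (HasDegree⇒Support {f = f} df e fe≢0)
          (≤ᵗ-trans a≤m (HasDegree⇒≤ {f = h} d (support-bound h)))

    opaque
      _∣?_ : ∀ f h → Dec (f ∣ h)
      f ∣? h with h ≈? 0ₚ
      ... | yes h≈0 = yes (0ₚ , R.trans {0ₚ * f} {0ₚ} {h} (R.zeroˡ f) (R.sym {h} {0ₚ} h≈0))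
      ... | no  h≉0 = Dec.map′
        (λ some → let u , uf≈h = Any.satisfied some in u , uf≈h)
        (λ { (u , uf≈h) → Any.map (λ {u′} u≈u′ → R.trans {u′ * f} {u * f} {h}
               (R.*-congʳ {f} {u′} {u} (R.sym {u} {u′} u≈u′)) uf≈h)
               (polysIn-complete u (bound h) (proj₁ (factorSupports {u} {f} {h} h≉0 uf≈h))) })
        (any? (λ u → (u * f) ≈? h) (polysIn (bound h)))

    classify : ∀ {f} → ¬ f ≈ 0ₚ → f ∣ 1ₚ ⊎ Irreducible f ⊎ ∃[ x ] ∃[ y ] f ≈ x * y × x ∤ 1ₚ × y ∤ 1ₚ
    classify {f} f≉0 with f ∣? 1ₚ
    ... | yes f∣1 = inj₁ f∣1
    ... | no  f∤1 with any? (λ x → any? (λ y → (f ≈? (x * y)) ×-dec (¬? (x ∣? 1ₚ) ×-dec ¬? (y ∣? 1ₚ))) fs) fs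
      where fs = polysIn (bound f)
    ...   | yes some = let x , some′ = Any.satisfied some; y , p = Any.satisfied some′ in inj₂ (inj₂ (x , y , p))
    ...   | no  none = inj₂ (inj₁ (mkIrred f∤1 split))
      where
      split : ∀ {x y} → f ≈ x * y → x ∣ 1ₚ ⊎ y ∣ 1ₚ
      split {x} {y} f≈xy with x ∣? 1ₚ | y ∣? 1ₚ
      ... | yes x∣1 | _       = inj₁ x∣1
      ... | no _    | yes y∣1 = inj₂ y∣1
      ... | no x∤1  | no y∤1 with factorSupports {x} {y} {f} f≉0 (R.sym {f} {x * y} f≈xy)
      ...   | sx , sy = contradiction
        (Any.map (λ {x′} x≈x′ → Any.map (λ {y′} y≈y′ →
             R.trans {f} {x * y} {x′ * y′} f≈xy (R.*-cong {x} {x′} {y} {y′} x≈x′ y≈y′)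
           , (λ x′∣1 → x∤1 (∣-respˡ {1ₚ} {x′} {x} (R.sym {x} {x′} x≈x′) x′∣1))
           , (λ y′∣1 → y∤1 (∣-respˡ {1ₚ} {y′} {y} (R.sym {y} {y′} y≈y′) y′∣1)))
           (polysIn-complete y (bound f) sy)) (polysIn-complete x (bound f) sx)) none

    nonunit⇒sum>0 : ∀ {m f} → HasDegree m f → f ∤ 1ₚ → 0 ℕ.< Vec.sum m
    nonunit⇒sum>0 {m} {f} d f∤1 = ℕₚ.n≢0⇒n>0 λ sum≡0 → f∤1 (HasDegree-𝟘⇒∣1 {f} (≡.subst (λ m → HasDegree m f) (m≡𝟘 m sum≡0) d))
      where
      m≡𝟘 : ∀ {n} (m : Tuple n) → Vec.sum m ≡ 0 → m ≡ 𝟘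
      m≡𝟘 []      _  = ≡.refl
      m≡𝟘 (m ∷ ms) eq = ≡.cong₂ _∷_ (ℕₚ.m+n≡0⇒m≡0 m eq) (m≡𝟘 ms (ℕₚ.m+n≡0⇒n≡0 m eq))

    sum-+ᵗ : ∀ {n} (a b : Tuple n) → Vec.sum (a +ᵗ b) ≡ Vec.sum a ℕ.+ Vec.sum b
    sum-+ᵗ []       []       = ≡.refl
    sum-+ᵗ (a ∷ as) (b ∷ bs) = ≡.trans (≡.cong (a ℕ.+ b ℕ.+_) (sum-+ᵗ as bs)) (medial a b (Vec.sum as) (Vec.sum bs))
      where open CommutativeSemigroupProperties ℕₚ.+-commutativeSemigroup using () renaming (interchange to medial)

    opaque
      -- Induction on the total degree: a nonunit has positive total degree, so in a product of two
      -- nonunits both factors have smaller total degree than the product.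
      factorize : ∀ {f} → ¬ f ≈ 0ₚ → Factorization Irreducible f
      factorize {f₀} f₀≉0 with HasDegree-exists {f₀} f₀≉0
      ... | m₀ , d₀ = go (suc (Vec.sum m₀)) {f₀} {m₀} d₀ (ℕₚ.n<1+n _)
        where
        go : ∀ n {f m} → HasDegree m f → Vec.sum m ℕ.< n → Factorization Irreducible f
        go (suc n) {f} {m} d m<n with classify {f} (proj₁ d)
        ... | inj₁ f∣1        = unit f∣1
        ... | inj₂ (inj₁ irr) = cons {p = f} {d = 1ₚ} irr (R.sym {f * 1ₚ} {f} (R.*-identityʳ f)) (unit (1ₚ , R.*-identityʳ 1ₚ))
        ... | inj₂ (inj₂ (x , y , f≈xy , x∤1 , y∤1))
          with a , b , dx , dy , ≡.refl ← factorDegrees {m} {x} {y} {f} d (R.sym {f} {x * y} f≈xy)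
          rewrite sum-+ᵗ a b =
          factorization-* {Irreducible} {x} {y} {f} f≈xy
            (go n {x} {a} dx (ℕₚ.<-≤-trans (ℕₚ.m<m+n (Vec.sum a) (nonunit⇒sum>0 {b} {y} dy y∤1)) (ℕₚ.≤-pred m<n)))
            (go n {y} {b} dy (ℕₚ.<-≤-trans (ℕₚ.m<n+m (Vec.sum b) (nonunit⇒sum>0 {a} {x} dx x∤1)) (ℕₚ.≤-pred m<n)))

-- Induction on the number of variables

module _ {q : ℕ} (F : FiniteField q) where
  open FiniteField F using (1≢0; 0#)
  open PolynomialRing F
  private
    module P = Polynomials F
    module PF = PolynomialFacts F
    module D k = Divisibility (polyRing k)

  opaque
    poly-noZeroDivisors : ∀ k → IntegralDomain.NoZeroDivisors (polyRing k)
    poly-noZeroDivisors zero    f g fg≈0 with FieldElements._≟ᶜ_ F (P.coeff f []) 0#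
    ... | yes f≡0 = inj₁ λ { [] → f≡0 }
    ... | no  f≢0 = inj₂ λ { [] → decidable-stable (FieldElements._≟ᶜ_ F _ 0#) λ g≢0 →
      FiniteField.x*y≢0 F f≢0 g≢0 (≡.trans (≡.sym (FiniteField.+-identityʳ F _)) (fg≈0 [])) }
    poly-noZeroDivisors (suc k) = Extension.noZeroDivisors (polynomialExtension F k)
      (λ a → PF._≈?_ k a (P.0ₚ k)) (poly-noZeroDivisors k)

  1≉0ₚ : ∀ k → ¬ P._≈_ k (P.1ₚ k) (P.0ₚ k)
  1≉0ₚ k 1≈0 = 1≢0 (≡.trans (≡.sym (coeff-const-𝟘 k _)) (≡.trans (1≈0 𝟘) (coeff-0 k 𝟘)))

  opaque
    -- If `r` were nonzero, its degree in the first variable would be the sum of those of `u` and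
    -- `p`, hence at least `n`. But `r` has no nonzero coefficient there.
    poly-below-∣ : ∀ k {p r n} → let open PolynomialExtension (polynomialExtension F k) in
      ¬ P._≈_ k (slice p n) (P.0ₚ k) → Extension.Below (polynomialExtension F k) r n →
      P._∣_ (suc k) p r → P._≈_ (suc k) r (P.0ₚ (suc k))
    poly-below-∣ k {p} {r} {n} pₙ≉0 r<n (u , up≈r) with PF._≈?_ (suc k) r (P.0ₚ (suc k))
    ... | yes r≈0 = r≈0
    ... | no  r≉0
      with m , dr ← PF.HasDegree-exists (suc k) {r} r≉0
      with a , b , _ , dp , ≡.refl ← PF.factorDegrees (suc k)
             (poly-noZeroDivisors (suc k)) {m} {u} {p} {r} dr up≈r
      with e , pe≢0 ← PF.nonzeroCoeff k (PolynomialExtension.slice (polynomialExtension F k) p n) pₙ≉0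
      with proj₂ dr zero
    ... | _ , (l ∷ e′) , re≢0 , l≡ = contradiction
      (≡.trans (r<n l n≤l e′) (coeff-0 k e′)) re≢0
      where
      n≤l : n ℕ.≤ l
      n≤l = ℕₚ.≤-trans (proj₁ (proj₂ dp zero) (n ∷ e) pe≢0)
        (ℕₚ.≤-trans (ℕₚ.m≤n+m (lookup b zero) (lookup a zero))
          (ℕₚ.≤-reflexive (≡.trans (≡.sym (Vecₚ.lookup-zipWith ℕ._+_ zero a b)) (≡.sym l≡))))

  opaque
    -- Holds vacuously: in zero variables every nonzero polynomial is a unit.
    irreducible-splits-zero : ∀ {p} → D.Irreducible 0 p → D.Splits 0 p
    irreducible-splits-zero {p} irr = contradiction (PF.HasDegree-𝟘⇒∣1 0 (poly-noZeroDivisors 0) {p} p-const) (D.Irreducible.p∤1 irr)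
      where
      p-const : P.HasDegree 0 𝟘 p
      p-const with m , d ← PF.HasDegree-exists 0 {p} (D.Irreducible⇒≉0 0 (λ 0≈1 → 1≉0ₚ 0 (λ e → ≡.sym (0≈1 e))) {p} irr)
        with [] ← m = d

    irreducible-splits-suc : ∀ k → (∀ {p} → D.Irreducible k p → D.Splits k p) →
                             ∀ {p} → D.Irreducible (suc k) p → D.Splits (suc k) p
    irreducible-splits-suc k splits {p} irr = Extension.Step.irreducible-splits (polynomialExtension F k)
      (λ a → PF._≈?_ k a (P.0ₚ k))
      (PF._∣?_ k (poly-noZeroDivisors k))
      (1≉0ₚ k)
      (poly-noZeroDivisors k)
      (λ {c} → PF.factorize k (poly-noZeroDivisors k) {c})
      splits
      (λ {p} {r} → poly-below-∣ k {p} {r})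
      {p} irr

  poly-irreducible-splits : ∀ k {p} → D.Irreducible k p → D.Splits k p
  poly-irreducible-splits zero    {p} = irreducible-splits-zero {p}
  poly-irreducible-splits (suc k) {p} = irreducible-splits-suc k (λ {p} → poly-irreducible-splits k {p}) {p}

-- Unique factorization with degrees

-- The properties of the polynomial ring on which the counting arguments rest. Association `~` is a
-- relation of its own, tied to divisibility by `~⇒∣` and `∣∧degree⇒~`.
record GradedUFD (k : ℕ) : Set₁ where
  field
    commutativeRing : CommutativeRing 0ℓ 0ℓ
  open CommutativeRing commutativeRing public
  open Divisibility commutativeRing public
  infix 4 _~_ _~?_ _∣?_
  field
    _~_              : Carrier → Carrier → Set
    HasDegree        : Tuple k → Carrier → Set
    noZeroDivisors   : IntegralDomain.NoZeroDivisors commutativeRing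
    _∣?_             : ∀ x y → Dec (x ∣ y)
    _~?_             : ∀ x y → Dec (x ~ y)
    splits           : ∀ {p} → Irreducible p → Splits p
    factorize        : ∀ {x} → ¬ x ≈ 0# → Factorization Irreducible x
    ~-isEquivalence  : IsEquivalence _~_
    ≈⇒~              : ∀ {x y} → x ≈ y → x ~ y
    ~⇒∣              : ∀ {x y} → x ~ y → x ∣ y
    degree           : ∀ {x} → ¬ x ≈ 0# → ∃[ m ] HasDegree m x
    degree⇒≉0        : ∀ {m x} → HasDegree m x → ¬ x ≈ 0#
    degree-unique    : ∀ {m n x} → HasDegree m x → HasDegree n x → m ≡ n
    degree-~         : ∀ {m x y} → x ~ y → HasDegree m y → HasDegree m x
    degree-*         : ∀ {m n x y} → HasDegree m x → HasDegree n y → HasDegree (m +ᵗ n) (x * y)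
    factorDegrees    : ∀ {m x y z} → HasDegree m z → x * y ≈ z →
                       ∃[ a ] ∃[ b ] HasDegree a x × HasDegree b y × a +ᵗ b ≡ m
    degree-1         : HasDegree 𝟘 1#
    degree-𝟘⇒~1      : ∀ {x} → HasDegree 𝟘 x → x ~ 1#
    ∣∧degree⇒~       : ∀ {m x y} → HasDegree m x → HasDegree m y → x ∣ y → y ~ x

module UniqueFactorization {k : ℕ} (U : GradedUFD k) where
  open GradedUFD U public
  open IsEquivalence ~-isEquivalence public
    using () renaming (refl to ~-refl; sym to ~-sym; trans to ~-trans)

  product : List Carrier → Carrier
  product = List.foldr _*_ 1#

  Distinct : List Carrier → Set
  Distinct = AllPairs (λ x y → ¬ x ~ y)

  *-cancelˡ : ∀ {x y z} → ¬ x ≈ 0# → x * y ≈ x * z → y ≈ z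
  *-cancelˡ = IntegralDomain.*-cancelˡ commutativeRing noZeroDivisors

  ∣-cancelˡ : ∀ {x y z} → ¬ x ≈ 0# → x * y ∣ x * z → y ∣ z
  ∣-cancelˡ {x} {y} x≉0 (u , uxy≈xz) =
    u , *-cancelˡ x≉0 (trans (RingIdentities.*-left-comm commutativeRing x u y) uxy≈xz)

  ≉0-~ : ∀ {x y} → x ~ y → ¬ y ≈ 0# → ¬ x ≈ 0#
  ≉0-~ x~y y≉0 with m , d ← degree y≉0 = degree⇒≉0 (degree-~ x~y d)

  *-≉0 : ∀ {x y} → ¬ x ≈ 0# → ¬ y ≈ 0# → ¬ x * y ≈ 0#
  *-≉0 x≉0 y≉0 xy≈0 = Sum.[ x≉0 , y≉0 ] (noZeroDivisors _ _ xy≈0)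

  ≈*⇒≉0ʳ : ∀ {x y z} → ¬ z ≈ 0# → z ≈ x * y → ¬ y ≈ 0#
  ≈*⇒≉0ʳ z≉0 z≈xy y≈0 = z≉0 (trans z≈xy (trans (*-congˡ y≈0) (zeroʳ _)))

  ∣-~ˡ : ∀ {x y z} → x ~ y → y ∣ z → x ∣ z
  ∣-~ˡ x~y = ∣-trans (~⇒∣ x~y)

  ∣-~ʳ : ∀ {x y z} → y ~ z → x ∣ y → x ∣ z
  ∣-~ʳ y~z x∣y = ∣-trans x∣y (~⇒∣ y~z)

  ∣1⇒~1 : ∀ {x} → x ∣ 1# → x ~ 1#
  ∣1⇒~1 {x} (u , ux≈1) with a , b , _ , dx , a+b≡𝟘 ← factorDegrees degree-1 ux≈1 =
    degree-𝟘⇒~1 (≡.subst (λ b → HasDegree b x) (a+b≡𝟘⇒b≡𝟘 a a+b≡𝟘) dx)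

  -- Both products have the same degree and one divides the other, which forces association. The
  -- elements must be nonzero in order to have degrees.
  *-cong-~ : ∀ {x x′ y y′} → ¬ x′ ≈ 0# → ¬ y′ ≈ 0# → x ~ x′ → y ~ y′ → x * y ~ x′ * y′
  *-cong-~ {x} {x′} {y} {y′} x′≉0 y′≉0 x~x′ y~y′ with degree x′≉0 | degree y′≉0
  ... | m , dx | n , dy = ∣∧degree⇒~ (degree-* dx dy) (degree-* (degree-~ x~x′ dx) (degree-~ y~y′ dy))
    (∣-trans (*-mono-∣ x′ (~⇒∣ (~-sym y~y′)))
             (∣-respʳ (*-comm y x) (∣-respˡ (*-comm y x′) (*-mono-∣ y (~⇒∣ (~-sym x~x′))))))

  *-congˡ-~ : ∀ {x y y′} → ¬ x ≈ 0# → ¬ y′ ≈ 0# → y ~ y′ → x * y ~ x * y′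
  *-congˡ-~ x≉0 y′≉0 = *-cong-~ x≉0 y′≉0 ~-refl

  *-cancelˡ-~ : ∀ {x y z} → ¬ x ≈ 0# → ¬ y ≈ 0# → ¬ z ≈ 0# → x * y ~ x * z → y ~ z
  *-cancelˡ-~ {x} {y} {z} x≉0 y≉0 z≉0 xy~xz with degree x≉0 | degree y≉0 | degree z≉0
  ... | l , dx | m , dy | n , dz
    with ≡.refl ← +ᵗ-cancelˡ l (degree-unique (degree-* dx dy) (degree-~ xy~xz (degree-* dx dz))) =
    ∣∧degree⇒~ dz dy (∣-cancelˡ x≉0 (~⇒∣ (~-sym xy~xz)))

  irreducible-≉0 : ∀ {p} → Irreducible p → ¬ p ≈ 0#
  irreducible-≉0 = Irreducible⇒≉0 (λ 0≈1 → degree⇒≉0 degree-1 (sym 0≈1))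

  irreducible-∣⇒~ : ∀ {p r} → Irreducible p → Irreducible r → p ∣ r → p ~ r
  irreducible-∣⇒~ {p} {r} p-irr r-irr (u , up≈r) with Irreducible.split-∣1 r-irr (sym up≈r)
  ... | inj₂ p∣1 = contradiction p∣1 (Irreducible.p∤1 p-irr)
  ... | inj₁ u∣1 = ~-sym (~-trans (≈⇒~ (sym up≈r)) (~-trans
    (*-cong-~ (degree⇒≉0 degree-1) (irreducible-≉0 p-irr) (∣1⇒~1 u∣1) ~-refl) (≈⇒~ (*-identityˡ p))))

  irreducible-~ : ∀ {p r} → p ~ r → Irreducible r → Irreducible p
  irreducible-~ {p} {r} p~r r-irr = mkIrred
    (λ p∣1 → Irreducible.p∤1 r-irr (∣-~ˡ (~-sym p~r) p∣1))
    (λ {x} {y} p≈xy → split (~⇒∣ p~r) p≈xy)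
    where
    split : ∀ {x y} → p ∣ r → p ≈ x * y → x ∣ 1# ⊎ y ∣ 1#
    split {x} {y} (u , up≈r) p≈xy with Irreducible.split-∣1 r-irr
      {u * x} {y} (trans (sym up≈r) (trans (*-congˡ p≈xy) (sym (*-assoc u x y))))
    ... | inj₁ ux∣1 = inj₁ (∣-trans (x∣ʳyx x u) ux∣1)
    ... | inj₂ y∣1  = inj₂ y∣1

  -- Split off one irreducible factor `p`: the product `p * d` is irreducible exactly if `d` is a
  -- unit.
  irreducible? : ∀ {x} → ¬ x ≈ 0# → Dec (Irreducible x)
  irreducible? x≉0 with factorize x≉0
  ... | unit x∣1 = no (λ irr → Irreducible.p∤1 irr x∣1)
  ... | cons {p} {d} p-irr x≈pd _ with d ∣? 1#
  ...   | no d∤1 = no (λ irr → Sum.[ Irreducible.p∤1 p-irr , d∤1 ] (Irreducible.split-∣1 irr x≈pd))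
  ...   | yes d∣1 = yes (irreducible-~ (~-trans (≈⇒~ (trans x≈pd (*-comm p d)))
    (~-trans (*-cong-~ (degree⇒≉0 degree-1) (irreducible-≉0 p-irr) (∣1⇒~1 d∣1) ~-refl) (≈⇒~ (*-identityˡ p)))) p-irr)

  product-≉0 : ∀ {ps} → All Irreducible ps → ¬ product ps ≈ 0#
  product-≉0 []          = degree⇒≉0 degree-1
  product-≉0 (irr ∷ irrs) = *-≉0 (irreducible-≉0 irr) (product-≉0 irrs)

  ∣product⇒Any~ : ∀ {p} → Irreducible p → ∀ {ps} → All Irreducible ps → p ∣ product ps → Any (p ~_) ps
  ∣product⇒Any~ p-irr []           p∣1 = contradiction p∣1 (Irreducible.p∤1 p-irr)
  ∣product⇒Any~ p-irr (irr ∷ irrs) p∣  with splits p-irr p∣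
  ... | inj₁ p∣q  = here (irreducible-∣⇒~ p-irr irr p∣q)
  ... | inj₂ p∣qs = there (∣product⇒Any~ p-irr irrs p∣qs)

  Any~⇒∣product : ∀ {p ps} → Any (p ~_) ps → p ∣ product ps
  Any~⇒∣product (here p~q)  = ∣-trans (~⇒∣ p~q) (x∣xy _ _)
  Any~⇒∣product (there p∈ps) = x∣ʳy⇒x∣ʳzy _ (Any~⇒∣product p∈ps)

  head∤product : ∀ {p ps} → All Irreducible (p ∷ ps) → Distinct (p ∷ ps) → ¬ p ∣ product ps
  head∤product (irr ∷ irrs) (p≁ ∷ _) p∣ with q , q∈ , p~q ← find (∣product⇒Any~ irr irrs p∣) =
    All.lookup p≁ q∈ p~q

  -- The factor found in the list is merely associated to `p`, so the conclusion holds up to `~`.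
  -- The lengths are recorded for `length-unique`.
  extract : ∀ {p} → Irreducible p → ∀ {qs} → All Irreducible qs → p ∣ product qs →
    ∃[ rs ] All Irreducible rs × length qs ≡ suc (length rs) × product qs ~ p * product rs
  extract p-irr []                        p∣1 = contradiction p∣1 (Irreducible.p∤1 p-irr)
  extract {p} p-irr {q ∷ qs} (irr ∷ irrs) p∣  with splits p-irr p∣
  ... | inj₁ p∣q = qs , irrs , ≡.refl
    , *-cong-~ (irreducible-≉0 p-irr) (product-≉0 irrs) (~-sym (irreducible-∣⇒~ p-irr irr p∣q)) ~-refl
  ... | inj₂ p∣qs with extract p-irr irrs p∣qs
  ...   | rs , rs-irr , len , qs~prs = q ∷ rs , irr ∷ rs-irr , ≡.cong suc len , ~-trans
    (*-congˡ-~ (irreducible-≉0 irr) (*-≉0 (irreducible-≉0 p-irr) (product-≉0 rs-irr)) qs~prs)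
    (≈⇒~ (RingIdentities.*-left-comm commutativeRing q p (product rs)))

  -- The part of unique factorization that makes the sign `-1ℤ ^ length ps` in the Möbius function
  -- well defined.
  length-unique : ∀ {ps qs} → All Irreducible ps → All Irreducible qs → product ps ~ product qs → length ps ≡ length qs
  length-unique {[]} {[]} _ _ _ = ≡.refl
  length-unique {[]} {q ∷ qs} _ (irr ∷ _) 1~ =
    contradiction (∣-trans (x∣xy q (product qs)) (~⇒∣ (~-sym 1~))) (Irreducible.p∤1 irr)
  length-unique {p ∷ ps} {qs} (irr ∷ irrs) qs-irr eq
    with rs , rs-irr , len , qs~prs ← extract irr qs-irr (∣-trans (x∣xy p (product ps)) (~⇒∣ eq)) =
    ≡.trans (≡.cong suc (length-unique irrs rs-irr
      (*-cancelˡ-~ (irreducible-≉0 irr) (product-≉0 irrs) (product-≉0 rs-irr) (~-trans eq qs~prs)))) (≡.sym len)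

  -- If `p` divides the head `q`, then `p` is associated to it, and cancelling one factor makes `p`
  -- divide the remaining product, against distinctness. Otherwise both factors `p` pass to the
  -- remaining product, since `p` splits.
  square∤distinct : ∀ {p ps} → Irreducible p → All Irreducible ps → Distinct ps → ¬ p * p ∣ product ps
  square∤distinct {p} p-irr []           _           pp∣ = Irreducible.p∤1 p-irr (∣-trans (x∣xy p p) pp∣)
  square∤distinct {p} {q ∷ qs} p-irr irrs@(irr ∷ irrs′) dist@(_ ∷ dist′) pp∣ with p ∣? q
  ... | yes p∣q = head∤product irrs dist (∣-~ˡ q~p (∣-cancelˡ (irreducible-≉0 p-irr) (∣-~ʳ
    (*-cong-~ (irreducible-≉0 p-irr) (product-≉0 irrs′) q~p ~-refl) pp∣)))
    where q~p = ~-sym (irreducible-∣⇒~ p-irr irr p∣q)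
  ... | no  p∤q with splits p-irr (∣-trans (x∣xy p p) pp∣)
  ...   | inj₁ p∣q = contradiction p∣q p∤q
  ...   | inj₂ (c , cp≈) with splits p-irr {q} {c} (∣-cancelˡ (irreducible-≉0 p-irr) (∣-respʳ
            (trans (*-congˡ (trans (sym cp≈) (*-comm c p))) (RingIdentities.*-left-comm commutativeRing q p c)) pp∣))
  ...     | inj₁ p∣q = contradiction p∣q p∤q
  ...     | inj₂ p∣c = square∤distinct p-irr irrs′ dist′ (∣-respʳ (trans (*-comm p c) cp≈) (*-mono-∣ p p∣c))

  -- The Möbius function

  SquareFree HasSquare : Carrier → Set
  SquareFree h = ∃[ ps ] All Irreducible ps × Distinct ps × h ~ product ps
  HasSquare  h = ∃[ p ] Irreducible p × p * p ∣ h

  squareFree? : ∀ {h} → ¬ h ≈ 0# → SquareFree h ⊎ HasSquare h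
  squareFree? h≉0 = go h≉0 (factorize h≉0)
    where
    go : ∀ {h} → ¬ h ≈ 0# → Factorization Irreducible h → SquareFree h ⊎ HasSquare h
    go h≉0 (unit h∣1) = inj₁ ([] , [] , [] , ∣1⇒~1 h∣1)
    go {h} h≉0 (cons {p} {d} irr h≈pd fact) with p ∣? d
    ... | yes p∣d = inj₂ (p , irr , ∣-respʳ (sym h≈pd) (*-mono-∣ p p∣d))
    ... | no  p∤d with go (≈*⇒≉0ʳ h≉0 h≈pd) fact
    ...   | inj₂ (q , q-irr , qq∣d) = inj₂ (q , q-irr , ∣-respʳ (sym h≈pd) (x∣ʳy⇒x∣ʳzy p qq∣d))
    ...   | inj₁ (ps , irrs , dist , d~ps) = inj₁
      ( p ∷ ps , irr ∷ irrs , All.tabulate (λ q∈ p~q → p∤d (∣-~ʳ (~-sym d~ps) (Any~⇒∣product (lose q∈ p~q)))) ∷ dist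
      , ~-trans (≈⇒~ h≈pd) (*-congˡ-~ (irreducible-≉0 irr) (product-≉0 irrs) d~ps))

  record IsMöbiusFunction (μ : Carrier → ℤ) : Set where
    field
      distinct : ∀ h ps → All Irreducible ps → Distinct ps → h ~ product ps → μ h ≡ -1ℤ ℤ.^ length ps
      square   : ∀ h p → ¬ h ≈ 0# → Irreducible p → p * p ∣ h → μ h ≡ 0ℤ

    μ-~ : ∀ {h h′} → ¬ h′ ≈ 0# → h ~ h′ → μ h ≡ μ h′
    μ-~ {h} {h′} h′≉0 h~h′ with squareFree? h′≉0
    ... | inj₁ (ps , irrs , dist , h′~ps) =
      ≡.trans (distinct h ps irrs dist (~-trans h~h′ h′~ps)) (≡.sym (distinct h′ ps irrs dist h′~ps))
    ... | inj₂ (p , irr , pp∣h′) =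
      ≡.trans (square h p (≉0-~ h~h′ h′≉0) irr (∣-~ʳ (~-sym h~h′) pp∣h′)) (≡.sym (square h′ p h′≉0 irr pp∣h′))

    μ-1 : ∀ {h} → h ~ 1# → μ h ≡ 1ℤ
    μ-1 {h} h~1 = distinct h [] [] [] h~1

    μ-∣ : ∀ {p h} → Irreducible p → ¬ h ≈ 0# → p ∣ h → μ (p * h) ≡ 0ℤ
    μ-∣ {p} {h} irr h≉0 p∣h = square (p * h) p (*-≉0 (irreducible-≉0 irr) h≉0) irr (*-mono-∣ p p∣h)

    -- With `μ-1`, `μ-~` and `μ-∣`, this is all that the two summation formulas use of `μ`.
    μ-∤ : ∀ {p h} → Irreducible p → ¬ h ≈ 0# → ¬ p ∣ h → μ (p * h) ≡ ℤ.- μ h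
    μ-∤ {p} {h} irr h≉0 p∤h with squareFree? h≉0
    ... | inj₂ (q , q-irr , qq∣h) = ≡.trans
      (square (p * h) q (*-≉0 (irreducible-≉0 irr) h≉0) q-irr (x∣ʳy⇒x∣ʳzy p qq∣h))
      (≡.cong ℤ.-_ (≡.sym (square h q h≉0 q-irr qq∣h)))
    ... | inj₁ (ps , irrs , dist , h~ps) = ≡.trans
      (distinct (p * h) (p ∷ ps) (irr ∷ irrs)
        (All.tabulate (λ q∈ p~q → p∤h (∣-~ʳ (~-sym h~ps) (Any~⇒∣product (lose q∈ p~q)))) ∷ dist)
        (*-congˡ-~ (irreducible-≉0 irr) (product-≉0 irrs) h~ps))
      (≡.trans (ℤₚ.-1*i≡-i (-1ℤ ℤ.^ length ps)) (≡.cong ℤ.-_ (≡.sym (distinct h ps irrs dist h~ps))))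

  möbius : ∀ {h} → Dec (h ≈ 0#) → ℤ
  -- A default value; the defining conditions prescribe nothing at zero.
  möbius (yes _)   = 0ℤ
  möbius (no h≉0) with squareFree? h≉0
  ... | inj₁ (ps , _) = -1ℤ ℤ.^ length ps
  ... | inj₂ _        = 0ℤ

  möbius-isMöbius : (_≟0 : ∀ h → Dec (h ≈ 0#)) → IsMöbiusFunction (λ h → möbius (h ≟0))
  möbius-isMöbius _≟0 = record
    { distinct = λ h ps irrs dist h~ps → isDistinct (h ≟0) irrs dist h~ps
    ; square   = λ h p h≉0 irr pp∣h → isSquare (h ≟0) h≉0 irr pp∣h
    }
    where
    isDistinct : ∀ {h ps} (d : Dec (h ≈ 0#)) → All Irreducible ps → Distinct ps → h ~ product ps →
                 möbius d ≡ -1ℤ ℤ.^ length ps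
    isDistinct (yes h≈0) irrs dist h~ps = contradiction h≈0 (≉0-~ h~ps (product-≉0 irrs))
    isDistinct (no h≉0)  irrs dist h~ps with squareFree? h≉0
    ... | inj₁ (qs , irrs′ , _ , h~qs) =
      ≡.cong (-1ℤ ℤ.^_) (length-unique irrs′ irrs (~-trans (~-sym h~qs) h~ps))
    ... | inj₂ (p , irr , pp∣h) = contradiction (∣-~ʳ h~ps pp∣h) (square∤distinct irr irrs dist)

    isSquare : ∀ {h p} (d : Dec (h ≈ 0#)) → ¬ h ≈ 0# → Irreducible p → p * p ∣ h → möbius d ≡ 0ℤ
    isSquare (yes h≈0) h≉0 irr pp∣h = contradiction h≈0 h≉0
    isSquare (no h≉0)  _   irr pp∣h with squareFree? h≉0
    ... | inj₁ (ps , irrs , dist , h~ps) = contradiction (∣-~ʳ h~ps pp∣h) (square∤distinct irr irrs dist)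
    ... | inj₂ _ = ≡.refl

-- Indicator sums and systems of representatives

open import Data.Integer.Base using (+_)
open Sums ℤₚ.+-*-commutativeRing renaming (sum to sumℤ)

𝟙 : {P : Set} → Dec P → ℤ
𝟙 (yes _) = 1ℤ
𝟙 (no  _) = 0ℤ

module _ {P : Set} where

  𝟙-yes : (d : Dec P) → P → 𝟙 d ≡ 1ℤ
  𝟙-yes (yes _) _ = ≡.refl
  𝟙-yes (no ¬p) p = contradiction p ¬p

  𝟙-no : (d : Dec P) → ¬ P → 𝟙 d ≡ 0ℤ
  𝟙-no (yes p) ¬p = contradiction p ¬p
  𝟙-no (no _)  _  = ≡.refl

  𝟙-cong : ∀ {Q : Set} (d : Dec P) (d′ : Dec Q) → (P → Q) → (Q → P) → 𝟙 d ≡ 𝟙 d′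
  𝟙-cong d (yes q) _ g = 𝟙-yes d (g q)
  𝟙-cong d (no ¬q) f _ = 𝟙-no d (¬q ∘ f)

  𝟙-× : ∀ {Q : Set} (d : Dec P) (d′ : Dec Q) → 𝟙 (d ×-dec d′) ≡ 𝟙 d ℤ.* 𝟙 d′
  𝟙-× (yes _) (yes _) = ≡.refl
  𝟙-× (yes _) (no _)  = ≡.refl
  𝟙-× (no _)  _       = ≡.refl

  𝟙+𝟙¬ : (d : Dec P) → 𝟙 d ℤ.+ 𝟙 (¬? d) ≡ 1ℤ
  𝟙+𝟙¬ (yes _) = ≡.refl
  𝟙+𝟙¬ (no _)  = ≡.refl

module _ {X : Set} where

  sum-1 : ∀ (xs : List X) → sumℤ xs (λ _ → 1ℤ) ≡ + length xs
  sum-1 []       = ≡.refl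
  sum-1 (x ∷ xs) = ≡.cong (ℤ._+_ 1ℤ) (sum-1 xs)

  sum-neg : ∀ (xs : List X) (f : X → ℤ) → sumℤ xs (λ x → ℤ.- f x) ≡ ℤ.- sumℤ xs f
  sum-neg []       f = ≡.refl
  sum-neg (x ∷ xs) f = ≡.trans (≡.cong (ℤ._+_ (ℤ.- f x)) (sum-neg xs f)) (≡.sym (ℤₚ.neg-distrib-+ (f x) (sumℤ xs f)))

  sum-filter : ∀ {P : X → Set} (P? : ∀ x → Dec (P x)) (xs : List X) (f : X → ℤ) →
               sumℤ (List.filter P? xs) f ≡ sumℤ xs (λ x → 𝟙 (P? x) ℤ.* f x)
  sum-filter P? []       f = ≡.refl
  sum-filter P? (x ∷ xs) f with P? x
  ... | yes _ = ≡.cong₂ ℤ._+_ (≡.sym (ℤₚ.*-identityˡ (f x))) (sum-filter P? xs f)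
  ... | no  _ = ≡.trans (sum-filter P? xs f) (≡.sym (ℤₚ.+-identityˡ _))

  sum-none : ∀ {P : X → Set} (P? : ∀ x → Dec (P x)) (xs : List X) →
             (∀ {x} → x ∈ xs → ¬ P x) → sumℤ xs (λ x → 𝟙 (P? x)) ≡ 0ℤ
  sum-none P? xs none = sum-zero-∈ xs (λ {x} x∈ → 𝟙-no (P? x) (none x∈))

  -- The basic tool of every double count below. The relation `R` is kept general because it is used
  -- both for `~` and for its version on pairs.
  sum-unique : ∀ {R : X → X → Set} {P : X → Set} (P? : ∀ x → Dec (P x)) {xs} →
               AllPairs (λ x y → ¬ R x y) xs → (∀ {x y} → x ∈ xs → y ∈ xs → P x → P y → R x y) →
               Any P xs → sumℤ xs (λ x → 𝟙 (P? x)) ≡ 1ℤ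
  sum-unique P? {x ∷ xs} (x≁ ∷ dist) P⇒R any with P? x
  ... | yes Px = ≡.cong (ℤ._+_ 1ℤ) (sum-none P? xs (λ y∈ Py → All.lookup x≁ y∈ (P⇒R (here ≡.refl) (there y∈) Px Py)))
  ... | no ¬Px = ≡.trans (ℤₚ.+-identityˡ _) (sum-unique P? dist (λ x∈ y∈ → P⇒R (there x∈) (there y∈)) (Any.tail ¬Px any))

  -- A transversal of the classes in `Q`; sums over normalized polynomials become sums over such
  -- lists.
  record Representatives (_~_ : X → X → Set) (Q : X → Set) (xs : List X) : Set where
    field
      sound    : All Q xs
      distinct : AllPairs (λ x y → ¬ x ~ y) xs
      complete : ∀ {x} → Q x → Any (x ~_) xs

sum-concatMap : ∀ {X Y : Set} (g : X → List Y) (xs : List X) (f : Y → ℤ) →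
                sumℤ (concatMap g xs) f ≡ sumℤ xs (λ x → sumℤ (g x) f)
sum-concatMap g []       f = ≡.refl
sum-concatMap g (x ∷ xs) f = ≡.trans (sum-++ (g x) (concatMap g xs) f) (≡.cong (ℤ._+_ (sumℤ (g x) f)) (sum-concatMap g xs f))

box-unique : ∀ {k} (m : Tuple k) → Unique (box m)
box-unique []       = [] ∷ []
box-unique (m ∷ ms) = Uniqueₚ.cartesianProductWith⁺ _∷_ Vecₚ.∷-injective (Uniqueₚ.upTo⁺ (suc m)) (box-unique ms)

m+[n∸m]≡n : ∀ {k} {m n : Tuple k} → m ≤ᵗ n → m +ᵗ (n ∸ᵗ m) ≡ n
m+[n∸m]≡n []       = ≡.refl
m+[n∸m]≡n (p ∷ ps) = ≡.cong₂ _∷_ (ℕₚ.m+[n∸m]≡n p) (m+[n∸m]≡n ps)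

-- Counting coprime pairs

module Counting {k : ℕ} (U : GradedUFD k) where
  open UniqueFactorization U

  -- Lists for different degrees cannot contain associated elements, because associated elements
  -- have the same degree.
  concatMap-representatives : ∀ {Q : Tuple k → Carrier → Set} {E} → (∀ {d x} → Q d x → HasDegree d x) →
    (∀ d → Representatives _~_ (Q d) (E d)) → ∀ {ds} → Unique ds →
    Representatives _~_ (λ x → ∃[ d ] d ∈ ds × Q d x) (concatMap E ds)
  concatMap-representatives {Q} {E} Q⇒degree reps = go
    where
    open Representatives
    go : ∀ {ds} → Unique ds → Representatives _~_ (λ x → ∃[ d ] d ∈ ds × Q d x) (concatMap E ds)
    go {[]}     []             = record { sound = [] ; distinct = [] ; complete = λ { (_ , () , _) } }
    go {d ∷ ds} (d∉ ∷ ds-uniq) = record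
      { sound    = Allₚ.++⁺ (All.map (λ q → d , here ≡.refl , q) (sound (reps d)))
                            (All.map (λ (d′ , d′∈ , q) → d′ , there d′∈ , q) (sound rest))
      ; distinct = AllPairsₚ.++⁺ (distinct (reps d)) (distinct rest)
          (All.map (λ {x} q → All.map (λ { (d′ , d′∈ , q′) x~y → All.lookup d∉ d′∈
            (degree-unique (Q⇒degree q) (degree-~ x~y (Q⇒degree q′))) }) (sound rest)) (sound (reps d)))
      ; complete = λ { (d′ , here ≡.refl , q) → Anyₚ.++⁺ˡ (complete (reps d) q)
                     ; (d′ , there d′∈ , q)   → Anyₚ.++⁺ʳ (E d) (complete rest (d′ , d′∈ , q)) }
      }
      where rest = go ds-uniq

  sum-at : ∀ {Q xs} → Representatives _~_ Q xs → ∀ {y} → Q y → (w : Carrier → ℤ) →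
           (∀ {x} → x ~ y → w x ≡ w y) → sumℤ xs (λ x → 𝟙 (x ~? y) ℤ.* w x) ≡ w y
  sum-at {Q} {xs} reps {y} qy w w-~ = begin
    sumℤ xs (λ x → 𝟙 (x ~? y) ℤ.* w x)  ≡⟨ sum-cong xs move ⟩
    sumℤ xs (λ x → 𝟙 (x ~? y) ℤ.* w y)  ≡⟨ sum-*ʳ xs (w y) (λ x → 𝟙 (x ~? y)) ⟩
    sumℤ xs (λ x → 𝟙 (x ~? y)) ℤ.* w y  ≡⟨ ≡.cong (ℤ._* w y) (sum-unique (_~? y) distinct
                                             (λ _ _ x~y x′~y → ~-trans x~y (~-sym x′~y)) (Any.map ~-sym (complete qy))) ⟩
    1ℤ ℤ.* w y                         ≡⟨ ℤₚ.*-identityˡ (w y) ⟩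
    w y                                ∎
    where
    open ≡-Reasoning
    open Representatives reps
    move : ∀ x → 𝟙 (x ~? y) ℤ.* w x ≡ 𝟙 (x ~? y) ℤ.* w y
    move x with x ~? y
    ... | yes x~y = ≡.cong (ℤ._*_ 1ℤ) (w-~ x~y)
    ... | no  _   = ≡.refl

  -- Run through the irreducible factors of `f`; one that divides `g` is a common factor. If `p`
  -- does not divide `g`, it divides no common divisor `z` of `p * d` and `g`, so it divides the
  -- cofactor of `z`, and `z` divides `d`.
  coprime⊎common : ∀ {f g} → ¬ f ≈ 0# → Coprime f g ⊎ ∃[ p ] Irreducible p × p ∣ f × p ∣ g
  coprime⊎common {f} {g} f≉0 = go (factorize f≉0)
    where
    go : ∀ {f} → Factorization Irreducible f → Coprime f g ⊎ ∃[ p ] Irreducible p × p ∣ f × p ∣ g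
    go (unit f∣1) = inj₁ (λ z∣f _ → ∣-trans z∣f f∣1)
    go {f} (cons {p} {d} irr f≈pd fact) with p ∣? g
    ... | yes p∣g = inj₂ (p , irr , ∣-respʳ (sym f≈pd) (x∣xy p d) , p∣g)
    ... | no  p∤g with go fact
    ...   | inj₂ (r , r-irr , r∣d , r∣g) = inj₂ (r , r-irr , ∣-respʳ (sym f≈pd) (x∣ʳy⇒x∣ʳzy p r∣d) , r∣g)
    ...   | inj₁ coprime = inj₁ λ {z} z∣f z∣g → coprime (z∣d z z∣f z∣g) z∣g
      where
      z∣d : ∀ z → z ∣ f → z ∣ g → z ∣ d
      z∣d z (w , wz≈f) z∣g with splits irr {w} {z} (∣-respʳ (sym (trans wz≈f f≈pd)) (x∣xy p d))
      ... | inj₂ p∣z = contradiction (∣-trans p∣z z∣g) p∤g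
      ... | inj₁ (w′ , w′p≈w) = w′ , *-cancelˡ (irreducible-≉0 irr) (begin
        p * (w′ * z)  ≈⟨ *-assoc p w′ z ⟨
        p * w′ * z    ≈⟨ *-congʳ (trans (*-comm p w′) w′p≈w) ⟩
        w * z         ≈⟨ trans wz≈f f≈pd ⟩
        p * d         ∎)
        where open SetoidReasoning setoid

  coprime? : ∀ {f g} → ¬ f ≈ 0# → Dec (Coprime f g)
  coprime? {f} {g} f≉0 with coprime⊎common {f} {g} f≉0
  ... | inj₁ coprime               = yes coprime
  ... | inj₂ (p , irr , p∣f , p∣g) = no (λ coprime → Irreducible.p∤1 irr (coprime p∣f p∣g))

  module _ {E : Tuple k → List Carrier} (reps : ∀ m → Representatives _~_ (HasDegree m) (E m)) where
    open Representatives

    -- Count the pairs `(f , g)` with `f ~ h * g` in two ways: a multiple `f` of `h` has one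
    -- cofactor `g` up to `~`, of degree `m ∸ᵗ d`, and every such `g` gives one `f`.
    count-multiples : ∀ {d m h} → HasDegree d h → d ≤ᵗ m →
                      sumℤ (E m) (λ f → 𝟙 (h ∣? f)) ≡ + length (E (m ∸ᵗ d))
    count-multiples {d} {m} {h} dh d≤m = begin
      sumℤ (E m) (λ f → 𝟙 (h ∣? f))
        ≡⟨ sum-cong-∈ (E m) (λ {f} f∈ → cofactors f (All.lookup (sound (reps m)) f∈)) ⟨
      sumℤ (E m) (λ f → sumℤ (E n) (λ g → 𝟙 (f ~? h * g)))
        ≡⟨ sum-swap (E m) (E n) (λ f g → 𝟙 (f ~? h * g)) ⟩
      sumℤ (E n) (λ g → sumℤ (E m) (λ f → 𝟙 (f ~? h * g)))
        ≡⟨ sum-cong-∈ (E n) (λ {g} g∈ → sum-unique (_~? h * g) (distinct (reps m))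
             (λ _ _ f~hg f′~hg → ~-trans f~hg (~-sym f′~hg))
             (Any.map ~-sym (complete (reps m)
               (≡.subst (λ m → HasDegree m (h * g)) d+n≡m (degree-* dh (All.lookup (sound (reps n)) g∈)))))) ⟩
      sumℤ (E n) (λ _ → 1ℤ)
        ≡⟨ sum-1 (E n) ⟩
      + length (E n) ∎
      where
      open ≡-Reasoning
      n = m ∸ᵗ d
      d+n≡m : d +ᵗ n ≡ m
      d+n≡m = m+[n∸m]≡n d≤m
      cofactors : ∀ f → HasDegree m f → sumℤ (E n) (λ g → 𝟙 (f ~? h * g)) ≡ 𝟙 (h ∣? f)
      cofactors f df with h ∣? f
      ... | no  h∤f = sum-none (λ g → f ~? h * g) (E n)
        (λ {g} _ f~hg → h∤f (∣-~ʳ (~-sym f~hg) (x∣xy h g)))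
      ... | yes (u , uh≈f) with factorDegrees df uh≈f
      ...   | a , b , du , dh′ , a+b≡m = sum-unique (λ g → f ~? h * g) (distinct (reps n))
        (λ g∈ g′∈ f~hg f~hg′ → *-cancelˡ-~ (degree⇒≉0 dh) (≉0 g∈) (≉0 g′∈) (~-trans (~-sym f~hg) f~hg′))
        (Any.map f~h* (complete (reps n) (≡.subst (λ a → HasDegree a u) a≡n du)))
        where
        ≉0 : ∀ {g} → g ∈ E n → ¬ g ≈ 0#
        ≉0 g∈ = degree⇒≉0 (All.lookup (sound (reps n)) g∈)
        a≡n : a ≡ n
        a≡n = +ᵗ-cancelˡ d (≡.trans (+ᵗ-comm d a)
          (≡.trans (≡.cong (a +ᵗ_) (degree-unique dh dh′)) (≡.trans a+b≡m (≡.sym d+n≡m))))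
        f~h* : ∀ {g} → u ~ g → f ~ h * g
        f~h* u~g = ~-trans (≈⇒~ (trans (sym uh≈f) (*-comm u h)))
          (*-congˡ-~ (degree⇒≉0 dh) (≉0-~ (~-sym u~g) (degree⇒≉0 du)) u~g)

    commonDegrees : Tuple k → Tuple k → List (Tuple k)
    commonDegrees m n = List.filter (_≤ᵗ? n) (box m)

    commonDegrees⁻ : ∀ {m n d} → d ∈ commonDegrees m n → d ≤ᵗ m × d ≤ᵗ n
    commonDegrees⁻ {m} {n} d∈ with ∈ₚ.∈-filter⁻ (_≤ᵗ? n) {xs = box m} d∈
    ... | d∈box , d≤n = ∈-box⁻ m d∈box , d≤n

    -- Represents every common divisor of every `f` of degree `m` and `g` of degree `n`. One list
    -- serves all pairs, so that the sum over divisors can be exchanged with the sums over `f` and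
    -- `g`.
    candidates : Tuple k → Tuple k → List Carrier
    candidates m n = concatMap E (commonDegrees m n)

    candidates-representatives : ∀ m n →
      Representatives _~_ (λ h → ∃[ d ] d ∈ commonDegrees m n × HasDegree d h) (candidates m n)
    candidates-representatives m n = concatMap-representatives (λ d → d) reps (Uniqueₚ.filter⁺ (_≤ᵗ? n) (box-unique m))

    module _ {μ : Carrier → ℤ} (isMöbius : IsMöbiusFunction μ) where
      open IsMöbiusFunction isMöbius using (μ-~; μ-1; μ-∣; μ-∤)

      commonDivisor? : ∀ f g h → Dec (h ∣ f × h ∣ g)
      commonDivisor? f g h = (h ∣? f) ×-dec (h ∣? g)

      module _ {m n f g} (df : HasDegree m f) (dg : HasDegree n g) where

        private
          T = candidates m n
          T-reps = candidates-representatives m n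

          δ : Carrier → ℤ
          δ h = 𝟙 (commonDivisor? f g h) ℤ.* μ h

          f≉0 = degree⇒≉0 df

          degree-∣ : ∀ {m h f} → HasDegree m f → h ∣ f → ∃[ d ] HasDegree d h × d ≤ᵗ m
          degree-∣ df (u , uh≈f) with a , b , _ , dh , ≡.refl ← factorDegrees df uh≈f =
            b , dh , ≡.subst (b ≤ᵗ_) (+ᵗ-comm b a) (≤ᵗ-+ˡ b a)

          commonDivisor-degree : ∀ {h} → h ∣ f → h ∣ g → ∃[ d ] d ∈ commonDegrees m n × HasDegree d h
          commonDivisor-degree h∣f h∣g with degree-∣ df h∣f | degree-∣ dg h∣g
          ... | d , dh , d≤m | d′ , dh′ , d′≤n with ≡.refl ← degree-unique dh dh′ =
            d , ∈ₚ.∈-filter⁺ (_≤ᵗ? n) (∈-box⁺ d≤m) d′≤n , dh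

          candidate-≉0 : ∀ {h} → h ∈ T → ¬ h ≈ 0#
          candidate-≉0 h∈ with _ , _ , dh ← All.lookup (sound T-reps) h∈ = degree⇒≉0 dh

          δ-0 : ∀ {h} → ¬ (h ∣ f × h ∣ g) → δ h ≡ 0ℤ
          δ-0 {h} ¬both = ≡.cong (ℤ._* μ h) (𝟙-no (commonDivisor? f g h) ¬both)

          δ-μ : ∀ {h} → h ∣ f → h ∣ g → δ h ≡ μ h
          δ-μ {h} h∣f h∣g = ≡.trans (≡.cong (ℤ._* μ h) (𝟙-yes (commonDivisor? f g h) (h∣f , h∣g))) (ℤₚ.*-identityˡ (μ h))

        coprime⇒sum≡1 : Coprime f g → sumℤ T δ ≡ 1ℤ
        coprime⇒sum≡1 coprime = ≡.trans (sum-cong T δ≡)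
          (sum-unique (_~? 1#) (distinct T-reps) (λ _ _ x~1 y~1 → ~-trans x~1 (~-sym y~1))
            (Any.map ~-sym (complete T-reps (commonDivisor-degree (1∣ f) (1∣ g)))))
          where
          1∣ : ∀ x → 1# ∣ x
          1∣ x = x , *-identityʳ x
          δ≡ : ∀ h → δ h ≡ 𝟙 (h ~? 1#)
          δ≡ h with h ~? 1#
          ... | yes h~1 = ≡.trans (δ-μ (∣-~ˡ h~1 (1∣ f)) (∣-~ˡ h~1 (1∣ g))) (μ-1 h~1)
          ... | no  h≁1 = δ-0 (λ (h∣f , h∣g) → h≁1 (∣1⇒~1 (coprime h∣f h∣g)))

        -- Multiplication by p matches the h with p ∤ h against the h with p ∣ h and p² ∤ h,
        -- and changes the sign of μ.
        common⇒sum≡0 : ∀ {p} → Irreducible p → p ∣ f → p ∣ g → sumℤ T δ ≡ 0ℤ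
        common⇒sum≡0 {p} irr p∣f p∣g = begin
          sumℤ T δ
            ≡⟨ sum-cong T split ⟩
          sumℤ T (λ h → 𝟙 (p ∣? h) ℤ.* δ h ℤ.+ 𝟙 (¬? (p ∣? h)) ℤ.* δ h)
            ≡⟨ sum-+ T (λ h → 𝟙 (p ∣? h) ℤ.* δ h) (λ h → 𝟙 (¬? (p ∣? h)) ℤ.* δ h) ⟩
          sumℤ T (λ h → 𝟙 (p ∣? h) ℤ.* δ h) ℤ.+ S
            ≡⟨ ≡.cong (ℤ._+ S) multiples ⟩
          ℤ.- S ℤ.+ S
            ≡⟨ ℤₚ.+-inverseˡ S ⟩
          0ℤ ∎
          where
          open ≡-Reasoning
          S = sumℤ T (λ h → 𝟙 (¬? (p ∣? h)) ℤ.* δ h)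
          p≉0 = irreducible-≉0 irr

          split : ∀ h → δ h ≡ 𝟙 (p ∣? h) ℤ.* δ h ℤ.+ 𝟙 (¬? (p ∣? h)) ℤ.* δ h
          split h = ≡.trans (≡.sym (ℤₚ.*-identityˡ (δ h)))
            (≡.trans (≡.cong (ℤ._* δ h) (≡.sym (𝟙+𝟙¬ (p ∣? h)))) (ℤₚ.*-distribʳ-+ (δ h) (𝟙 (p ∣? h)) (𝟙 (¬? (p ∣? h)))))

          -- For a common divisor `h` divisible by `p`, exactly one `h′` in `T` satisfies
          -- `h ~ p * h′`: the quotient is a common divisor too, hence represented in `T`.
          quotients : ∀ h → 𝟙 (p ∣? h) ℤ.* δ h ≡ sumℤ T (λ h′ → 𝟙 (h ~? p * h′) ℤ.* δ h)
          quotients h with commonDivisor? f g h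
          ... | no _ = ≡.trans (ℤₚ.*-zeroʳ (𝟙 (p ∣? h))) (≡.sym (sum-zero-∈ T (λ {h′} _ → ℤₚ.*-zeroʳ (𝟙 (h ~? p * h′)))))
          ... | yes (h∣f , h∣g) = ≡.trans (≡.cong (ℤ._* (1ℤ ℤ.* μ h)) (≡.sym count)) (≡.sym (sum-*ʳ T (1ℤ ℤ.* μ h) (λ h′ → 𝟙 (h ~? p * h′))))
            where
            h≉0 : ¬ h ≈ 0#
            h≉0 with _ , _ , dh ← commonDivisor-degree h∣f h∣g = degree⇒≉0 dh
            count : sumℤ T (λ h′ → 𝟙 (h ~? p * h′)) ≡ 𝟙 (p ∣? h)
            count with p ∣? h
            ... | no  p∤h = sum-none (λ h′ → h ~? p * h′) T (λ {h′} _ h~ph′ → p∤h (∣-~ʳ (~-sym h~ph′) (x∣xy p h′)))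
            ... | yes (u , up≈h) = sum-unique (λ h′ → h ~? p * h′) (distinct T-reps)
              (λ x∈ y∈ h~px h~py → *-cancelˡ-~ p≉0 (candidate-≉0 x∈) (candidate-≉0 y∈) (~-trans (~-sym h~px) h~py))
              (Any.map (λ u~h′ → ~-trans (≈⇒~ h≈pu) (*-congˡ-~ p≉0 (≉0-~ (~-sym u~h′) (≈*⇒≉0ʳ h≉0 h≈pu)) u~h′))
                (complete T-reps (commonDivisor-degree (∣-trans u∣h h∣f) (∣-trans u∣h h∣g))))
              where
              h≈pu : h ≈ p * u
              h≈pu = trans (sym up≈h) (*-comm u p)
              u∣h : u ∣ h
              u∣h = p , sym h≈pu

          p*-∣ : ∀ {h f} → p ∣ f → ¬ p ∣ h → h ∣ f → p * h ∣ f
          p*-∣ {h} p∣f p∤h (u , uh≈f) with splits irr (∣-respʳ (sym uh≈f) p∣f)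
          ... | inj₂ p∣h = contradiction p∣h p∤h
          ... | inj₁ p∣u = ∣-respʳ (trans (*-comm h u) uh≈f) (∣-respˡ (*-comm h p) (*-mono-∣ h p∣u))

          -- Only the class of `p * h′` can contribute. If `p * h′` is not a common divisor, both
          -- sides vanish: when `p` does not divide `h′`, a common divisor `h′` would make `p * h′`
          -- one by `p*-∣`.
          negated : ∀ {h′} → h′ ∈ T →
            sumℤ T (λ h → 𝟙 (h ~? p * h′) ℤ.* δ h) ≡ ℤ.- (𝟙 (¬? (p ∣? h′)) ℤ.* δ h′)
          negated {h′} h′∈ with commonDivisor? f g (p * h′)
          ... | no ¬both = ≡.trans (sum-zero-∈ T (λ {h} _ → vanish h)) (≡.cong ℤ.-_ (≡.sym vanish′))
            where
            vanish : ∀ h → 𝟙 (h ~? p * h′) ℤ.* δ h ≡ 0ℤ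
            vanish h with h ~? p * h′
            ... | no _     = ≡.refl
            ... | yes h~ph′ = ≡.trans (ℤₚ.*-identityˡ (δ h))
              (δ-0 (λ (h∣f , h∣g) → ¬both (∣-~ˡ (~-sym h~ph′) h∣f , ∣-~ˡ (~-sym h~ph′) h∣g)))
            vanish′ : 𝟙 (¬? (p ∣? h′)) ℤ.* δ h′ ≡ 0ℤ
            vanish′ with p ∣? h′
            ... | yes _   = ≡.refl
            ... | no p∤h′ = ≡.trans (ℤₚ.*-identityˡ (δ h′))
              (δ-0 (λ (h′∣f , h′∣g) → ¬both (p*-∣ p∣f p∤h′ h′∣f , p*-∣ p∣g p∤h′ h′∣g)))
          ... | yes (ph′∣f , ph′∣g) = begin
            sumℤ T (λ h → 𝟙 (h ~? p * h′) ℤ.* δ h)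
              ≡⟨ sum-at T-reps (commonDivisor-degree ph′∣f ph′∣g) δ δ-~ ⟩
            δ (p * h′)
              ≡⟨ δ-μ ph′∣f ph′∣g ⟩
            μ (p * h′)
              ≡⟨ sign ⟩
            ℤ.- (𝟙 (¬? (p ∣? h′)) ℤ.* δ h′) ∎
            where
            h′≉0 = candidate-≉0 h′∈
            δ-~ : ∀ {h} → h ~ p * h′ → δ h ≡ δ (p * h′)
            δ-~ {h} h~ = ≡.cong₂ ℤ._*_
              (𝟙-cong (commonDivisor? f g h) (commonDivisor? f g (p * h′))
                (λ (a , b) → ∣-~ˡ (~-sym h~) a , ∣-~ˡ (~-sym h~) b) (λ (a , b) → ∣-~ˡ h~ a , ∣-~ˡ h~ b))
              (μ-~ (*-≉0 p≉0 h′≉0) h~)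
            h′∣ph′ = x∣ʳyx h′ p
            sign : μ (p * h′) ≡ ℤ.- (𝟙 (¬? (p ∣? h′)) ℤ.* δ h′)
            sign with p ∣? h′
            ... | yes p∣h′ = μ-∣ irr h′≉0 p∣h′
            ... | no  p∤h′ = ≡.trans (μ-∤ irr h′≉0 p∤h′) (≡.cong ℤ.-_
              (≡.sym (≡.trans (ℤₚ.*-identityˡ (δ h′)) (δ-μ (∣-trans h′∣ph′ ph′∣f) (∣-trans h′∣ph′ ph′∣g)))))

          multiples : sumℤ T (λ h → 𝟙 (p ∣? h) ℤ.* δ h) ≡ ℤ.- S
          multiples = begin
            sumℤ T (λ h → 𝟙 (p ∣? h) ℤ.* δ h)
              ≡⟨ sum-cong T quotients ⟩
            sumℤ T (λ h → sumℤ T (λ h′ → 𝟙 (h ~? p * h′) ℤ.* δ h))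
              ≡⟨ sum-swap T T (λ h h′ → 𝟙 (h ~? p * h′) ℤ.* δ h) ⟩
            sumℤ T (λ h′ → sumℤ T (λ h → 𝟙 (h ~? p * h′) ℤ.* δ h))
              ≡⟨ sum-cong-∈ T negated ⟩
            sumℤ T (λ h′ → ℤ.- (𝟙 (¬? (p ∣? h′)) ℤ.* δ h′))
              ≡⟨ sum-neg T (λ h′ → 𝟙 (¬? (p ∣? h′)) ℤ.* δ h′) ⟩
            ℤ.- S ∎

      _~²_ : Carrier × Carrier → Carrier × Carrier → Set
      (f , g) ~² (f′ , g′) = f ~ f′ × g ~ g′

      -- The entries of `cs` need not occur in `E m` and `E n`. Matching them up to `~` turns the
      -- length of `cs` into a sum, over all pairs from these lists, of the indicator of
      -- coprimality. For fixed `h` the resulting double sum factors into two counts of multiples.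
      coprimePairs-formula : ∀ m n {cs} →
        Representatives _~²_ (λ (f , g) → HasDegree m f × HasDegree n g × Coprime f g) cs →
        + length cs ≡ sumℤ (commonDegrees m n) (λ d →
          + length (E (m ∸ᵗ d)) ℤ.* + length (E (n ∸ᵗ d)) ℤ.* sumℤ (E d) μ)
      coprimePairs-formula m n {cs} cs-reps = begin
        + length cs
          ≡⟨ sum-1 cs ⟨
        sumℤ cs (λ _ → 1ℤ)
          ≡⟨ sum-cong-∈ cs (λ {c} c∈ → pairs c (All.lookup (sound cs-reps) c∈)) ⟨
        sumℤ cs (λ c → sumℤ (E m) (λ f → sumℤ (E n) (λ g → 𝟙 (f ≟c c ∣ g))))
          ≡⟨ sum-swap cs (E m) (λ c f → sumℤ (E n) (λ g → 𝟙 (f ≟c c ∣ g))) ⟩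
        sumℤ (E m) (λ f → sumℤ cs (λ c → sumℤ (E n) (λ g → 𝟙 (f ≟c c ∣ g))))
          ≡⟨ sum-cong-∈ (E m) (λ {f} f∈ → ≡.trans
               (sum-swap cs (E n) (λ c g → 𝟙 (f ≟c c ∣ g)))
               (sum-cong-∈ (E n) (λ {g} g∈ → indicator (All.lookup (sound (reps m)) f∈) (All.lookup (sound (reps n)) g∈)))) ⟩
        sumℤ (E m) (λ f → sumℤ (E n) (λ g → sumℤ T (λ h → 𝟙 (commonDivisor? f g h) ℤ.* μ h)))
          ≡⟨ sum-cong (E m) (λ f → sum-swap (E n) T (λ g h → 𝟙 (commonDivisor? f g h) ℤ.* μ h)) ⟩
        sumℤ (E m) (λ f → sumℤ T (λ h → sumℤ (E n) (λ g → 𝟙 (commonDivisor? f g h) ℤ.* μ h)))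
          ≡⟨ sum-swap (E m) T (λ f h → sumℤ (E n) (λ g → 𝟙 (commonDivisor? f g h) ℤ.* μ h)) ⟩
        sumℤ T (λ h → sumℤ (E m) (λ f → sumℤ (E n) (λ g → 𝟙 (commonDivisor? f g h) ℤ.* μ h)))
          ≡⟨ sum-cong T factor ⟩
        sumℤ T (λ h → sumℤ (E m) (λ f → 𝟙 (h ∣? f)) ℤ.* sumℤ (E n) (λ g → 𝟙 (h ∣? g)) ℤ.* μ h)
          ≡⟨ sum-concatMap E D (λ h → sumℤ (E m) (λ f → 𝟙 (h ∣? f)) ℤ.* sumℤ (E n) (λ g → 𝟙 (h ∣? g)) ℤ.* μ h) ⟩
        sumℤ D (λ d → sumℤ (E d) (λ h → sumℤ (E m) (λ f → 𝟙 (h ∣? f)) ℤ.* sumℤ (E n) (λ g → 𝟙 (h ∣? g)) ℤ.* μ h))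
          ≡⟨ sum-cong-∈ D (λ {d} d∈ → ≡.trans
               (sum-cong-∈ (E d) (λ {h} h∈ → ≡.cong (ℤ._* μ h) (≡.cong₂ ℤ._*_
                 (count-multiples (All.lookup (sound (reps d)) h∈) (proj₁ (commonDegrees⁻ {m} d∈)))
                 (count-multiples (All.lookup (sound (reps d)) h∈) (proj₂ (commonDegrees⁻ {m} d∈))))))
               (sum-*ˡ (E d) (+ length (E (m ∸ᵗ d)) ℤ.* + length (E (n ∸ᵗ d))) μ)) ⟩
        sumℤ D (λ d → + length (E (m ∸ᵗ d)) ℤ.* + length (E (n ∸ᵗ d)) ℤ.* sumℤ (E d) μ) ∎
        where
        open ≡-Reasoning
        D = commonDegrees m n
        T = candidates m n

        _≟c_∣_ : ∀ f c g → Dec (f ~ proj₁ c × g ~ proj₂ c)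
        f ≟c c ∣ g = (f ~? proj₁ c) ×-dec (g ~? proj₂ c)

        once : ∀ {m c} → HasDegree m c → sumℤ (E m) (λ f → 𝟙 (f ~? c)) ≡ 1ℤ
        once {m} {c} dc = sum-unique (_~? c) (distinct (reps m))
          (λ _ _ x~c y~c → ~-trans x~c (~-sym y~c)) (Any.map ~-sym (complete (reps m) dc))

        pairs : ∀ c → HasDegree m (proj₁ c) × HasDegree n (proj₂ c) × Coprime (proj₁ c) (proj₂ c) →
          sumℤ (E m) (λ f → sumℤ (E n) (λ g → 𝟙 (f ≟c c ∣ g))) ≡ 1ℤ
        pairs (c , c′) (dc , dc′ , _) = begin
          sumℤ (E m) (λ f → sumℤ (E n) (λ g → 𝟙 ((f ~? c) ×-dec (g ~? c′))))
            ≡⟨ sum-cong (E m) (λ f → ≡.trans (sum-cong (E n) (λ g → 𝟙-× (f ~? c) (g ~? c′)))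
                 (≡.trans (sum-*ˡ (E n) (𝟙 (f ~? c)) (λ g → 𝟙 (g ~? c′)))
                 (≡.trans (≡.cong (ℤ._*_ (𝟙 (f ~? c))) (once dc′)) (ℤₚ.*-identityʳ (𝟙 (f ~? c)))))) ⟩
          sumℤ (E m) (λ f → 𝟙 (f ~? c))
            ≡⟨ once dc ⟩
          1ℤ ∎

        indicator : ∀ {f g} → HasDegree m f → HasDegree n g →
          sumℤ cs (λ c → 𝟙 (f ≟c c ∣ g)) ≡ sumℤ T (λ h → 𝟙 (commonDivisor? f g h) ℤ.* μ h)
        indicator {f} {g} df dg with coprime⊎common {f} {g} (degree⇒≉0 df)
        ... | inj₁ coprime = ≡.trans
          (sum-unique (λ c → f ≟c c ∣ g) (distinct cs-reps)
            (λ _ _ (f~c , g~c) (f~c′ , g~c′) → ~-trans (~-sym f~c) f~c′ , ~-trans (~-sym g~c) g~c′)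
            (complete cs-reps (df , dg , coprime)))
          (≡.sym (coprime⇒sum≡1 df dg coprime))
        ... | inj₂ (p , irr , p∣f , p∣g) = ≡.trans
          (sum-none (λ c → f ≟c c ∣ g) cs (λ c∈ (f~c , g~c) → Irreducible.p∤1 irr
            (proj₂ (proj₂ (All.lookup (sound cs-reps) c∈)) (∣-~ʳ f~c p∣f) (∣-~ʳ g~c p∣g))))
          (≡.sym (common⇒sum≡0 df dg irr p∣f p∣g))

        factor : ∀ h → sumℤ (E m) (λ f → sumℤ (E n) (λ g → 𝟙 (commonDivisor? f g h) ℤ.* μ h)) ≡
                       sumℤ (E m) (λ f → 𝟙 (h ∣? f)) ℤ.* sumℤ (E n) (λ g → 𝟙 (h ∣? g)) ℤ.* μ h
        factor h = begin
          sumℤ (E m) (λ f → sumℤ (E n) (λ g → 𝟙 (commonDivisor? f g h) ℤ.* μ h))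
            ≡⟨ sum-cong (E m) (λ f → ≡.trans (sum-*ʳ (E n) (μ h) (λ g → 𝟙 (commonDivisor? f g h)))
                 (≡.cong (ℤ._* μ h) (≡.trans (sum-cong (E n) (λ g → 𝟙-× (h ∣? f) (h ∣? g)))
                   (sum-*ˡ (E n) (𝟙 (h ∣? f)) (λ g → 𝟙 (h ∣? g)))))) ⟩
          sumℤ (E m) (λ f → 𝟙 (h ∣? f) ℤ.* sumℤ (E n) (λ g → 𝟙 (h ∣? g)) ℤ.* μ h)
            ≡⟨ sum-*ʳ (E m) (μ h) (λ f → 𝟙 (h ∣? f) ℤ.* sumℤ (E n) (λ g → 𝟙 (h ∣? g))) ⟩
          sumℤ (E m) (λ f → 𝟙 (h ∣? f) ℤ.* sumℤ (E n) (λ g → 𝟙 (h ∣? g))) ℤ.* μ h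
            ≡⟨ ≡.cong (ℤ._* μ h) (sum-*ʳ (E m) (sumℤ (E n) (λ g → 𝟙 (h ∣? g))) (λ f → 𝟙 (h ∣? f))) ⟩
          sumℤ (E m) (λ f → 𝟙 (h ∣? f)) ℤ.* sumℤ (E n) (λ g → 𝟙 (h ∣? g)) ℤ.* μ h ∎

-- Sublists and binomial sums

sublists : ∀ {X : Set} → List X → List (List X)
sublists []       = [] ∷ []
sublists (x ∷ xs) = sublists xs ++ List.map (x ∷_) (sublists xs)

module _ {X : Set} where

  sum-sublists-∷ : ∀ (x : X) xs (w : List X → ℤ) →
    sumℤ (sublists (x ∷ xs)) w ≡ sumℤ (sublists xs) w ℤ.+ sumℤ (sublists xs) (w ∘ (x ∷_))
  sum-sublists-∷ x xs w = ≡.trans (sum-++ (sublists xs) (List.map (x ∷_) (sublists xs)) w)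
    (≡.cong (ℤ._+_ (sumℤ (sublists xs) w)) (sum-map (x ∷_) (sublists xs) w))

  sublists-All : ∀ {P : X → Set} {xs} → All P xs → ∀ {s} → s ∈ sublists xs → All P s
  sublists-All []        (here ≡.refl) = []
  sublists-All {xs = x ∷ xs} (px ∷ pxs) s∈ with ∈ₚ.∈-++⁻ (sublists xs) s∈
  ... | inj₁ s∈xs = sublists-All pxs s∈xs
  ... | inj₂ s∈map with t , t∈ , ≡.refl ← ∈ₚ.∈-map⁻ (x ∷_) s∈map = px ∷ sublists-All pxs t∈

sum-upTo-suc : ∀ n (f : ℕ → ℤ) → sumℤ (upTo (suc n)) f ≡ f 0 ℤ.+ sumℤ (upTo n) (f ∘ suc)
sum-upTo-suc n f = ≡.cong (ℤ._+_ (f 0)) (≡.trans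
  (≡.cong (λ is → sumℤ is f) (≡.sym (Listₚ.map-upTo suc n))) (sum-map suc (upTo n) f))

sum-upTo-last : ∀ n (f : ℕ → ℤ) → sumℤ (upTo (suc n)) f ≡ sumℤ (upTo n) f ℤ.+ f n
sum-upTo-last zero    f = ℤₚ.+-comm (f 0) 0ℤ
sum-upTo-last (suc n) f = begin
  sumℤ (upTo (suc (suc n))) f                        ≡⟨ sum-upTo-suc (suc n) f ⟩
  f 0 ℤ.+ sumℤ (upTo (suc n)) (f ∘ suc)              ≡⟨ ≡.cong (ℤ._+_ (f 0)) (sum-upTo-last n (f ∘ suc)) ⟩
  f 0 ℤ.+ (sumℤ (upTo n) (f ∘ suc) ℤ.+ f (suc n))    ≡⟨ ℤₚ.+-assoc (f 0) _ _ ⟨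
  f 0 ℤ.+ sumℤ (upTo n) (f ∘ suc) ℤ.+ f (suc n)      ≡⟨ ≡.cong (ℤ._+ f (suc n)) (sum-upTo-suc n f) ⟨
  sumℤ (upTo (suc n)) f ℤ.+ f (suc n)                ∎
  where open ≡-Reasoning

-- Pascal's rule splits every term except that for `a = 0`. The shifted sum then stops one index
-- early; the hypothesis on `G (suc M)` makes the missing term zero.
sum-pascal : ∀ b M (G : ℕ → ℤ) → G (suc M) ≡ 0ℤ →
  sumℤ (upTo (suc M)) (λ a → + (suc b C a) ℤ.* G a) ≡
  sumℤ (upTo (suc M)) (λ a → + (b C a) ℤ.* G a) ℤ.+ sumℤ (upTo (suc M)) (λ a → + (b C a) ℤ.* G (suc a))
sum-pascal b M G GM≡0 = begin
  sumℤ (upTo (suc M)) (λ a → + (suc b C a) ℤ.* G a)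
    ≡⟨ sum-upTo-suc M (λ a → + (suc b C a) ℤ.* G a) ⟩
  + (suc b C 0) ℤ.* G 0 ℤ.+ sumℤ (upTo M) (λ a → + (suc b C suc a) ℤ.* G (suc a))
    ≡⟨ ≡.cong (ℤ._+_ (+ 1 ℤ.* G 0)) (≡.trans (sum-cong (upTo M) pascal) (sum-+ (upTo M) g h)) ⟩
  + (b C 0) ℤ.* G 0 ℤ.+ (sumℤ (upTo M) g ℤ.+ sumℤ (upTo M) h)
    ≡⟨ ℤₚ.+-assoc (+ (b C 0) ℤ.* G 0) (sumℤ (upTo M) g) (sumℤ (upTo M) h) ⟨
  + (b C 0) ℤ.* G 0 ℤ.+ sumℤ (upTo M) g ℤ.+ sumℤ (upTo M) h
    ≡⟨ ≡.cong₂ ℤ._+_ (≡.sym (sum-upTo-suc M (λ a → + (b C a) ℤ.* G a))) (≡.sym last) ⟩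
  sumℤ (upTo (suc M)) (λ a → + (b C a) ℤ.* G a) ℤ.+ sumℤ (upTo (suc M)) h ∎
  where
  open ≡-Reasoning
  g h : ℕ → ℤ
  g a = + (b C suc a) ℤ.* G (suc a)
  h a = + (b C a) ℤ.* G (suc a)
  pascal : ∀ a → + (suc b C suc a) ℤ.* G (suc a) ≡ g a ℤ.+ h a
  pascal a = ≡.trans (≡.cong (λ n → + n ℤ.* G (suc a))
      (≡.trans (≡.sym (nCk+nC[k+1]≡[n+1]C[k+1] b a)) (ℕₚ.+-comm (b C a) (b C suc a))))
    (ℤₚ.*-distribʳ-+ (G (suc a)) (+ (b C suc a)) (+ (b C a)))
  last : sumℤ (upTo (suc M)) h ≡ sumℤ (upTo M) h
  last = ≡.trans (sum-upTo-last M h) (≡.trans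
    (≡.cong (ℤ._+_ (sumℤ (upTo M) h)) (≡.trans (≡.cong (ℤ._*_ (+ (b C M))) GM≡0) (ℤₚ.*-zeroʳ (+ (b C M)))))
    (ℤₚ.+-identityʳ _))

+ᵗ-assoc : ∀ {k} (a b c : Tuple k) → (a +ᵗ b) +ᵗ c ≡ a +ᵗ (b +ᵗ c)
+ᵗ-assoc = Vecₚ.zipWith-assoc ℕₚ.+-assoc

+ᵗ-left-comm : ∀ {k} (a b c : Tuple k) → a +ᵗ (b +ᵗ c) ≡ b +ᵗ (a +ᵗ c)
+ᵗ-left-comm a b c = ≡.trans (≡.sym (+ᵗ-assoc a b c)) (≡.trans (≡.cong (_+ᵗ c) (+ᵗ-comm a b)) (+ᵗ-assoc b a c))

+ᵗ-identityˡ : ∀ {k} (a : Tuple k) → 𝟘 +ᵗ a ≡ a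
+ᵗ-identityˡ = Vecₚ.zipWith-identityˡ ℕₚ.+-identityˡ

0·ᵗ : ∀ {k} (i : Tuple k) → 0 ·ᵗ i ≡ 𝟘
0·ᵗ []      = ≡.refl
0·ᵗ (_ ∷ i) = ≡.cong (0 ∷_) (0·ᵗ i)

suc·ᵗ : ∀ {k} a (i : Tuple k) → suc a ·ᵗ i ≡ i +ᵗ a ·ᵗ i
suc·ᵗ a []      = ≡.refl
suc·ᵗ a (x ∷ i) = ≡.cong (x ℕ.+ a ℕ.* x ∷_) (suc·ᵗ a i)

-- Some entry of `i` is at least one, and the corresponding entry of `a ·ᵗ i` is at least `a`. This
-- is why families with entries up to `Vec.sum d` suffice.
a≤sumℤ[a·i+t] : ∀ {k} a {i : Tuple k} t → i ≢ 𝟘 → a ℕ.≤ Vec.sum (a ·ᵗ i +ᵗ t)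
a≤sumℤ[a·i+t] a {[]}        []      i≢𝟘 = contradiction ≡.refl i≢𝟘
a≤sumℤ[a·i+t] a {zero  ∷ i} (t ∷ ts) i≢𝟘 = ℕₚ.m≤n⇒m≤o+n (a ℕ.* 0 ℕ.+ t) (a≤sumℤ[a·i+t] a ts (i≢𝟘 ∘ ≡.cong (0 ∷_)))
a≤sumℤ[a·i+t] a {suc x ∷ i} (t ∷ ts) i≢𝟘 =
  ℕₚ.m≤n⇒m≤n+o _ (ℕₚ.m≤n⇒m≤n+o t (ℕₚ.m≤m*n a (suc x)))

-- The sum of the Möbius function over one degree

module MöbiusSum {k : ℕ} (U : GradedUFD k) where
  open UniqueFactorization U

  totalDegree : List (Tuple k × Carrier) → Tuple k
  totalDegree = List.foldr (λ (i , _) t → i +ᵗ t) 𝟘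

  -- M bounds the number of elements of one degree.  In the application w t c = [t = d] (−1)^c,
  -- which is Vanishing for M = d₁ + ⋯ + dₖ.
  module _ (M : ℕ) where

    Vanishing : (Tuple k → ℕ → ℤ) → Set
    Vanishing w = ∀ {i} → i ≢ 𝟘 → ∀ {a} → M ℕ.< a → ∀ t c → w (a ·ᵗ i +ᵗ t) c ≡ 0ℤ

    shift-Vanishing : ∀ w → Vanishing w → ∀ s b → Vanishing (λ t c → w (s +ᵗ t) (b ℕ.+ c))
    shift-Vanishing w vanishing s b {i} i≢𝟘 {a} M<a t c =
      ≡.trans (≡.cong (λ t → w t (b ℕ.+ c)) (+ᵗ-left-comm s (a ·ᵗ i) t)) (vanishing i≢𝟘 M<a (s +ᵗ t) (b ℕ.+ c))

    -- Elements of a block affect the weight only through their number. By induction on the block,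
    -- its first element is left out or taken, and the two sums combine by Pascal's rule. Cutting
    -- off at `M` is harmless because larger numbers have weight zero.
    sum-block : ∀ {i} → i ≢ 𝟘 → ∀ block rest → All (λ x → proj₁ x ≡ i) block → ∀ w → Vanishing w →
      sumℤ (sublists (block ++ rest)) (λ s → w (totalDegree s) (length s)) ≡
      sumℤ (upTo (suc M)) (λ a → + (length block C a) ℤ.*
        sumℤ (sublists rest) (λ s → w (a ·ᵗ i +ᵗ totalDegree s) (a ℕ.+ length s)))
    sum-block {i} i≢𝟘 [] rest [] w vanishing = begin
      sumℤ (sublists rest) (λ s → w (totalDegree s) (length s))
        ≡⟨ sum-cong (sublists rest) (λ s → ≡.cong (λ t → w t (length s))
             (≡.sym (≡.trans (≡.cong (_+ᵗ totalDegree s) (0·ᵗ i)) (+ᵗ-identityˡ (totalDegree s))))) ⟩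
      G 0
        ≡⟨ ≡.trans (≡.sym (ℤₚ.+-identityʳ (G 0))) (≡.cong₂ ℤ._+_ (≡.sym (ℤₚ.*-identityˡ (G 0)))
             (≡.sym (sum-zero-∈ (upTo M) (λ _ → ≡.refl)))) ⟩
      + 1 ℤ.* G 0 ℤ.+ sumℤ (upTo M) (λ a → + (0 C suc a) ℤ.* G (suc a))
        ≡⟨ sum-upTo-suc M (λ a → + (0 C a) ℤ.* G a) ⟨
      sumℤ (upTo (suc M)) (λ a → + (0 C a) ℤ.* G a) ∎
      where
      open ≡-Reasoning
      G : ℕ → ℤ
      G a = sumℤ (sublists rest) (λ s → w (a ·ᵗ i +ᵗ totalDegree s) (a ℕ.+ length s))
    sum-block {i} i≢𝟘 ((.i , x) ∷ block) rest (≡.refl ∷ degrees) w vanishing = begin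
      sumℤ (sublists ((i , x) ∷ block ++ rest)) (λ s → w (totalDegree s) (length s))
        ≡⟨ sum-sublists-∷ (i , x) (block ++ rest) (λ s → w (totalDegree s) (length s)) ⟩
      sumℤ (sublists (block ++ rest)) (λ s → w (totalDegree s) (length s)) ℤ.+
      sumℤ (sublists (block ++ rest)) (λ s → w (i +ᵗ totalDegree s) (suc (length s)))
        ≡⟨ ≡.cong₂ ℤ._+_ (sum-block i≢𝟘 block rest degrees w vanishing)
             (≡.trans (sum-block i≢𝟘 block rest degrees (λ t c → w (i +ᵗ t) (suc c)) (shift-Vanishing w vanishing i 1))
                      (sum-cong (upTo (suc M)) (λ a → ≡.cong (ℤ._*_ (+ (length block C a))) (G-suc a)))) ⟩
      sumℤ (upTo (suc M)) (λ a → + (length block C a) ℤ.* G a) ℤ.+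
      sumℤ (upTo (suc M)) (λ a → + (length block C a) ℤ.* G (suc a))
        ≡⟨ sum-pascal (length block) M G
             (sum-zero-∈ (sublists rest) (λ {s} _ → vanishing i≢𝟘 (ℕₚ.n<1+n M) (totalDegree s) (suc M ℕ.+ length s))) ⟨
      sumℤ (upTo (suc M)) (λ a → + (suc (length block) C a) ℤ.* G a) ∎
      where
      open ≡-Reasoning
      G : ℕ → ℤ
      G a = sumℤ (sublists rest) (λ s → w (a ·ᵗ i +ᵗ totalDegree s) (a ℕ.+ length s))
      G-suc : ∀ a → sumℤ (sublists rest) (λ s → w (i +ᵗ (a ·ᵗ i +ᵗ totalDegree s)) (suc (a ℕ.+ length s))) ≡ G (suc a)
      G-suc a = sum-cong (sublists rest) (λ s → ≡.cong (λ t → w t (suc (a ℕ.+ length s)))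
        (≡.trans (≡.sym (+ᵗ-assoc i (a ·ᵗ i) (totalDegree s))) (≡.cong (_+ᵗ totalDegree s) (≡.sym (suc·ᵗ a i)))))

    -- The weight `w` is arbitrary so that the choices made in the first block can be absorbed into
    -- it before the induction hypothesis is applied to the others.
    sum-blocks : ∀ (B : Tuple k → List (Tuple k × Carrier)) → (∀ i → All (λ x → proj₁ x ≡ i) (B i)) →
      ∀ (I : Tuple k → ℕ) → (∀ i → length (B i) ≡ I i) →
      ∀ is → All (_≢ 𝟘) is → ∀ w → Vanishing w →
      sumℤ (sublists (concatMap B is)) (λ s → w (totalDegree s) (length s)) ≡
      sumℤ (box (replicate (length is) M)) (λ a →
        w (Vec.foldr _ _+ᵗ_ 𝟘 (zipWith _·ᵗ_ a (fromList is))) (Vec.sum a) ℤ.*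
        + Vec.foldr _ ℕ._*_ 1 (zipWith (λ aᵢ i → I i C aᵢ) a (fromList is)))
    sum-blocks B degrees I lengths []       []            w vanishing = ≡.cong (ℤ._+ 0ℤ) (≡.sym (ℤₚ.*-identityʳ (w 𝟘 0)))
    sum-blocks B degrees I lengths (i ∷ is) (i≢𝟘 ∷ is≢𝟘) w vanishing = begin
      sumℤ (sublists (B i ++ concatMap B is)) (λ s → w (totalDegree s) (length s))
        ≡⟨ ≡.trans (sum-block i≢𝟘 (B i) (concatMap B is) (degrees i) w vanishing)
             (≡.cong (λ l → sumℤ (upTo (suc M)) (λ a → + (l C a) ℤ.*
               sumℤ (sublists (concatMap B is)) (λ s → w (a ·ᵗ i +ᵗ totalDegree s) (a ℕ.+ length s)))) (lengths i)) ⟩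
      sumℤ (upTo (suc M)) (λ a → + (I i C a) ℤ.*
        sumℤ (sublists (concatMap B is)) (λ s → w (a ·ᵗ i +ᵗ totalDegree s) (a ℕ.+ length s)))
        ≡⟨ sum-cong (upTo (suc M)) (λ a → ≡.cong (ℤ._*_ (+ (I i C a)))
             (sum-blocks B degrees I lengths is is≢𝟘 (λ t c → w (a ·ᵗ i +ᵗ t) (a ℕ.+ c)) (shift-Vanishing w vanishing (a ·ᵗ i) a))) ⟩
      sumℤ (upTo (suc M)) (λ a → + (I i C a) ℤ.* sumℤ as (λ a′ →
        w (a ·ᵗ i +ᵗ weights a′) (a ℕ.+ Vec.sum a′) ℤ.* + binomials a′))
        ≡⟨ sum-cong (upTo (suc M)) (λ a → ≡.trans
             (≡.sym (sum-*ˡ as (+ (I i C a)) (λ a′ → w (a ·ᵗ i +ᵗ weights a′) (a ℕ.+ Vec.sum a′) ℤ.* + binomials a′)))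
             (sum-cong as (λ a′ → regroup (I i C a) (w (a ·ᵗ i +ᵗ weights a′) (a ℕ.+ Vec.sum a′)) (binomials a′)))) ⟩
      sumℤ (upTo (suc M)) (λ a → sumℤ as (λ a′ →
        w (a ·ᵗ i +ᵗ weights a′) (a ℕ.+ Vec.sum a′) ℤ.* + ((I i C a) ℕ.* binomials a′)))
        ≡⟨ sum-cartesianProductWith _∷_ (upTo (suc M)) as (λ a →
             w (Vec.foldr _ _+ᵗ_ 𝟘 (zipWith _·ᵗ_ a (fromList (i ∷ is)))) (Vec.sum a) ℤ.*
             + Vec.foldr _ ℕ._*_ 1 (zipWith (λ aᵢ i → I i C aᵢ) a (fromList (i ∷ is)))) ⟨
      sumℤ (box (replicate (suc (length is)) M)) (λ a →
        w (Vec.foldr _ _+ᵗ_ 𝟘 (zipWith _·ᵗ_ a (fromList (i ∷ is)))) (Vec.sum a) ℤ.*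
        + Vec.foldr _ ℕ._*_ 1 (zipWith (λ aᵢ i → I i C aᵢ) a (fromList (i ∷ is)))) ∎
      where
      open ≡-Reasoning
      as = box (replicate (length is) M)
      weights : Vec ℕ (length is) → Tuple k
      weights a = Vec.foldr _ _+ᵗ_ 𝟘 (zipWith _·ᵗ_ a (fromList is))
      binomials : Vec ℕ (length is) → ℕ
      binomials a = Vec.foldr _ ℕ._*_ 1 (zipWith (λ aᵢ i → I i C aᵢ) a (fromList is))
      regroup : ∀ c w b → + c ℤ.* (w ℤ.* + b) ≡ w ℤ.* + (c ℕ.* b)
      regroup c w b = ≡.trans (RingIdentities.*-left-comm ℤₚ.+-*-commutativeRing (+ c) w (+ b))
        (≡.cong (ℤ._*_ w) (≡.sym (ℤₚ.pos-* c b)))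

  module _ {μ : Carrier → ℤ} (isMöbius : IsMöbiusFunction μ) where
    open IsMöbiusFunction isMöbius

    ε : List Carrier → ℤ
    ε s = -1ℤ ℤ.^ length s

    -- Induction on `ps`. If the head `p` does not divide `h`, only sublists without `p` contribute.
    -- If `h ≈ p * h′`, only those with `p` do, and their sum is minus the corresponding sum for
    -- `h′`; this matches the rules `μ-∤` and `μ-∣`.
    sum-sublists-μ : ∀ {ps h} → ¬ h ≈ 0# → All Irreducible ps → Distinct ps →
      (∀ {p} → Irreducible p → p ∣ h → Any (p ~_) ps) →
      sumℤ (sublists ps) (λ s → 𝟙 (h ~? product s) ℤ.* ε s) ≡ μ h
    -- No irreducible divides `h`, so `h` is a unit: a square factor or a nonempty list of factors
    -- would contradict `covers`.
    sum-sublists-μ {[]} {h} h≉0 [] [] covers with squareFree? h≉0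
    ... | inj₂ (p , irr , pp∣h) with () ← covers irr (∣-trans (x∣xy p p) pp∣h)
    ... | inj₁ (p ∷ ps , irr ∷ _ , _ , h~) with () ← covers irr (∣-~ʳ (~-sym h~) (x∣xy p (product ps)))
    ... | inj₁ ([] , _ , _ , h~1) = ≡.trans
      (≡.cong (λ i → i ℤ.* 1ℤ ℤ.+ 0ℤ) (𝟙-yes (h ~? 1#) h~1)) (≡.sym (μ-1 h~1))
    sum-sublists-μ {p ∷ ps} {h} h≉0 irrs@(irr ∷ irrs′) dist@(_ ∷ dist′) covers =
      ≡.trans (sum-sublists-∷ p ps (λ s → 𝟙 (h ~? product s) ℤ.* ε s)) by-cases
      where
      without with-p : ℤ
      without = sumℤ (sublists ps) (λ s → 𝟙 (h ~? product s) ℤ.* ε s)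
      with-p  = sumℤ (sublists ps) (λ s → 𝟙 (h ~? p * product s) ℤ.* ε (p ∷ s))

      p∤sublist : ∀ {s} → s ∈ sublists ps → ¬ p ∣ product s
      p∤sublist {s} s∈ p∣s with r , r∈ , p~r ← find (∣product⇒Any~ irr (sublists-All irrs′ s∈) p∣s) =
        All.lookup (sublists-All (AllPairs.head dist) s∈) r∈ p~r

      covers′ : ∀ {h′} → ¬ p ∣ h′ → (∀ {r} → r ∣ h′ → r ∣ h) → ∀ {r} → Irreducible r → r ∣ h′ → Any (r ~_) ps
      covers′ p∤h′ h′⇒h r-irr r∣h′ with covers r-irr (h′⇒h r∣h′)
      ... | here r~p   = contradiction (∣-~ˡ (~-sym r~p) r∣h′) p∤h′
      ... | there r∈ps = r∈ps

      by-cases : without ℤ.+ with-p ≡ μ h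
      by-cases with p ∣? h
      ... | no p∤h = ≡.trans
        (≡.cong₂ ℤ._+_ (sum-sublists-μ h≉0 irrs′ dist′ (covers′ p∤h (λ r∣h → r∣h)))
          (sum-zero-∈ (sublists ps) (λ {s} _ → ≡.cong (ℤ._* ε (p ∷ s))
            (𝟙-no (h ~? p * product s) (λ h~ → p∤h (∣-~ʳ (~-sym h~) (x∣xy p (product s))))))))
        (ℤₚ.+-identityʳ (μ h))
      ... | yes (h′ , h′p≈h) = ≡.trans
        (≡.cong₂ ℤ._+_
          (sum-zero-∈ (sublists ps) (λ {s} s∈ → ≡.cong (ℤ._* ε s)
            (𝟙-no (h ~? product s) (λ h~ → p∤sublist s∈ (∣-~ʳ h~ (h′ , h′p≈h))))))
          (≡.trans (sum-cong-∈ (sublists ps) divide) (sum-neg (sublists ps) (λ s → 𝟙 (h′ ~? product s) ℤ.* ε s))))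
        (≡.trans (ℤₚ.+-identityˡ _) rest)
        where
        h≈ph′ : h ≈ p * h′
        h≈ph′ = trans (sym h′p≈h) (*-comm h′ p)
        h′≉0 : ¬ h′ ≈ 0#
        h′≉0 = ≈*⇒≉0ʳ h≉0 h≈ph′
        p≉0 = irreducible-≉0 irr

        divide : ∀ {s} → s ∈ sublists ps →
          𝟙 (h ~? p * product s) ℤ.* ε (p ∷ s) ≡ ℤ.- (𝟙 (h′ ~? product s) ℤ.* ε s)
        divide {s} s∈ = ≡.trans
          (≡.cong₂ ℤ._*_ (𝟙-cong (h ~? p * product s) (h′ ~? product s)
              (λ h~ → *-cancelˡ-~ p≉0 h′≉0 s≉0 (~-trans (≈⇒~ (sym h≈ph′)) h~))
              (λ h′~ → ~-trans (≈⇒~ h≈ph′) (*-congˡ-~ p≉0 s≉0 h′~)))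
            (ℤₚ.-1*i≡-i (ε s)))
          (≡.sym (ℤₚ.neg-distribʳ-* (𝟙 (h′ ~? product s)) (ε s)))
          where s≉0 = product-≉0 (sublists-All irrs′ s∈)

        rest : ℤ.- sumℤ (sublists ps) (λ s → 𝟙 (h′ ~? product s) ℤ.* ε s) ≡ μ h
        rest with p ∣? h′
        ... | no p∤h′ = ≡.trans
          (≡.cong ℤ.-_ (sum-sublists-μ h′≉0 irrs′ dist′ (covers′ p∤h′ (λ r∣h′ → ∣-respʳ (sym h≈ph′) (x∣ʳy⇒x∣ʳzy p r∣h′)))))
          (≡.sym (≡.trans (μ-~ (*-≉0 p≉0 h′≉0) (≈⇒~ h≈ph′)) (μ-∤ irr h′≉0 p∤h′)))
        -- The induction hypothesis does not apply, since `ps` no longer covers the divisor `p` of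
        -- `h′`. But no product of a sublist of `ps` is divisible by `p`, so every term is zero.
        ... | yes p∣h′ = ≡.trans
          (≡.cong ℤ.-_ (sum-zero-∈ (sublists ps) (λ {s} s∈ → ≡.cong (ℤ._* ε s)
            (𝟙-no (h′ ~? product s) (λ h′~ → p∤sublist s∈ (∣-~ʳ h′~ p∣h′))))))
          (≡.sym (≡.trans (μ-~ (*-≉0 p≉0 h′≉0) (≈⇒~ h≈ph′)) (μ-∣ irr h′≉0 p∣h′)))

    open Counting U using (concatMap-representatives)

    module _ {E J : Tuple k → List Carrier}
      (E-reps : ∀ m → Representatives _~_ (HasDegree m) (E m))
      (J-reps : ∀ m → Representatives _~_ (λ x → HasDegree m x × Irreducible x) (J m))
      where
      open Representatives

      -- Each irreducible carries its degree, so that the degree of a product can be read off the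
      -- list of its factors.
      tagged : Tuple k → List (Tuple k × Carrier)
      tagged i = List.map (i ,_) (J i)

      möbiusSum-formula : ∀ (I : Tuple k → ℕ) → (∀ i → length (J i) ≡ I i) → ∀ d →
        sumℤ (E d) μ ≡ sumℤ (families d) (λ a → -1ℤ ℤ.^ Vec.sum a ℤ.*
          + Vec.foldr _ ℕ._*_ 1 (zipWith (λ aᵢ i → I i C aᵢ) a (fromList (positive d))))
      möbiusSum-formula I lengths d = begin
        sumℤ (E d) μ
          ≡⟨ sum-cong-∈ (E d) (λ {h} h∈ → expand h (All.lookup (sound (E-reps d)) h∈)) ⟨
        sumℤ (E d) (λ h → sumℤ S (λ s → 𝟙 (h ~? product (polys s)) ℤ.* sign s))
          ≡⟨ sum-swap (E d) S (λ h s → 𝟙 (h ~? product (polys s)) ℤ.* sign s) ⟩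
        sumℤ S (λ s → sumℤ (E d) (λ h → 𝟙 (h ~? product (polys s)) ℤ.* sign s))
          -- For fixed `s`, exactly one `h` in `E d` is associated to the product of `s` if the
          -- total degree of `s` is `d`, and none otherwise.
          ≡⟨ sum-cong-∈ S (λ {s} s∈ → ≡.trans (sum-*ʳ (E d) (sign s) (λ h → 𝟙 (h ~? product (polys s))))
               (≡.cong (ℤ._* sign s) (products (sublists-All tagged-degrees s∈)))) ⟩
        sumℤ S (λ s → w (totalDegree s) (length s))
          ≡⟨ sum-blocks (Vec.sum d) tagged (λ i → Allₚ.map⁺ (All.tabulate (λ _ → ≡.refl)))
               I (λ i → ≡.trans (Listₚ.length-map (i ,_) (J i)) (lengths i)) (positive d) positive-≢𝟘 w vanishing ⟩
        sumℤ as (λ a → w (weight d a) (Vec.sum a) ℤ.* + binomials a)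
          ≡⟨ sum-cong as (λ a → ℤₚ.*-assoc (𝟙 (weight d a ≟ᵗ d)) (-1ℤ ℤ.^ Vec.sum a) (+ binomials a)) ⟩
        sumℤ as (λ a → 𝟙 (weight d a ≟ᵗ d) ℤ.* (-1ℤ ℤ.^ Vec.sum a ℤ.* + binomials a))
          ≡⟨ sum-filter (λ a → weight d a ≟ᵗ d) as (λ a → -1ℤ ℤ.^ Vec.sum a ℤ.* + binomials a) ⟨
        sumℤ (families d) (λ a → -1ℤ ℤ.^ Vec.sum a ℤ.* + binomials a) ∎
        where
        open ≡-Reasoning
        as = box (replicate (length (positive d)) (Vec.sum d))
        S = sublists (concatMap tagged (positive d))

        polys : List (Tuple k × Carrier) → List Carrier
        polys = List.map proj₂

        sign : List (Tuple k × Carrier) → ℤ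
        sign s = -1ℤ ℤ.^ length s

        w : Tuple k → ℕ → ℤ
        w t c = 𝟙 (t ≟ᵗ d) ℤ.* -1ℤ ℤ.^ c

        binomials : Family d → ℕ
        binomials a = Vec.foldr _ ℕ._*_ 1 (zipWith (λ aᵢ i → I i C aᵢ) a (fromList (positive d)))

        vanishing : Vanishing (Vec.sum d) w
        vanishing {i} i≢𝟘 {a} M<a t c = ≡.cong (ℤ._* -1ℤ ℤ.^ c) (𝟙-no (a ·ᵗ i +ᵗ t ≟ᵗ d)
          (λ eq → ℕₚ.<⇒≱ M<a (≡.subst (λ d → a ℕ.≤ Vec.sum d) eq (a≤sumℤ[a·i+t] a t i≢𝟘))))

        positive⁻ : ∀ {i} → i ∈ positive d → i ≢ 𝟘
        positive⁻ i∈ = proj₂ (∈ₚ.∈-filter⁻ (λ i → ¬? (i ≟ᵗ 𝟘)) {xs = box d} i∈)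

        positive-≢𝟘 : All (_≢ 𝟘) (positive d)
        positive-≢𝟘 = All.tabulate positive⁻

        irreducibles : List Carrier
        irreducibles = concatMap J (positive d)

        irreducibles-reps : Representatives _~_ (λ x → ∃[ i ] i ∈ positive d × HasDegree i x × Irreducible x) irreducibles
        irreducibles-reps = concatMap-representatives proj₁ J-reps
          (Uniqueₚ.filter⁺ (λ i → ¬? (i ≟ᵗ 𝟘)) (box-unique d))

        polys-tagged : ∀ is → polys (concatMap tagged is) ≡ concatMap J is
        polys-tagged []       = ≡.refl
        polys-tagged (i ∷ is) = ≡.trans (Listₚ.map-++ proj₂ (tagged i) (concatMap tagged is)) (≡.cong₂ _++_
          (≡.trans (≡.sym (Listₚ.map-∘ (J i))) (Listₚ.map-id (J i))) (polys-tagged is))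

        polys-sublists : ∀ xs (v : List Carrier → ℤ) → sumℤ (sublists xs) (v ∘ polys) ≡ sumℤ (sublists (polys xs)) v
        polys-sublists []       v = ≡.refl
        polys-sublists (x ∷ xs) v = ≡.trans (sum-sublists-∷ x xs (v ∘ polys)) (≡.trans
          (≡.cong₂ ℤ._+_ (polys-sublists xs v) (polys-sublists xs (v ∘ (proj₂ x ∷_))))
          (≡.sym (sum-sublists-∷ (proj₂ x) (polys xs) v)))

        tagged-degrees : All (λ x → HasDegree (proj₁ x) (proj₂ x)) (concatMap tagged (positive d))
        tagged-degrees = go (positive d)
          where
          go : ∀ is → All (λ x → HasDegree (proj₁ x) (proj₂ x)) (concatMap tagged is)
          go []       = []
          go (i ∷ is) = Allₚ.++⁺ (Allₚ.map⁺ (All.map proj₁ (sound (J-reps i)))) (go is)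

        totalDegree-correct : ∀ {s} → All (λ x → HasDegree (proj₁ x) (proj₂ x)) s → HasDegree (totalDegree s) (product (polys s))
        totalDegree-correct []       = degree-1
        totalDegree-correct (dx ∷ ds) = degree-* dx (totalDegree-correct ds)

        products : ∀ {s} → All (λ x → HasDegree (proj₁ x) (proj₂ x)) s →
          sumℤ (E d) (λ h → 𝟙 (h ~? product (polys s))) ≡ 𝟙 (totalDegree s ≟ᵗ d)
        products {s} ds with totalDegree s ≟ᵗ d
        ... | yes ≡.refl = sum-unique (_~? product (polys s)) (distinct (E-reps d))
          (λ _ _ x~ y~ → ~-trans x~ (~-sym y~)) (Any.map ~-sym (complete (E-reps d) (totalDegree-correct ds)))
        ... | no  ≢d     = sum-none (_~? product (polys s)) (E d) (λ h∈ h~ → ≢d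
          (degree-unique (totalDegree-correct ds) (degree-~ (~-sym h~) (All.lookup (sound (E-reps d)) h∈))))

        expand : ∀ h → HasDegree d h → sumℤ S (λ s → 𝟙 (h ~? product (polys s)) ℤ.* sign s) ≡ μ h
        expand h dh = begin
          sumℤ S (λ s → 𝟙 (h ~? product (polys s)) ℤ.* sign s)
            ≡⟨ sum-cong S (λ s → ≡.cong (λ n → 𝟙 (h ~? product (polys s)) ℤ.* -1ℤ ℤ.^ n) (≡.sym (Listₚ.length-map proj₂ s))) ⟩
          sumℤ S (λ s → 𝟙 (h ~? product (polys s)) ℤ.* ε (polys s))
            ≡⟨ polys-sublists (concatMap tagged (positive d)) (λ s → 𝟙 (h ~? product s) ℤ.* ε s) ⟩
          sumℤ (sublists (polys (concatMap tagged (positive d)))) (λ s → 𝟙 (h ~? product s) ℤ.* ε s)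
            ≡⟨ ≡.cong (λ ps → sumℤ (sublists ps) (λ s → 𝟙 (h ~? product s) ℤ.* ε s)) (polys-tagged (positive d)) ⟩
          sumℤ (sublists irreducibles) (λ s → 𝟙 (h ~? product s) ℤ.* ε s)
            ≡⟨ sum-sublists-μ (degree⇒≉0 dh) (All.map (λ (_ , _ , _ , irr) → irr) (sound irreducibles-reps))
                 (distinct irreducibles-reps) covers ⟩
          μ h ∎
          where
          covers : ∀ {p} → Irreducible p → p ∣ h → Any (p ~_) irreducibles
          covers {p} irr (u , up≈h) with a , b , _ , dp , a+b≡d ← factorDegrees dh up≈h =
            complete irreducibles-reps (b , ∈ₚ.∈-filter⁺ (λ i → ¬? (i ≟ᵗ 𝟘)) (∈-box⁺ b≤d) b≢𝟘 , dp , irr)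
            where
            b≤d : b ≤ᵗ d
            b≤d = ≡.subst (b ≤ᵗ_) (≡.trans (+ᵗ-comm b a) a+b≡d) (≤ᵗ-+ˡ b a)
            b≢𝟘 : b ≢ 𝟘
            b≢𝟘 ≡.refl = Irreducible.p∤1 irr (~⇒∣ (degree-𝟘⇒~1 dp))

-- Finite setoids and lists

module _ (S : Setoid 0ℓ 0ℓ) where
  open Setoid S renaming (Carrier to X)

  lookup-injective : ∀ {xs} → AllPairs (λ x y → ¬ x ≈ y) xs → ∀ i j → List.lookup xs i ≈ List.lookup xs j → i ≡ j
  lookup-injective {_ ∷ _} _          zero    zero    _  = ≡.refl
  lookup-injective {_ ∷ _} (x≉ ∷ _)   zero    (suc j) eq = contradiction eq (All.lookup x≉ (∈ₚ.∈-lookup j))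
  lookup-injective {_ ∷ _} (x≉ ∷ _)   (suc i) zero    eq = contradiction (sym eq) (All.lookup x≉ (∈ₚ.∈-lookup i))
  lookup-injective {_ ∷ _} (_ ∷ dist) (suc i) (suc j) eq = ≡.cong suc (lookup-injective dist i j eq)

-- Removing repetitions up to `≈` makes indexing injective, so `size` counts classes and not list
-- entries.
finite-fromList : (S : Setoid 0ℓ 0ℓ) → let open Setoid S in
                  Decidable _≈_ → (xs : List Carrier) → (∀ x → Any (x ≈_) xs) → Finite S
finite-fromList S _≈?_ xs complete = record
  { size        = length ys
  ; enumeration = record
    { to        = List.lookup ys
    ; from      = index
    ; to-cong   = λ { ≡.refl → refl }
    ; from-cong = λ {x} {y} x≈y → injective (index x) (index y)
                    (trans (sym (lookup-index x)) (trans x≈y (lookup-index y)))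
    ; inverse   = (λ { {x} ≡.refl → sym (lookup-index x) })
                , (λ {i} {x} x≈ → injective (index x) i (trans (sym (lookup-index x)) x≈))
    }
  }
  where
  open Setoid S renaming (Carrier to X)
  decSetoid : DecSetoid 0ℓ 0ℓ
  decSetoid = record { isDecEquivalence = record { isEquivalence = isEquivalence ; _≟_ = _≈?_ } }
  ys : List X
  ys = List.deduplicate _≈?_ xs
  injective : ∀ i j → List.lookup ys i ≈ List.lookup ys j → i ≡ j
  injective = lookup-injective S (UniqueDecSetoidₚ.deduplicate-! decSetoid xs)
  complete′ : ∀ x → Any (x ≈_) ys
  complete′ x = Anyₚ.deduplicate⁺ _≈?_ (λ b≈a x≈a → trans x≈a (sym b≈a)) (complete x)
  index : X → Fin (length ys)
  index x = Any.index (complete′ x)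
  lookup-index : ∀ x → x ≈ List.lookup ys (index x)
  lookup-index x = Anyₚ.lookup-index (complete′ x)

module _ (S : Setoid 0ℓ 0ℓ) where
  open Setoid S renaming (Carrier to X)

  module _ {Q : X → Set} (Q? : ∀ x → Dec (Q x)) where

    satisfying : List X → List (Σ X Q)
    satisfying []       = []
    satisfying (x ∷ xs) with Q? x
    ... | yes q = (x , q) ∷ satisfying xs
    ... | no  _ = satisfying xs

    satisfying⁺ : ∀ {R : X → Set} {xs} → (∀ {x} → R x → Q x) → Any R xs → Any (R ∘ proj₁) (satisfying xs)
    satisfying⁺ {xs = x ∷ _} R⇒Q any with Q? x | any
    ... | yes _ | here r  = here r
    ... | yes _ | there a = there (satisfying⁺ R⇒Q a)
    ... | no ¬q | here r  = contradiction (R⇒Q r) ¬q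
    ... | no _  | there a = satisfying⁺ R⇒Q a

  finite-Subset : Decidable _≈_ → ∀ {Q : X → Set} → (∀ x → Dec (Q x)) → (∀ {x y} → x ≈ y → Q x → Q y) →
                  (xs : List X) → (∀ x → Q x → Any (x ≈_) xs) → Finite (Subset S Q)
  finite-Subset _≈?_ {Q} Q? resp xs complete = finite-fromList (Subset S Q) (λ x y → proj₁ x ≈? proj₁ y) (satisfying Q? xs)
    (λ (x , q) → satisfying⁺ Q? {R = x ≈_} (λ x≈y → resp x≈y q) (complete x q))

  module _ (fin : Finite S) where
    open Finite fin

    length-elements : length elements ≡ size
    length-elements = Listₚ.length-tabulate (Inverse.to enumeration)

    elements-distinct : AllPairs (λ x y → ¬ x ≈ y) elements
    elements-distinct = AllPairsₚ.tabulate⁺ λ {i} {j} i≢j eq → i≢j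
      (≡.trans (≡.sym (Inverse.strictlyInverseʳ enumeration i))
        (≡.trans (Inverse.from-cong enumeration eq) (Inverse.strictlyInverseʳ enumeration j)))

    elements-complete : ∀ x → Any (x ≈_) elements
    elements-complete x = Anyₚ.tabulate⁺ (Inverse.from enumeration x) (sym (Inverse.strictlyInverseˡ enumeration x))

-- Counting data for polynomials and the two formulas

open import Data.Integer.Base using (_*_; _^_)
open import Data.List.Base using (filter)
open import Data.Nat.Base using (_≤_)
open import Data.Vec.Base using (sum)

module _ {q : ℕ} (F : FiniteField q) (k : ℕ) where
  open Polynomials F k hiding (_+_; _*_; product)
  private
    module PF = PolynomialFacts F k
    nzd = poly-noZeroDivisors F k

  polyUFD : GradedUFD k
  polyUFD = record
    { commutativeRing  = PolynomialRing.polyRing F k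
    ; _~_              = _~_
    ; HasDegree        = HasDegree
    ; noZeroDivisors   = nzd
    ; _∣?_             = PF._∣?_ nzd
    ; _~?_             = PF._~?_
    ; splits           = λ {p} → poly-irreducible-splits F k {p}
    ; factorize        = λ {f} → PF.factorize nzd {f}
    ; ~-isEquivalence  = Setoid.isEquivalence Normalized
    ; ≈⇒~              = λ {f} {g} → PF.≈⇒~ {f} {g}
    ; ~⇒∣              = λ {f} {g} f~g → PF.~⇒∣ {g} {f} (Setoid.sym Normalized {f} {g} f~g)
    ; degree           = λ {f} → PF.HasDegree-exists {f}
    ; degree⇒≉0        = proj₁
    ; degree-unique    = λ {m} {n} {f} → PF.HasDegree-unique {f} {m} {n}
    ; degree-~         = λ {m} {f} {g} → PF.HasDegree-~ {m} {f} {g}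
    ; degree-*         = λ {m} {n} {f} {g} → PF.HasDegree-* nzd {m} {n} {f} {g}
    ; factorDegrees    = λ {m} {f} {g} {h} → PF.factorDegrees nzd {m} {f} {g} {h}
    ; degree-1         = PF.const-HasDegree (FiniteField.1≢0 F)
    ; degree-𝟘⇒~1      = λ {f} → PF.HasDegree-𝟘⇒~1 {f}
    ; ∣∧degree⇒~       = λ {m} {f} {g} → PF.∣∧HasDegree⇒~ nzd {m} {f} {g}
    }

  private
    module UF = UniqueFactorization polyUFD

  open Finite using (elements)

  𝒩-finite′ : ∀ m → Finite (𝒩 m)
  𝒩-finite′ m = finite-Subset Normalized PF._~?_ (PF.hasDegree? m)
    (λ {f} {g} f~g → PF.HasDegree-~ {m} {g} {f} (Setoid.sym Normalized {f} {g} f~g))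
    (PF.polysIn m)
    (λ f d → Any.map (λ {g} → PF.≈⇒~ {f} {g}) (PF.polysIn-complete f m (PF.HasDegree⇒Support {m} {f} d)))

  ~𝒩? : ∀ m → Decidable (Setoid._≈_ (𝒩 m))
  ~𝒩? m (f , _) (g , _) = f PF.~? g

  IrreducibleIn𝒩-finite′ : ∀ m → Finite (IrreducibleIn𝒩 m)
  IrreducibleIn𝒩-finite′ m = finite-Subset (𝒩 m) (~𝒩? m) (λ (f , d) → UF.irreducible? {f} (proj₁ d))
    (λ {(f , _)} {(g , _)} f~g → UF.irreducible-~ {g} {f} (Setoid.sym Normalized {f} {g} f~g))
    (elements (𝒩-finite′ m)) (λ f _ → elements-complete (𝒩 m) (𝒩-finite′ m) f)

  CoprimePairs-finite′ : ∀ m n → Finite (CoprimePairs m n)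
  CoprimePairs-finite′ m n = finite-Subset (𝒩 m ×ₛ 𝒩 n) (×-decidable (~𝒩? m) (~𝒩? n))
    (λ ((f , d) , (g , _)) → Counting.coprime? polyUFD {f} {g} (proj₁ d))
    (λ { {(f , _) , (g , _)} {(f′ , _) , (g′ , _)} (f~f′ , g~g′) coprime {z} z∣f′ z∣g′ → coprime {z}
         (UF.∣-~ʳ {z} {f′} {f} (Setoid.sym Normalized {f} {f′} f~f′) z∣f′)
         (UF.∣-~ʳ {z} {g′} {g} (Setoid.sym Normalized {g} {g′} g~g′) z∣g′) })
    (List.cartesianProduct (elements (𝒩-finite′ m)) (elements (𝒩-finite′ n)))
    (λ (f , g) _ → Anyₚ.cartesianProduct⁺ (elements-complete (𝒩 m) (𝒩-finite′ m) f) (elements-complete (𝒩 n) (𝒩-finite′ n) g))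

  -- Ensures that formulas asserted for all counting data are not vacuous.
  countingData : CountingData
  countingData = record
    { 𝒩-finite              = 𝒩-finite′
    ; IrreducibleIn𝒩-finite = IrreducibleIn𝒩-finite′
    ; CoprimePairs-finite   = CoprimePairs-finite′
    ; μ                     = λ h → UF.möbius {h} (h PF.≈? 0ₚ)
    ; isMöbius              = record { distinct = M.distinct ; square = M.square }
    }
    where module M = UF.IsMöbiusFunction (UF.möbius-isMöbius (λ h → h PF.≈? 0ₚ))

  module _ (D : CountingData) where
    open CountingData D

    private
      isMöbiusFunction : UF.IsMöbiusFunction μ
      isMöbiusFunction = record { distinct = IsMöbius.distinct isMöbius ; square = IsMöbius.square isMöbius }

      -- The representatives are taken from the given `D`, so that the formulas hold for every
      -- choice of enumerations and not just for `countingData`.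
      E : Tuple k → List Poly
      E m = List.map proj₁ (elements (𝒩-finite m))

      E-reps : ∀ m → Representatives _~_ (HasDegree m) (E m)
      E-reps m = record
        { sound    = Allₚ.map⁺ (All.tabulate (λ {x} _ → proj₂ x))
        ; distinct = AllPairsₚ.map⁺ (elements-distinct (𝒩 m) (𝒩-finite m))
        ; complete = λ {f} d → Anyₚ.map⁺ (elements-complete (𝒩 m) (𝒩-finite m) (f , d))
        }

      length-E : ∀ m → length (E m) ≡ N m
      length-E m = ≡.trans (Listₚ.length-map proj₁ (elements (𝒩-finite m))) (length-elements (𝒩 m) (𝒩-finite m))

      sum-E : ∀ d → sumℤ (E d) μ ≡ A d
      sum-E d = sum-map proj₁ (elements (𝒩-finite d)) μ

      J : Tuple k → List Poly
      J m = List.map (proj₁ ∘ proj₁) (elements (IrreducibleIn𝒩-finite m))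

      J-reps : ∀ m → Representatives _~_ (λ f → HasDegree m f × Irreducible f) (J m)
      J-reps m = record
        { sound    = Allₚ.map⁺ (All.tabulate (λ {((_ , d) , irr)} _ → d , irr))
        ; distinct = AllPairsₚ.map⁺ (elements-distinct (IrreducibleIn𝒩 m) (IrreducibleIn𝒩-finite m))
        ; complete = λ {f} (d , irr) → Anyₚ.map⁺ (elements-complete (IrreducibleIn𝒩 m) (IrreducibleIn𝒩-finite m) ((f , d) , irr))
        }

      length-J : ∀ m → length (J m) ≡ I m
      length-J m = ≡.trans (Listₚ.length-map (proj₁ ∘ proj₁) (elements (IrreducibleIn𝒩-finite m)))
        (length-elements (IrreducibleIn𝒩 m) (IrreducibleIn𝒩-finite m))

    P-formula : ∀ m n → + P m n ≡ ∑[ d ∈ filter (_≤ᵗ? n) (box m) ] (+ N (m ∸ᵗ d) * + N (n ∸ᵗ d) * A d)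
    P-formula m n = begin
      + P m n
        ≡⟨ ≡.cong +_ (≡.trans (Listₚ.length-map pair (elements (CoprimePairs-finite m n)))
                              (length-elements (CoprimePairs m n) (CoprimePairs-finite m n))) ⟨
      + length (List.map pair (elements (CoprimePairs-finite m n)))
        ≡⟨ Counting.coprimePairs-formula polyUFD E-reps isMöbiusFunction m n pairs-reps ⟩
      ∑[ d ∈ ds ] (+ length (E (m ∸ᵗ d)) * + length (E (n ∸ᵗ d)) * sumℤ (E d) μ)
        ≡⟨ sum-cong ds (λ d → ≡.cong₂ _*_ (≡.cong₂ (λ a b → + a * + b) (length-E (m ∸ᵗ d)) (length-E (n ∸ᵗ d))) (sum-E d)) ⟩
      ∑[ d ∈ ds ] (+ N (m ∸ᵗ d) * + N (n ∸ᵗ d) * A d) ∎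
      where
      open ≡-Reasoning
      ds = filter (_≤ᵗ? n) (box m)
      pair : Setoid.Carrier (CoprimePairs m n) → Poly × Poly
      pair (((f , _) , (g , _)) , _) = f , g
      pairs-reps : Representatives (λ (f , g) (f′ , g′) → f ~ f′ × g ~ g′)
        (λ (f , g) → HasDegree m f × HasDegree n g × Coprime f g) (List.map pair (elements (CoprimePairs-finite m n)))
      pairs-reps = record
        { sound    = Allₚ.map⁺ (All.tabulate (λ {(((_ , df) , (_ , dg)) , coprime)} _ → df , dg , λ {z} → coprime {z}))
        ; distinct = AllPairsₚ.map⁺ (elements-distinct (CoprimePairs m n) (CoprimePairs-finite m n))
        ; complete = λ { {f , g} (df , dg , coprime) →
            Anyₚ.map⁺ (elements-complete (CoprimePairs m n) (CoprimePairs-finite m n) (((f , df) , (g , dg)) , λ {z} → coprime {z})) }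
        }

    A-formula : ∀ d → A d ≡ ∑[ a ∈ families d ] (-1ℤ ^ sum a * + binomialProduct d a)
    A-formula d = ≡.trans (≡.sym (sum-E d))
      (MöbiusSum.möbiusSum-formula polyUFD isMöbiusFunction E-reps J-reps I length-J d)

mainTheorem10 : (q : ℕ) → IsPrimePower q → (F : FiniteField q) → (k : ℕ) → 1 ≤ k →
    Polynomials.CountingData F k ×
    ((D : Polynomials.CountingData F k) → let open Polynomials.CountingData D in
    ((m n : Tuple k) →
    + P m n ≡ ∑[ d ∈ filter (_≤ᵗ? n) (box m) ]
    (+ N (m ∸ᵗ d) * + N (n ∸ᵗ d) * A d))
    ×
    ((d : Tuple k) →
    A d ≡ ∑[ a ∈ families d ] (-1ℤ ^ sum a * + binomialProduct d a)))
mainTheorem10 q _ F k _ = countingData F k , λ D → P-formula F k D , A-formula F k D
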